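{- Let $k\leq n$ and $d$ be positive integers, let $\lambda\vdash nd$, $\mu\vdash kd$ with $\mu\subset\lambda$, and let $F:D_\lambda\to[n]$ be a Young$^d_n$ tableau with $F^{ -1}([k])=D_\mu$. Let $\mathcal{G}$ be the set of Young$^d_n$ tableaux $G:D_\lambda\to[n]$ such that (1) $G^{ -1}(i)\preceq F^{ -1}(i)$ for all $i\in[k]$, with $G^{ -1}(i)\prec F^{ -1}(i)$ for at least one $i\in[k]$; and (2) $G^{ -1}([k])=D_\delta$ for some partition $\delta\subset\lambda$. Writing $F_0=F|_{D_\mu}$, we have in $\mathscr{S}^{(d)}$ \[[F]\in\mathscr{I}([F_0])+\mathscr{I}([G]:G\in\mathcal{G}),\] and in particular, writing $G_0$ for the restriction of $G$ to $G^{ -1}([k])$, \[[F]\in\mathscr{I}([F_0])+\mathscr{I}([G_0]:G\in\mathcal{G}).\]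
   Context: $\mathbb{K}$ is a field of characteristic zero; $[n]=\{1,\dots,n\}$; permutations are multiplied by composition. A Young tableau of shape $\lambda$ with entries in $A$ is a bijection $T:D_\lambda\to A$, $D_\lambda=\{(i,j):1\leq j\leq\lambda_i\}$, with rows $R_i(T)$ and columns $C_j(T)$; $\mathfrak{c}_\lambda(T)=\prod_i\mathfrak{a}(R_i(T))\cdot\prod_j\mathfrak{b}(C_j(T))\in\mathbb{K}[\mathfrak{S}_A]$, where $\mathfrak{a}(X)=\sum_{\sigma\in\mathfrak{S}_X}\sigma$, $\mathfrak{b}(X)=\sum_{\tau\in\mathfrak{S}_X}\mathrm{sgn}(\tau)\tau$. The algebra $\mathscr{S}^{(d)}$ assigns to each finite set $A$ with $|A|=md$ the vector space $\mathscr{S}^{(d)}_A$ with basis the monomials $z_{\underline{A}}=z_{A_1}\cdots z_{A_m}$ in commuting variables $z_{A_i}$, where $\underline{A}$ runs over the set partitions $A=A_1\sqcup\cdots\sqcup A_m$ with $|A_i|=d$; bijections $\phi:A\to A'$ act by $z_{A_1}\cdots z_{A_m}\mapsto z_{\phi(A_1)}\cdots z_{\phi(A_m)}$ (so $\mathbb{K}[\mathfrak{S}_A]$ acts on $\mathscr{S}^{(d)}_A$), and for disjoint $A,B$ the product $\mathscr{S}^{(d)}_A\otimes\mathscr{S}^{(d)}_B\to\mathscr{S}^{(d)}_{A\sqcup B}$ is multiplication of monomials. An ideal is a family of subspaces $\mathscr{I}_A\subseteq\mathscr{S}^{(d)}_A$ preserved by the maps induced by bijections with $\mathscr{I}_A\cdot\mathscr{S}^{(d)}_B\subseteq\mathscr{I}_{A\sqcup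 B}$; generated ideals and sums are as usual. A Young$^d_n$ tableau of shape $\lambda\vdash nd$ is a function $F:D_\lambda\to[n]$ with $|F^{ -1}(i)|=d$ for all $i\in[n]$. For a Young tableau $T:D_\lambda\to A$, $T\circ F^{ -1}$ denotes the partition $\underline{A}$ with $A_i=T(F^{ -1}(i))$; the Young$^d_n$ tabloid $[F]$ is the collection of elements $t_F(A,T)=\mathfrak{c}_\lambda(T)\cdot z_{T\circ F^{ -1}}\in\mathscr{S}^{(d)}_A$ over all $A$ with $|A|=nd$ and all Young tableaux $T:D_\lambda\to A$; $\mathscr{I}([F])$ is the ideal generated by these elements. (Restrictions of $F$ or $G$ to the preimage of $[k]$ are Young$^d_k$ tableaux, with tabloids defined in the same way.) For $d$-element sets of boxes $X=\{(x_i,y_i)\}_{i\in[d]}$, $X'=\{(x'_i,y'_i)\}_{i\in[d]}$ indexed so that $y_1\leq\cdots\leq y_d$ and $y'_1\leq\cdots\leq y'_d$, write $X\preceq X'$ if $y_i\leq y'_i$ for all $i$, and $X\prec X'$ if $X\preceq X'$ and $y_i<y'_i$ for some $i$. -}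

module Defs where

open import Level using (Level; _⊔_) renaming (suc to lsuc)
open import Data.Nat using (ℕ; zero; suc; _+_; _*_; _≤_; _<_; _≡ᵇ_; _<ᵇ_; _≟_; _<?_)
open import Data.Nat.Properties using (≤-decTotalOrder)
open import Data.Fin using (Fin; toℕ; splitAt) renaming (zero to fzero)
open import Data.Fin.Properties using (toℕ<n)
open import Data.Fin.Permutation using (Permutation′; _⟨$⟩ʳ_; _⟨$⟩ˡ_; _∘ₚ_; lift₀; transpose)
                                 renaming (id to idₚ)
open import Data.List using (List; []; _∷_; [_]; map; filterᵇ; concatMap; filter; length; lookup; allFin; upTo; foldr; zip; _++_)
open import Data.Bool.ListAction using (all)
open import Data.Nat.ListAction using (sum)
open import Data.List.Relation.Binary.Pointwise using (Pointwise)
open import Data.List.Relation.Unary.All using (All)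
open import Data.List.Relation.Unary.Any using (Any)
open import Data.List.Sort using (sort)
open import Data.Bool using (Bool; true; false; if_then_else_; not; _xor_; _∧_)
open import Data.Product using (Σ; ∃; _×_; _,_; proj₁; proj₂; uncurry)
open import Data.Sum using (_⊎_; [_,_]′)
open import Function using (_∘_; _↔_; _⇔_; Inverse)
open import Relation.Binary.PropositionalEquality using (_≡_)
open import Relation.Nullary using (¬_)
open import Algebra.Bundles using (CommutativeRing)

record Field (c ℓ : Level) : Set (lsuc (c ⊔ ℓ)) where
  field
    commutativeRing : CommutativeRing c ℓ
  open CommutativeRing commutativeRing
    using (Carrier; _≈_; 0#; 1#) renaming (_*_ to _·_)
  field
    1≉0     : ¬ (1# ≈ 0#)
    inverse : ∀ x → ¬ (x ≈ 0#) → Σ Carrier (λ y → (x · y) ≈ 1#)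

module _ {c ℓ : Level} (K : Field c ℓ) where
  open CommutativeRing (Field.commutativeRing K)
    using (Carrier; _≈_; 0#; 1#) renaming (_+_ to _+ᴷ_)

  natK : ℕ → Carrier
  natK zero    = 0#
  natK (suc n) = 1# +ᴷ natK n

  CharZero : Set ℓ
  CharZero = ∀ n → ¬ (natK (suc n) ≈ 0#)

-- Partitions and Young diagrams (rows and columns indexed from 0)

_!_ : List ℕ → ℕ → ℕ
[]       ! _     = 0
(x ∷ xs) ! zero  = x
(x ∷ xs) ! suc i = xs ! i

data IsPartition : List ℕ → Set where
  []  : IsPartition []
  single : ∀ {x} → 1 ≤ x → IsPartition (x ∷ [])
  _∷_ : ∀ {x y ys} → y ≤ x → IsPartition (y ∷ ys) → IsPartition (x ∷ y ∷ ys)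

_⊢_ : List ℕ → ℕ → Set
λ' ⊢ N = IsPartition λ' × sum λ' ≡ N

_⊆ᵖ_ : List ℕ → List ℕ → Set
μ ⊆ᵖ λ' = ∀ i → μ ! i ≤ λ' ! i

record Box (λ' : List ℕ) : Set where
  constructor box
  field
    row : ℕ
    col : ℕ
    col<λrow : col < λ' ! row
open Box public

_∈D_ : ∀ {λ'} → Box λ' → List ℕ → Set
b ∈D μ = col b < μ ! row b

incl : ∀ {μ λ'} → μ ⊆ᵖ λ' → Box μ → Box λ'
incl sub (box i j p) = box i j (Data.Nat.Properties.<-≤-trans p (sub i))
  where import Data.Nat.Properties

allBoxes : (λ' : List ℕ) → List (Box λ')
allBoxes λ' = concatMap (λ i → map (λ j → box i (toℕ j) (toℕ<n j)) (allFin (λ' ! i)))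
                        (upTo (length λ'))

fiberSize : ∀ λ' → (Box λ' → ℕ) → ℕ → ℕ
fiberSize λ' F i = length (filter (λ b → F b ≟ i) (allBoxes λ'))

-- Young^d_n tableau of shape λ (values in [n] encoded as 0..n-1)
IsYoungTab : (d n : ℕ) (λ' : List ℕ) → (Box λ' → ℕ) → Set
IsYoungTab d n λ' F = (∀ b → F b < n) × (∀ i → i < n → fiberSize λ' F i ≡ d)

colsOf : ∀ λ' → (Box λ' → ℕ) → ℕ → List ℕ
colsOf λ' F i = sort ≤-decTotalOrder (map col (filter (λ b → F b ≟ i) (allBoxes λ')))

_⪯_ : List ℕ → List ℕ → Set
ys ⪯ ys' = Pointwise _≤_ ys ys'

_≺_ : List ℕ → List ℕ → Set
ys ≺ ys' = ys ⪯ ys' × Any (uncurry _<_) (zip ys ys')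

allPerms : (N : ℕ) → List (Permutation′ N)
allPerms zero    = idₚ ∷ []
allPerms (suc N) = concatMap (λ i → map (λ π → lift₀ π ∘ₚ transpose fzero i) (allPerms N))
                             (allFin (suc N))

inversions : ∀ {N} → Permutation′ N → ℕ
inversions {N} π =
  length (filterᵇ (λ ab → ab)
    (concatMap (λ a → map (λ b → (toℕ a <ᵇ toℕ b) ∧ (toℕ (π ⟨$⟩ʳ b) <ᵇ toℕ (π ⟨$⟩ʳ a)))
                          (allFin N)) (allFin N)))

-- The algebra 𝒮^(d) on the canonical finite sets A = Fin N
--
-- A monomial z_{A_1}⋯z_{A_m} on Fin N is encoded by a labelling
-- f : Fin N → ℕ whose fibres are the blocks A_i; two labellings encode
-- the same monomial iff they have the same kernel.  An element of
-- 𝒮^(d)_{Fin N} is a finite formal K-linear combination of monomials.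

Label : ℕ → Set
Label N = Fin N → ℕ

WFLabel : (d N : ℕ) → Label N → Set
WFLabel d N f = ∀ a → length (filter (λ b → f b ≟ f a) (allFin N)) ≡ d

sameKernel : ∀ {N} → Label N → Label N → Bool
sameKernel {N} f g =
  all (λ a → all (λ b → not ((f a ≡ᵇ f b) xor (g a ≡ᵇ g b))) (allFin N)) (allFin N)

-- the action of a bijection φ : z_{A_1}⋯ ↦ z_{φ(A_1)}⋯  (label f ∘ φ⁻¹)
actL : ∀ {N} → Permutation′ N → Label N → Label N
actL φ f a = f (φ ⟨$⟩ˡ a)

mulL : ∀ {N M} → Label N → Label M → Label (N + M)
mulL {N} f g x = [ (λ a → 2 * f a) , (λ b → suc (2 * g b)) ]′ (splitAt N x)

module Algebra𝒮 {c ℓ : Level} (K : Field c ℓ) (d : ℕ) where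
  open CommutativeRing (Field.commutativeRing K)
    using (Carrier; _≈_; 0#; 1#; -_) renaming (_+_ to _+ᴷ_; _*_ to _*ᴷ_)

  Elem : ℕ → Set c
  Elem N = List (Carrier × Label N)

  WF : ∀ {N} → Elem N → Set c
  WF {N} v = All (λ t → WFLabel d N (proj₂ t)) v

  coeff : ∀ {N} → Elem N → Label N → Carrier
  coeff v g = foldr (λ t acc → if sameKernel (proj₂ t) g then proj₁ t +ᴷ acc else acc) 0# v

  _≋_ : ∀ {N} → Elem N → Elem N → Set ℓ
  v ≋ w = ∀ g → coeff v g ≈ coeff w g

  _•_ : ∀ {N} → Carrier → Elem N → Elem N
  x • v = map (λ t → (x *ᴷ proj₁ t , proj₂ t)) v

  _⊙_ : ∀ {N} → Permutation′ N → Elem N → Elem N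
  φ ⊙ v = map (λ t → (proj₁ t , actL φ (proj₂ t))) v

  _⊗_ : ∀ {N M} → Elem N → Elem M → Elem (N + M)
  v ⊗ w = concatMap (λ s → map (λ t → (proj₁ s *ᴷ proj₁ t , mulL (proj₂ s) (proj₂ t))) w) v

  data InIdeal (Gen : (N : ℕ) → Elem N → Set (c ⊔ ℓ)) : (N : ℕ) → Elem N → Set (c ⊔ ℓ) where
    gen   : ∀ {N v} → Gen N v → InIdeal Gen N v
    zero  : ∀ {N} → InIdeal Gen N []
    add   : ∀ {N v w} → InIdeal Gen N v → InIdeal Gen N w → InIdeal Gen N (v ++ w)
    scale : ∀ {N v} (x : Carrier) → InIdeal Gen N v → InIdeal Gen N (x • v)
    act   : ∀ {N v} (φ : Permutation′ N) → InIdeal Gen N v → InIdeal Gen N (φ ⊙ v)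
    mul   : ∀ {N M v} (w : Elem M) → WF w → InIdeal Gen N v → InIdeal Gen (N + M) (v ⊗ w)
    resp  : ∀ {N v w} → v ≋ w → InIdeal Gen N v → InIdeal Gen N w

  sgn : ∀ {N} → Permutation′ N → Carrier
  sgn π = if even? (inversions π) then 1# else - 1#
    where
    even? : ℕ → Bool
    even? zero          = true
    even? (suc zero)    = false
    even? (suc (suc n)) = even? n

  rowGroup colGroup : ∀ {N} λ' → (Box λ' ↔ Fin N) → List (Permutation′ N)
  rowGroup {N} λ' T = filterᵇ (λ σ → all (λ a → row (Inverse.from T (σ ⟨$⟩ʳ a)) ≡ᵇ row (Inverse.from T a)) (allFin N)) (allPerms N)
  colGroup {N} λ' T = filterᵇ (λ σ → all (λ a → col (Inverse.from T (σ ⟨$⟩ʳ a)) ≡ᵇ col (Inverse.from T a)) (allFin N)) (allPerms N)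

  -- c_λ(T) · v = ∏ a(R_i(T)) ∏ b(C_j(T)) · v = Σ_{σ∈R(T)} Σ_{τ∈C(T)} sgn(τ) (σ∘τ)·v
  youngSym : ∀ {N} λ' → (Box λ' ↔ Fin N) → Elem N → Elem N
  youngSym λ' T v = concatMap (λ σ → concatMap (λ τ → sgn τ • (σ ⊙ (τ ⊙ v))) (colGroup λ' T)) (rowGroup λ' T)

  -- t_F(A,T) = c_λ(T) · z_{T∘F⁻¹}
  tabloidElem : ∀ {N} λ' → (Box λ' → ℕ) → (Box λ' ↔ Fin N) → Elem N
  tabloidElem λ' F T = youngSym λ' T ((1# , (λ a → F (Inverse.from T a))) ∷ [])

  TabloidGen : ∀ λ' → (Box λ' → ℕ) → (N : ℕ) → Elem N → Set (c ⊔ ℓ)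
  TabloidGen λ' F N v = Level.Lift (c ⊔ ℓ) (Σ (Box λ' ↔ Fin N) (λ T → v ≡ tabloidElem λ' F T))

  TabloidIn : ∀ λ' → (Box λ' → ℕ) → (Gen : (N : ℕ) → Elem N → Set (c ⊔ ℓ)) → Set (c ⊔ ℓ)
  TabloidIn λ' F Gen = ∀ N (T : Box λ' ↔ Fin N) → InIdeal Gen N (tabloidElem λ' F T)

PreimageIsDiagram : (k : ℕ) (λ' : List ℕ) → (Box λ' → ℕ) → List ℕ → Set
PreimageIsDiagram k λ' G δ = ∀ b → (G b < k ⇔ b ∈D δ)

In𝒢 : (k n d : ℕ) (λ' : List ℕ) (F G : Box λ' → ℕ) → Set
In𝒢 k n d λ' F G =
  IsYoungTab d n λ' G
  × (∀ i → i < k → colsOf λ' G i ⪯ colsOf λ' F i)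
  × Σ ℕ (λ i → i < k × colsOf λ' G i ≺ colsOf λ' F i)
  × Σ (List ℕ) (λ δ → IsPartition δ × δ ⊆ᵖ λ' × PreimageIsDiagram k λ' G δ)

{-# OPTIONS --safe #-}
module Submission where

{-
Let A₀ be the set of entries of T in D_μ and S the restriction of T to D_μ. The ideal of [F₀] contains
c_μ(S)·z_F, hence also c_λ(T) c_μ(S)·z_F. If an entry p lies in a column to the right of column j, then
c_λ(T) = Σ_x c_λ(T)·(x p), x running through the entries of column j. Applied to the entries of A₀ lying to
the right of their home column, and combined with the antisymmetry of c_μ(S) in the columns of S, this gives
c_λ(T) c_μ(S) = α c_λ(T) + Σ_π m_π c_λ(T) π, where in every term π no entry of A₀ moves to the right and
some entry moves strictly to the left. The scalar α does not depend on λ, so the case λ = μ shows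
c_μ(S)² = α c_μ(S), and α ≠ 0: for c_μ(S) = a b, the coefficient of the identity in (a b a)² is a sum of
squares of integers, not all zero.

In a term π the entries of A₀ need not occupy a diagram. A gap above an entry is removed by a transposition
inside the column; a gap to the left of an entry is removed by a Garnir relation, which replaces the term by
terms in which A₀ lies further to the left. Both processes terminate, and the surviving terms are tabloids of 𝒢.

The tableaux obtained in this way from some G ∈ 𝒢 belong to 𝒢 again, so the second inclusion follows from
the first by induction on the sum of the column indices of A₀.
-}

open import Defs
open import Algebra.Bundles using (CommutativeRing)
open import Data.Bool using (Bool; true; false; if_then_else_; not; _∧_; _xor_; T)
import Data.Bool.Properties as Boolₚ
open import Data.Bool.ListAction using (all)
open import Data.Fin as Fin using (Fin; toℕ; _↑ˡ_; _↑ʳ_; splitAt; join) renaming (zero to fzero; suc to fsuc)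
import Data.Fin.Properties as Finₚ
open import Data.Fin.Permutation as Perm
  using (Permutation′; _⟨$⟩ʳ_; _⟨$⟩ˡ_; _∘ₚ_; lift₀; transpose; inverseˡ; inverseʳ; flip)
  renaming (id to idₚ)
open import Data.List as List
  using (List; []; _∷_; map; filter; filterᵇ; concatMap; allFin; zip; _++_; foldr; tabulate; length)
import Data.List.Properties as Listₚ
open import Data.List.Membership.Propositional using (_∈_; lose)
open import Data.List.Membership.Propositional.Properties
  using (∈-map⁺; ∈-map⁻; ∈-concatMap⁺; ∈-filter⁺; ∈-upTo⁺; ∈-allFin)
open import Data.List.Membership.Propositional.Properties.WithK using (unique∧set⇒bag)
open import Data.List.Relation.Binary.BagAndSetEquality using (∼bag⇒↭)
open import Data.List.Relation.Binary.Permutation.Propositional as ↭ using (_↭_; ↭-refl; ↭-sym; ↭-trans; ↭-swap)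
import Data.List.Relation.Binary.Permutation.Propositional.Properties as ↭ₚ
open import Data.List.Relation.Binary.Pointwise as Pointwise using (Pointwise; []; _∷_)
open import Data.List.Relation.Unary.All as All using (All; []; _∷_)
import Data.List.Relation.Unary.All.Properties as Allₚ
open import Data.List.Relation.Unary.AllPairs as AllPairs using (AllPairs; []; _∷_)
import Data.List.Relation.Unary.AllPairs.Properties as AllPairsₚ
open import Data.List.Relation.Unary.Any using (Any; here; there)
open import Data.List.Relation.Unary.Sorted.TotalOrder.Properties using (Sorted⇒AllPairs)
open import Data.List.Relation.Unary.Unique.Propositional using (Unique)
import Data.List.Relation.Unary.Unique.Propositional.Properties as Uniqueₚ
open import Data.Nat as ℕ using (ℕ; zero; suc; _≡ᵇ_; _<ᵇ_; _≤_; _<_; z≤n; s≤s)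
import Data.Nat.Properties as ℕₚ
open import Data.Nat.Induction using (<-wellFounded)
import Data.Nat.ListAction as ListAction
open import Data.Nat.ListAction.Properties using (sum-↭)
open import Data.Nat.Solver using (module +-*-Solver)
open import Data.List.Sort ℕₚ.≤-decTotalOrder using (sort; sort-↭; sort-↗)
open import Data.Parity as ℙ using (Parity; 0ℙ; 1ℙ)
import Data.Parity.Properties as ℙₚ
open import Data.Product using (Σ; _×_; _,_; proj₁; proj₂; uncurry)
open import Data.Sum as Sum using (_⊎_; inj₁; inj₂; [_,_]′; map₁)
import Data.Sum.Properties as Sumₚ
open import Function using (_∘_; _↔_; Inverse; mk⇔; Equivalence; mk↔ₛ′)
open import Induction.WellFounded using (Acc; acc)
open import Level using (Level; _⊔_; Lift; lift; lower) renaming (suc to lsuc)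
open import Relation.Binary.Definitions using (tri<; tri≈; tri>)
open import Relation.Binary.PropositionalEquality as ≡ using (_≡_; _≢_; cong; cong₂; subst)
open import Relation.Nullary using (¬_; Dec; yes; no; does; contradiction)
open import Relation.Nullary.Decidable using (dec-true; dec-false; _×-dec_; _→-dec_)
open import Algebra.Properties.CommutativeMonoid.Sum ℕₚ.+-0-commutativeMonoid
  using (sum; sum-cong-≗; ∑-distrib-+; ∑-comm; sum-permute; sum-replicate-zero)

-- Sums over lists and over permutations

-- The obstacle is that α has to be the same for λ and for μ, although it comes out of a recursion
-- and not out of a formula. A step of the recursion takes an entry y of A₀ to the right of its home
-- column and exchanges it with the entries x standing in that column. An x with the same home
-- column returns the term itself with sign -1, so the term acquires the coefficient 1 + κ with κ a
-- count, invertible in characteristic zero. An x outside A₀ lowers the sum of the columns of A₀ for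
-- good and goes into the remainder. Every other x continues the recursion. So κ and the recursive
-- terms see A₀ alone, and one run of the recursion, for T modulo the remainder and for S modulo
-- zero, gives one scalar for both. The product a b a is used because, unlike a b, it is fixed by π
-- ↦ π⁻¹: with coefficients m, the identity has in its square the coefficient Σ m(π)m(π⁻¹) = Σ
-- m(π)². If (a b)² were 0, that square would vanish too, since a a is a multiple of a. Elements of
-- the group algebra are handled as functionals, so sums in which a permutation occurs in many forms
-- are never normalized.

private variable
  a b : Level
  I : Set a
  J : Set b

module Sums {c ℓ : Level} (R : CommutativeRing c ℓ) where
  open CommutativeRing R
  open import Relation.Binary.Reasoning.Setoid setoid
  open import Algebra.Properties.CommutativeSemigroup +-commutativeSemigroup using (interchange)

  infixr 8 _▸_
  _▸_ : Bool → Carrier → Carrier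
  b ▸ x = if b then x else 0#

  ▸-cong : ∀ b {x y} → (b ≡ true → x ≈ y) → b ▸ x ≈ b ▸ y
  ▸-cong true  p = p ≡.refl
  ▸-cong false p = refl

  ▸-+ : ∀ b x y → b ▸ (x + y) ≈ b ▸ x + b ▸ y
  ▸-+ true  x y = refl
  ▸-+ false x y = sym (+-identityˡ 0#)

  ▸-*ˡ : ∀ b x y → x * (b ▸ y) ≈ b ▸ (x * y)
  ▸-*ˡ true  x y = refl
  ▸-*ˡ false x y = zeroʳ x

  ▸-comm : ∀ a b x → a ▸ b ▸ x ≈ b ▸ a ▸ x
  ▸-comm true  b x = refl
  ▸-comm false true  x = refl
  ▸-comm false false x = refl

  ▸-split : ∀ b x → x ≈ b ▸ x + not b ▸ x
  ▸-split true  x = sym (+-identityʳ x)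
  ▸-split false x = sym (+-identityˡ x)

  abstract
    ∑ : List I → (I → Carrier) → Carrier
    ∑ []       f = 0#
    ∑ (x ∷ xs) f = f x + ∑ xs f

    ∑-cong : ∀ (xs : List I) {f g} → (∀ x → f x ≈ g x) → ∑ xs f ≈ ∑ xs g
    ∑-cong []       p = refl
    ∑-cong (x ∷ xs) p = +-cong (p x) (∑-cong xs p)

    ∑-zero : ∀ (xs : List I) {f} → (∀ x → f x ≈ 0#) → ∑ xs f ≈ 0#
    ∑-zero []       p = refl
    ∑-zero (x ∷ xs) p = trans (+-cong (p x) (∑-zero xs p)) (+-identityˡ 0#)

    ∑-+ : ∀ (xs : List I) f g → ∑ xs (λ x → f x + g x) ≈ ∑ xs f + ∑ xs g
    ∑-+ []       f g = sym (+-identityˡ 0#)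
    ∑-+ (x ∷ xs) f g = trans (+-congˡ (∑-+ xs f g)) (interchange _ _ _ _)

    ∑-*ˡ : ∀ (xs : List I) k f → k * ∑ xs f ≈ ∑ xs (λ x → k * f x)
    ∑-*ˡ []       k f = zeroʳ k
    ∑-*ˡ (x ∷ xs) k f = trans (distribˡ k _ _) (+-congˡ (∑-*ˡ xs k f))

    ∑-▸ : ∀ (xs : List I) b f → b ▸ ∑ xs f ≈ ∑ xs (λ x → b ▸ f x)
    ∑-▸ xs true  f = refl
    ∑-▸ xs false f = sym (∑-zero xs λ _ → refl)

    ∑-++ : ∀ (xs ys : List I) f → ∑ (xs ++ ys) f ≈ ∑ xs f + ∑ ys f
    ∑-++ []       ys f = sym (+-identityˡ _)
    ∑-++ (x ∷ xs) ys f = trans (+-congˡ (∑-++ xs ys f)) (sym (+-assoc _ _ _))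

    ∑-filterᵇ : ∀ (p : I → Bool) xs f → ∑ (filterᵇ p xs) f ≈ ∑ xs (λ x → p x ▸ f x)
    ∑-filterᵇ p []       f = refl
    ∑-filterᵇ p (x ∷ xs) f with p x
    ... | true  = +-congˡ (∑-filterᵇ p xs f)
    ... | false = trans (∑-filterᵇ p xs f) (sym (+-identityˡ _))


    ∑-map : ∀ (m : I → J) xs f → ∑ (map m xs) f ≡ ∑ xs (f ∘ m)
    ∑-map m []       f = ≡.refl
    ∑-map m (x ∷ xs) f = cong (f (m x) +_) (∑-map m xs f)

    ∑-concatMap : ∀ (m : I → List J) xs f → ∑ (concatMap m xs) f ≈ ∑ xs (λ x → ∑ (m x) f)
    ∑-concatMap m []       f = refl
    ∑-concatMap m (x ∷ xs) f = trans (∑-++ (m x) _ f) (+-congˡ (∑-concatMap m xs f))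

    ∑-swap : ∀ (xs : List I) (ys : List J) (f : I → J → Carrier) →
             ∑ xs (λ x → ∑ ys (f x)) ≈ ∑ ys (λ y → ∑ xs (λ x → f x y))
    ∑-swap []       ys f = sym (∑-zero ys λ _ → refl)
    ∑-swap (x ∷ xs) ys f = trans (+-congˡ (∑-swap xs ys f)) (sym (∑-+ ys (f x) _))

    ∑-nil : ∀ (f : I → Carrier) → ∑ [] f ≈ 0#
    ∑-nil f = refl

    ∑-∷ : ∀ (x : I) xs f → ∑ (x ∷ xs) f ≈ f x + ∑ xs f
    ∑-∷ x xs f = refl

  module _ {a b} {I : Set a} {J : Set b} where

    -- The relation `e` is one-to-one in the sense that its indicator sums return `v`. Inserting the
    -- first such sum, interchanging, and collapsing by the second reindexes the sum; `img` marks
    -- the indices that are hit.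
    double-count : ∀ (xs : List I) (ys : List J) (e : I → J → Bool) (img : J → Bool) {f : I → Carrier} {g : J → Carrier} →
      (∀ x v → ∑ ys (λ y → e x y ▸ v) ≈ v) →
      (∀ y v → ∑ xs (λ x → e x y ▸ v) ≈ img y ▸ v) →
      (∀ x y → e x y ≡ true → f x ≈ g y) →
      ∑ xs f ≈ ∑ ys (λ y → img y ▸ g y)
    double-count xs ys e img {f} {g} p q r = begin
      ∑ xs f                                  ≈⟨ ∑-cong xs (λ x → sym (p x (f x))) ⟩
      ∑ xs (λ x → ∑ ys (λ y → e x y ▸ f x))   ≈⟨ ∑-cong xs (λ x → ∑-cong ys λ y → ▸-cong (e x y) (r x y)) ⟩
      ∑ xs (λ x → ∑ ys (λ y → e x y ▸ g y))   ≈⟨ ∑-swap xs ys _ ⟩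
      ∑ ys (λ y → ∑ xs (λ x → e x y ▸ g y))   ≈⟨ ∑-cong ys (λ y → q y (g y)) ⟩
      ∑ ys (λ y → img y ▸ g y)                ∎

  ∑-allFin-suc : ∀ N f → ∑ (allFin (suc N)) f ≈ f fzero + ∑ (allFin N) (f ∘ fsuc)
  ∑-allFin-suc N f = trans (∑-∷ fzero _ f) (+-congˡ (reflexive (≡.trans
    (cong (λ xs → ∑ xs f) (≡.sym (Listₚ.map-tabulate (λ i → i) fsuc))) (∑-map fsuc (allFin N) f))))

  ∑-δ : ∀ {N} (j : Fin N) (f : Fin N → Carrier) →
        ∑ (allFin N) (λ i → does (i Finₚ.≟ j) ▸ f i) ≈ f j
  ∑-δ {suc N} fzero f = trans (∑-allFin-suc N _)
    (trans (+-congˡ (∑-zero (allFin N) λ _ → refl)) (+-identityʳ _))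
  ∑-δ {suc N} (fsuc j) f = trans (∑-allFin-suc N _)
    (trans (+-identityˡ _) (∑-δ j (f ∘ fsuc)))

Perm : ℕ → Set
Perm = Permutation′

infix 4 _≐_
-- A permutation carries its inverse and proofs, so propositional equality is too fine. A record,
-- unlike a bare function type, lets both permutations be inferred from a proof.
record _≐_ {N} (π ρ : Perm N) : Set where
  constructor ptw
  field at : ∀ a → π ⟨$⟩ʳ a ≡ ρ ⟨$⟩ʳ a
open _≐_ public

infixr 9 _·_
-- `_∘ₚ_` applies its left argument first; this is the product in the usual order of composition.
_·_ : ∀ {N} → Perm N → Perm N → Perm N
σ · τ = τ ∘ₚ σ

true≢false : ∀ {a} {A : Set a} {b} → b ≡ true → b ≡ false → A
true≢false ≡.refl ()

does⇒ : ∀ {a} {A : Set a} (A? : Dec A) → does A? ≡ true → A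
does⇒ (yes a) _ = a

module _ {N : ℕ} where

  ≐-sym : {π ρ : Perm N} → π ≐ ρ → ρ ≐ π
  ≐-sym p = ptw λ a → ≡.sym (at p a)

  ≐-trans : {π ρ σ : Perm N} → π ≐ ρ → ρ ≐ σ → π ≐ σ
  ≐-trans p q = ptw λ a → ≡.trans (at p a) (at q a)

  ·-congˡ : ∀ (σ : Perm N) {π ρ} → π ≐ ρ → σ · π ≐ σ · ρ
  ·-congˡ σ p = ptw λ a → cong (σ ⟨$⟩ʳ_) (at p a)

  ·-congʳ : ∀ (σ : Perm N) {π ρ} → π ≐ ρ → π · σ ≐ ρ · σ
  ·-congʳ σ p = ptw λ a → at p (σ ⟨$⟩ʳ a)

  perm-injective : ∀ (π : Perm N) {a b} → π ⟨$⟩ʳ a ≡ π ⟨$⟩ʳ b → a ≡ b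
  perm-injective π p = ≡.trans (≡.sym (inverseˡ π)) (≡.trans (cong (π ⟨$⟩ˡ_) p) (inverseˡ π))

  flip-cong : {π ρ : Perm N} → π ≐ ρ → flip π ≐ flip ρ
  flip-cong {π} {ρ} p = ptw λ a → perm-injective ρ
    (≡.trans (≡.sym (at p _)) (≡.trans (inverseʳ π) (≡.sym (inverseʳ ρ))))

  move-left : ∀ (ρ : Perm N) {π σ} → ρ · π ≐ σ → π ≐ flip ρ · σ
  move-left ρ p = ptw λ a → ≡.trans (≡.sym (inverseˡ ρ)) (cong (ρ ⟨$⟩ˡ_) (at p a))

  move-right : ∀ (ρ : Perm N) {π σ} → π · ρ ≐ σ → π ≐ σ · flip ρ
  move-right ρ {π} p = ptw λ a → ≡.trans (cong (π ⟨$⟩ʳ_) (≡.sym (inverseʳ ρ))) (at p (ρ ⟨$⟩ˡ a))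

  abstract
    eqᵇ : Perm N → Perm N → Bool
    eqᵇ π ρ = does (Finₚ.all? (λ a → π ⟨$⟩ʳ a Finₚ.≟ ρ ⟨$⟩ʳ a))

    eqᵇ⇒≐ : ∀ {π ρ} → eqᵇ π ρ ≡ true → π ≐ ρ
    eqᵇ⇒≐ {π} {ρ} p = ptw (does⇒ (Finₚ.all? (λ a → π ⟨$⟩ʳ a Finₚ.≟ ρ ⟨$⟩ʳ a)) p)

    ≐⇒eqᵇ : ∀ {π ρ} → π ≐ ρ → eqᵇ π ρ ≡ true
    ≐⇒eqᵇ {π} {ρ} p = dec-true (Finₚ.all? (λ a → π ⟨$⟩ʳ a Finₚ.≟ ρ ⟨$⟩ʳ a)) (at p)

∧-true₁ : ∀ {a b} → a ∧ b ≡ true → a ≡ true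
∧-true₁ {true} _ = ≡.refl

∧-true₂ : ∀ {a b} → a ∧ b ≡ true → b ≡ true
∧-true₂ {true} t = t

Bool-ext : ∀ {a b} → (a ≡ true → b ≡ true) → (b ≡ true → a ≡ true) → a ≡ b
Bool-ext {true}  {true}  p q = ≡.refl
Bool-ext {true}  {false} p q = ≡.sym (p ≡.refl)
Bool-ext {false} {true}  p q = q ≡.refl
Bool-ext {false} {false} p q = ≡.refl

all-allFin⇒ : ∀ {N} (p : Fin N → Bool) → all p (allFin N) ≡ true → ∀ a → p a ≡ true
all-allFin⇒ {suc N} p q a with p fzero in eq
all-allFin⇒ {suc N} p q fzero    | true = eq
all-allFin⇒ {suc N} p q (fsuc a) | true = all-allFin⇒ (p ∘ fsuc) (≡.trans (cong (List.foldr _∧_ true)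
  (≡.trans (Listₚ.map-tabulate (λ i → i) (p ∘ fsuc)) (≡.sym (Listₚ.map-tabulate fsuc p)))) q) a

⇒all-allFin : ∀ {N} (p : Fin N → Bool) → (∀ a → p a ≡ true) → all p (allFin N) ≡ true
⇒all-allFin {zero}  p q = ≡.refl
⇒all-allFin {suc N} p q rewrite q fzero = ≡.trans (cong (List.foldr _∧_ true)
  (≡.trans (Listₚ.map-tabulate fsuc p) (≡.sym (Listₚ.map-tabulate (λ i → i) (p ∘ fsuc)))))
  (⇒all-allFin (p ∘ fsuc) (q ∘ fsuc))

≡ᵇ⇒≡′ : ∀ {m n} → (m ≡ᵇ n) ≡ true → m ≡ n
≡ᵇ⇒≡′ {m} {n} p = ℕₚ.≡ᵇ⇒≡ m n (subst T (≡.sym p) _)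

≡⇒≡ᵇ′ : ∀ {m n} → m ≡ n → (m ≡ᵇ n) ≡ true
≡⇒≡ᵇ′ {m} {n} p with m ≡ᵇ n | ℕₚ.≡⇒≡ᵇ m n p
... | true | _ = ≡.refl

record Pres {N} (l : Fin N → ℕ) (π : Perm N) : Set where
  constructor pres
  field keep : ∀ a → l (π ⟨$⟩ʳ a) ≡ l a
open Pres public

-- With `l` the row or the column of an entry, this is literally the test by which `rowGroup` and
-- `colGroup` filter `allPerms`.
inG : ∀ {N} → (Fin N → ℕ) → Perm N → Bool
inG {N} l π = all (λ a → l (π ⟨$⟩ʳ a) ≡ᵇ l a) (allFin N)

inG⇒Pres : ∀ {N} (l : Fin N → ℕ) π → inG l π ≡ true → Pres l π
inG⇒Pres l π p = pres λ a → ≡ᵇ⇒≡′ (all-allFin⇒ (λ a → l (π ⟨$⟩ʳ a) ≡ᵇ l a) p a)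

Pres⇒inG : ∀ {N} (l : Fin N → ℕ) π → Pres l π → inG l π ≡ true
Pres⇒inG l π p = ⇒all-allFin _ λ a → ≡⇒≡ᵇ′ (keep p a)

module _ {N} {l : Fin N → ℕ} where
  Pres-· : ∀ {σ τ} → Pres l σ → Pres l τ → Pres l (σ · τ)
  Pres-· p q = pres λ a → ≡.trans (keep p _) (keep q a)

  Pres-flip : ∀ {σ} → Pres l σ → Pres l (flip σ)
  Pres-flip {σ} p = pres λ a → ≡.trans (≡.sym (keep p _)) (cong l (inverseʳ σ))

  Pres-≐ : ∀ {σ τ} → σ ≐ τ → Pres l σ → Pres l τ
  Pres-≐ e p = pres λ a → ≡.trans (cong l (≡.sym (at e a))) (keep p a)

  inG-cong : ∀ {π ρ : Perm N} → (Pres l π → Pres l ρ) → (Pres l ρ → Pres l π) → inG l π ≡ inG l ρ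
  inG-cong {π} {ρ} p q = Bool-ext (Pres⇒inG l ρ ∘ p ∘ inG⇒Pres l π) (Pres⇒inG l π ∘ q ∘ inG⇒Pres l ρ)

-- Since `t` and `ρ` agree at 0, the permutation t⁻¹ρ fixes 0 and is the lift of a unique smaller
-- one.
factor-through : ∀ {N} (t ρ : Perm (suc N)) → t ⟨$⟩ʳ fzero ≡ ρ ⟨$⟩ʳ fzero →
         Σ (Perm N) λ ρ′ → ∀ π → eqᵇ (lift₀ π ∘ₚ t) ρ ≡ eqᵇ π ρ′
factor-through {N} t ρ t0 = Perm.remove fzero ρ₁ , λ π → Bool-ext
    (λ e → ≐⇒eqᵇ (ptw λ a → Finₚ.suc-injective (≡.trans (≡.trans (≡.sym (inverseˡ t))
        (cong (t ⟨$⟩ˡ_) (at (eqᵇ⇒≐ e) (fsuc a)))) (≡.sym (lifted (fsuc a))))))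
    (λ e → ≐⇒eqᵇ (ptw λ a → ≡.trans (cong (t ⟨$⟩ʳ_)
        (≡.trans (Perm.lift₀-cong π _ (at (eqᵇ⇒≐ e)) a) (lifted a))) (inverseʳ t)))
  where
  ρ₁ : Perm (suc N)
  ρ₁ = ρ ∘ₚ flip t
  lifted : ∀ a → lift₀ (Perm.remove fzero ρ₁) ⟨$⟩ʳ a ≡ ρ₁ ⟨$⟩ʳ a
  lifted = Perm.lift₀-remove ρ₁ (≡.trans (cong (t ⟨$⟩ˡ_) (≡.sym t0)) (inverseˡ t))

-- Abstract because unfolding the removed permutation in the uses of unlift is prohibitively slow.
abstract
  unlift : ∀ {N} (t ρ : Perm (suc N)) → t ⟨$⟩ʳ fzero ≡ ρ ⟨$⟩ʳ fzero →
           Σ (Perm N) λ ρ′ → ∀ π → eqᵇ (lift₀ π ∘ₚ t) ρ ≡ eqᵇ π ρ′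
  unlift = factor-through

module PermSums {c ℓ : Level} (R : CommutativeRing c ℓ) where
  open CommutativeRing R
  open Sums R
  open import Relation.Binary.Reasoning.Setoid setoid

  ∑P : ∀ {N} → (Perm N → Carrier) → Carrier
  ∑P {N} = ∑ (allPerms N)

  Resp : ∀ {N} → (Perm N → Carrier) → Set ℓ
  Resp h = ∀ {π ρ} → π ≐ ρ → h π ≈ h ρ

  -- This expresses that `allPerms` lists every permutation exactly once up to `≐`. The image of 0
  -- singles out one transposition `transpose fzero i`, and `unlift` leads back to smaller N.
  ∑P-δ : ∀ {N} (ρ : Perm N) v → ∑P (λ π → eqᵇ π ρ ▸ v) ≈ v
  ∑P-δ {zero} ρ v = trans (∑-∷ _ _ _) (trans (+-congˡ (∑-nil _)) (trans (+-identityʳ _)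
    (reflexive (cong (_▸ v) (≐⇒eqᵇ {π = idₚ} {ρ} (ptw λ ()))))))
  ∑P-δ {suc N} ρ v = begin
    ∑P (λ π → eqᵇ π ρ ▸ v)
      ≈⟨ ∑-concatMap (λ i → map (λ π → lift₀ π ∘ₚ transpose fzero i) (allPerms N)) (allFin (suc N)) _ ⟩
    ∑ (allFin (suc N)) (λ i → ∑ (map (λ π → lift₀ π ∘ₚ transpose fzero i) (allPerms N)) (λ π → eqᵇ π ρ ▸ v))
      ≈⟨ ∑-cong (allFin (suc N)) (λ i → reflexive (∑-map (λ π → lift₀ π ∘ₚ transpose fzero i) (allPerms N) _)) ⟩
    ∑ (allFin (suc N)) (λ i → ∑P (λ π → eqᵇ (lift₀ π ∘ₚ transpose fzero i) ρ ▸ v))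
      ≈⟨ ∑-cong (allFin (suc N)) step ⟩
    ∑ (allFin (suc N)) (λ i → does (i Finₚ.≟ ρ ⟨$⟩ʳ fzero) ▸ v)
      ≈⟨ ∑-δ (ρ ⟨$⟩ʳ fzero) _ ⟩
    v ∎
    where
    step : ∀ i → ∑P (λ π → eqᵇ (lift₀ π ∘ₚ transpose fzero i) ρ ▸ v) ≈ does (i Finₚ.≟ ρ ⟨$⟩ʳ fzero) ▸ v
    step i with i Finₚ.≟ ρ ⟨$⟩ʳ fzero
    ... | no i≢ = ∑-zero (allPerms N) λ π → reflexive (cong (_▸ v) (Boolₚ.¬-not λ e → i≢ (at (eqᵇ⇒≐ e) fzero)))
    ... | yes i≡ with unlift (transpose fzero i) ρ i≡
    ...   | ρ′ , p = trans (∑-cong (allPerms N) λ π → reflexive (cong (_▸ v) (p π))) (∑P-δ ρ′ v)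

  -- The two sizes differ when permutations of a subset are extended by the identity, and `img` then
  -- cuts out the image; for translations and inversion `img` is constantly `true`.
  ∑P-reindex : ∀ {M N} (θ : Perm M → Perm N) (θ⁻ : Perm N → Perm M) (img : Perm N → Bool) →
    (∀ {π ρ} → π ≐ ρ → θ π ≐ θ ρ) →
    (∀ π ρ → θ π ≐ ρ → img ρ ≡ true × π ≐ θ⁻ ρ) →
    (∀ ρ → img ρ ≡ true → θ (θ⁻ ρ) ≐ ρ) →
    ∀ {h} → Resp h → ∑P (h ∘ θ) ≈ ∑P (λ π → img π ▸ h π)
  ∑P-reindex {M} {N} θ θ⁻ img cg to from {h} resp =
    double-count (allPerms M) (allPerms N) (λ π ρ → eqᵇ ρ (θ π)) img {h ∘ θ} {h}
      (λ π v → ∑P-δ (θ π) v)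
      count
      (λ π ρ e → sym (resp (eqᵇ⇒≐ e)))
    where
    count : ∀ ρ v → ∑P (λ π → eqᵇ ρ (θ π) ▸ v) ≈ img ρ ▸ v
    count ρ v with img ρ in eq
    ... | false = ∑-zero (allPerms M) λ π → reflexive (cong (_▸ v) (Boolₚ.¬-not λ e →
            true≢false (proj₁ (to π ρ (≐-sym (eqᵇ⇒≐ e)))) eq))
    ... | true = trans (∑-cong (allPerms M) λ π → reflexive (cong (_▸ v) (Bool-ext
            (λ e → ≐⇒eqᵇ (proj₂ (to π ρ (≐-sym (eqᵇ⇒≐ e)))))
            (λ e → ≐⇒eqᵇ (≐-trans (≐-sym (from ρ eq)) (≐-sym (cg (eqᵇ⇒≐ e))))))))
            (∑P-δ (θ⁻ ρ) v)

  abstract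
    ∑G : ∀ {N} → (Fin N → ℕ) → (Perm N → Carrier) → Carrier
    ∑G l h = ∑P (λ π → inG l π ▸ h π)

    ∑G-def : ∀ {N} (l : Fin N → ℕ) h → ∑G l h ≈ ∑P (λ π → inG l π ▸ h π)
    ∑G-def l h = refl

  ∑F-reindex : ∀ {N} (π : Perm N) f → ∑ (allFin N) f ≈ ∑ (allFin N) (λ x → f (π ⟨$⟩ʳ x))
  ∑F-reindex {N} π f = sym (double-count (allFin N) (allFin N) (λ x y → does (y Finₚ.≟ π ⟨$⟩ʳ x)) (λ _ → true)
    {λ x → f (π ⟨$⟩ʳ x)} {f}
    (λ x v → ∑-δ (π ⟨$⟩ʳ x) (λ _ → v))
    (λ y v → trans (∑-cong (allFin N) λ x → reflexive (cong (_▸ v) (Bool-ext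
        (λ e → dec-true (x Finₚ.≟ π ⟨$⟩ˡ y) (≡.trans (≡.sym (inverseˡ π)) (cong (π ⟨$⟩ˡ_) (≡.sym (does⇒ (y Finₚ.≟ π ⟨$⟩ʳ x) e)))))
        (λ e → dec-true (y Finₚ.≟ π ⟨$⟩ʳ x) (≡.trans (≡.sym (inverseʳ π)) (cong (π ⟨$⟩ʳ_) (≡.sym (does⇒ (x Finₚ.≟ π ⟨$⟩ˡ y) e))))))))
      (∑-δ (π ⟨$⟩ˡ y) (λ _ → v)))
    (λ x y e → reflexive (cong f (≡.sym (does⇒ (y Finₚ.≟ π ⟨$⟩ʳ x) e)))))

  module _ {N} (l : Fin N → ℕ) where

    ▸-resp : ∀ {h} → Resp h → Resp (λ π → inG l π ▸ h π)
    ▸-resp {h} rs {π} {ρ} e = trans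
      (▸-cong (inG l π) λ _ → rs e)
      (reflexive (cong (_▸ h ρ) (inG-cong {l = l} (Pres-≐ e) (Pres-≐ (≐-sym e)))))

    abstract
      ∑G-cong : ∀ {h h′} → (∀ π → Pres l π → h π ≈ h′ π) → ∑G l h ≈ ∑G l h′
      ∑G-cong p = ∑-cong (allPerms N) λ π → ▸-cong (inG l π) λ e → p π (inG⇒Pres l π e)

      ∑G-+ : ∀ h h′ → ∑G l (λ π → h π + h′ π) ≈ ∑G l h + ∑G l h′
      ∑G-+ h h′ = trans (∑-cong (allPerms N) λ π → ▸-+ (inG l π) _ _) (∑-+ (allPerms N) _ _)

      ∑G-*ˡ : ∀ k h → k * ∑G l h ≈ ∑G l (λ π → k * h π)
      ∑G-*ˡ k h = trans (∑-*ˡ (allPerms N) k _) (∑-cong (allPerms N) λ π → ▸-*ˡ (inG l π) k _)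

      ∑G-∑ : ∀ {a} {A : Set a} (xs : List A) (h : Perm N → A → Carrier) →
             ∑G l (λ π → ∑ xs (h π)) ≈ ∑ xs (λ x → ∑G l (λ π → h π x))
      ∑G-∑ xs h = trans (∑-cong (allPerms N) λ π → ∑-▸ xs (inG l π) (h π))
                        (∑-swap (allPerms N) xs (λ π x → inG l π ▸ h π x))

      ∑G-▸ : ∀ b h → b ▸ ∑G l h ≈ ∑G l (λ π → b ▸ h π)
      ∑G-▸ b h = trans (∑-▸ (allPerms N) b _) (∑-cong (allPerms N) λ π → ▸-comm b (inG l π) _)

      ∑G-swap : ∀ {M} (m : Fin M → ℕ) (h : Perm N → Perm M → Carrier) →
                ∑G l (λ π → ∑G m (h π)) ≈ ∑G m (λ ρ → ∑G l (λ π → h π ρ))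
      ∑G-swap {M} m h = trans (∑G-∑ (allPerms M) λ π ρ → inG m ρ ▸ h π ρ)
        (∑-cong (allPerms M) λ ρ → sym (∑G-▸ (inG m ρ) (λ π → h π ρ)))

      ∑G-reindex : ∀ (θ θ⁻ : Perm N → Perm N) →
        (∀ {π ρ} → π ≐ ρ → θ π ≐ θ ρ) → (∀ π ρ → θ π ≐ ρ → π ≐ θ⁻ ρ) → (∀ ρ → θ (θ⁻ ρ) ≐ ρ) →
        (∀ π → Pres l π → Pres l (θ π)) → (∀ π → Pres l (θ π) → Pres l π) →
        ∀ {h} → Resp h → ∑G l h ≈ ∑G l (h ∘ θ)
      ∑G-reindex θ θ⁻ cg to from p q {h} rs = sym (trans
        (∑-cong (allPerms N) λ π → reflexive (cong (_▸ h (θ π)) (inG-cong {l = l} (p π) (q π))))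
        (∑P-reindex θ θ⁻ (λ _ → true) cg (λ π ρ e → ≡.refl , to π ρ e) (λ ρ _ → from ρ)
          {λ π → inG l π ▸ h π} (▸-resp rs)))

    ∑G-zero : ∀ {h} → (∀ π → Pres l π → h π ≈ 0#) → ∑G l h ≈ 0#
    ∑G-zero {h} p = begin
      ∑G l h             ≈⟨ ∑G-cong (λ π q → trans (p π q) (sym (zeroˡ 0#))) ⟩
      ∑G l (λ _ → 0# * 0#) ≈⟨ ∑G-*ˡ 0# _ ⟨
      0# * ∑G l (λ _ → 0#) ≈⟨ zeroˡ _ ⟩
      0#                 ∎

    ∑G-left : ∀ {ρ} → Pres l ρ → ∀ {h} → Resp h → ∑G l h ≈ ∑G l (λ π → h (ρ · π))
    ∑G-left {ρ} p = ∑G-reindex (ρ ·_) (flip ρ ·_)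
      (·-congˡ ρ) (λ π σ → move-left ρ) (λ _ → ptw λ _ → inverseʳ ρ)
      (λ π q → Pres-· p q)
      (λ π q → Pres-≐ (ptw λ _ → inverseˡ ρ) (Pres-· (Pres-flip p) q))

    ∑G-right : ∀ {ρ} → Pres l ρ → ∀ {h} → Resp h → ∑G l h ≈ ∑G l (λ π → h (π · ρ))
    ∑G-right {ρ} p = ∑G-reindex (_· ρ) (_· flip ρ)
      (·-congʳ ρ) (λ π σ → move-right ρ)
      (λ σ → ptw λ _ → cong (σ ⟨$⟩ʳ_) (inverseˡ ρ))
      (λ π q → Pres-· q p)
      (λ π q → Pres-≐ (ptw λ _ → cong (π ⟨$⟩ʳ_) (inverseʳ ρ)) (Pres-· q (Pres-flip p)))

    ∑G-flip : ∀ {h} → Resp h → ∑G l h ≈ ∑G l (h ∘ flip)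
    ∑G-flip = ∑G-reindex flip flip
      flip-cong (λ π ρ e → flip-cong e)
      (λ _ → ptw λ _ → ≡.refl)
      (λ π → Pres-flip) (λ π → Pres-flip)

-- The sign of a permutation

transpose-fst : ∀ {N} (i j : Fin N) → transpose i j ⟨$⟩ʳ i ≡ j
transpose-fst i j rewrite dec-true (i Finₚ.≟ i) ≡.refl = ≡.refl

transpose-snd : ∀ {N} (i j : Fin N) → transpose i j ⟨$⟩ʳ j ≡ i
transpose-snd i j with j Finₚ.≟ i
... | yes p = p
... | no _ rewrite dec-true (j Finₚ.≟ j) ≡.refl = ≡.refl

transpose-other : ∀ {N} {i j k : Fin N} → k ≢ i → k ≢ j → transpose i j ⟨$⟩ʳ k ≡ k
transpose-other {i = i} {j} {k} p q rewrite dec-false (k Finₚ.≟ i) p | dec-false (k Finₚ.≟ j) q = ≡.refl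

abstract
  transpose-conj : ∀ {N} (π : Perm N) x y → π · transpose x y ≐ transpose (π ⟨$⟩ʳ x) (π ⟨$⟩ʳ y) · π
  transpose-conj π x y = ptw go
    where
    go : ∀ a → π ⟨$⟩ʳ (transpose x y ⟨$⟩ʳ a) ≡ transpose (π ⟨$⟩ʳ x) (π ⟨$⟩ʳ y) ⟨$⟩ʳ (π ⟨$⟩ʳ a)
    go a with a Finₚ.≟ x
    ... | yes ≡.refl = ≡.sym (transpose-fst (π ⟨$⟩ʳ x) _)
    ... | no a≢x with a Finₚ.≟ y
    ...   | yes ≡.refl = ≡.sym (transpose-snd (π ⟨$⟩ʳ x) (π ⟨$⟩ʳ y))
    ...   | no a≢y = ≡.sym (transpose-other (a≢x ∘ perm-injective π) (a≢y ∘ perm-injective π))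

  transpose-pres : ∀ {N} (l : Fin N → ℕ) {x y} → l x ≡ l y → Pres l (transpose x y)
  transpose-pres l {x} {y} e = pres go
    where
    go : ∀ a → l (transpose x y ⟨$⟩ʳ a) ≡ l a
    go a with a Finₚ.≟ x
    ... | yes ≡.refl = ≡.sym e
    ... | no _ with a Finₚ.≟ y
    ...   | yes ≡.refl = e
    ...   | no _ = ≡.refl

b2n : Bool → ℕ
b2n true  = 1
b2n false = 0

private
  lt : ∀ {N} → Fin N → Fin N → Bool
  lt a b = toℕ a <ᵇ toℕ b

  cnt : List Bool → ℕ
  cnt xs = length (filterᵇ (λ b → b) xs)

  cnt-++ : ∀ xs ys → cnt (xs ++ ys) ≡ cnt xs ℕ.+ cnt ys
  cnt-++ []           ys = ≡.refl
  cnt-++ (true ∷ xs)  ys = cong suc (cnt-++ xs ys)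
  cnt-++ (false ∷ xs) ys = cnt-++ xs ys

  cnt-map : ∀ {a} {A : Set a} {N} (f : Fin N → A) (p : A → Bool) → cnt (map p (tabulate f)) ≡ sum (b2n ∘ p ∘ f)
  cnt-map {N = zero}  f p = ≡.refl
  cnt-map {N = suc N} f p with p (f fzero)
  ... | true  = cong suc (cnt-map (f ∘ fsuc) p)
  ... | false = cnt-map (f ∘ fsuc) p

  cnt-concatMap : ∀ {a} {A : Set a} {N} (f : Fin N → A) g → cnt (concatMap g (tabulate f)) ≡ sum (cnt ∘ g ∘ f)
  cnt-concatMap {N = zero}  f g = ≡.refl
  cnt-concatMap {N = suc N} f g = ≡.trans (cnt-++ (g (f fzero)) _) (cong (cnt (g (f fzero)) ℕ.+_) (cnt-concatMap (f ∘ fsuc) g))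

  weight : ∀ {N} → (Fin N → Fin N → Bool) → ℕ
  weight p = sum λ a → sum λ b → b2n (lt a b ∧ p a b)

inversions-sum : ∀ {N} (π : Perm N) →
  inversions π ≡ sum (λ a → sum λ b → b2n ((toℕ a <ᵇ toℕ b) ∧ (toℕ (π ⟨$⟩ʳ b) <ᵇ toℕ (π ⟨$⟩ʳ a))))
inversions-sum {N} π = ≡.trans (cnt-concatMap {N = N} (λ i → i) _) (sum-cong-≗ λ a →
  cnt-map {N = N} (λ i → i) (λ b → lt a b ∧ lt (π ⟨$⟩ʳ b) (π ⟨$⟩ʳ a)))

private
  lt-flip : ∀ {N} {a b : Fin N} → a ≢ b → lt b a ≡ not (lt a b)
  lt-flip {a = a} {b} a≢b = aux (toℕ a) (toℕ b) (a≢b ∘ Finₚ.toℕ-injective)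
    where
    aux : ∀ m n → m ≢ n → (n <ᵇ m) ≡ not (m <ᵇ n)
    aux zero    zero    p = contradiction ≡.refl p
    aux zero    (suc n) p = ≡.refl
    aux (suc m) zero    p = ≡.refl
    aux (suc m) (suc n) p = aux m n (p ∘ cong suc)

  lt-irrefl : ∀ m → (m <ᵇ m) ≡ false
  lt-irrefl zero    = ≡.refl
  lt-irrefl (suc m) = lt-irrefl m

  lt⇒≢ : ∀ {N} {a b : Fin N} → lt a b ≡ true → a ≢ b
  lt⇒≢ {a = a} p ≡.refl = true≢false p (lt-irrefl (toℕ a))

  -- Unlike the test for an inversion, this one is symmetric in the two points. It lives on
  -- unordered pairs and can be transported along a permutation.
  discord : ∀ {N} → Perm N → Fin N → Fin N → Bool
  discord π a b = lt a b xor lt (π ⟨$⟩ʳ a) (π ⟨$⟩ʳ b)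

  inversions-weight : ∀ {N} (π : Perm N) → inversions π ≡ weight (discord π)
  inversions-weight π = ≡.trans (inversions-sum π) (sum-cong-≗ λ a → sum-cong-≗ λ b → cong b2n (go a b))
    where
    go : ∀ a b → lt a b ∧ lt (π ⟨$⟩ʳ b) (π ⟨$⟩ʳ a) ≡ lt a b ∧ discord π a b
    go a b with lt a b in eq
    ... | false = ≡.refl
    ... | true  = lt-flip (lt⇒≢ {a = a} {b} eq ∘ perm-injective π)

  record Symm {N} (p : Fin N → Fin N → Bool) : Set where
    field
      symm  : ∀ a b → p a b ≡ p b a
      irref : ∀ a → p a a ≡ false
  open Symm

  discord-symm : ∀ {N} (π : Perm N) → Symm (discord π)
  discord-symm π .irref a rewrite lt-irrefl (toℕ a) = lt-irrefl (toℕ (π ⟨$⟩ʳ a))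
  discord-symm π .symm a b with a Finₚ.≟ b
  ... | yes ≡.refl = ≡.refl
  ... | no a≢b rewrite lt-flip a≢b | lt-flip (a≢b ∘ perm-injective π) =
    xor-not (lt a b) (lt (π ⟨$⟩ʳ a) (π ⟨$⟩ʳ b))
    where
    xor-not : ∀ x y → x xor y ≡ not x xor not y
    xor-not true  y = ≡.refl
    xor-not false y = ≡.sym (Boolₚ.not-involutive y)

  -- `weight` sums over a < b, a range that permutations do not respect; twice `weight` is a sum
  -- over all pairs, which can be permuted in each argument.
  weight-double : ∀ {N} {p : Fin N → Fin N → Bool} → Symm p → weight p ℕ.+ weight p ≡ sum λ a → sum λ b → b2n (p a b)
  weight-double {N} {p} s = begin
    weight p ℕ.+ weight p
      ≡⟨ cong (weight p ℕ.+_) (∑-comm λ a b → b2n (lt a b ∧ p a b)) ⟩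
    weight p ℕ.+ (sum λ a → sum λ b → b2n (lt b a ∧ p b a))
      ≡⟨ ∑-distrib-+ (λ a → sum λ b → b2n (lt a b ∧ p a b)) (λ a → sum λ b → b2n (lt b a ∧ p b a)) ⟨
    (sum λ a → (sum λ b → b2n (lt a b ∧ p a b)) ℕ.+ (sum λ b → b2n (lt b a ∧ p b a)))
      ≡⟨ sum-cong-≗ (λ a → ≡.sym (∑-distrib-+ (λ b → b2n (lt a b ∧ p a b)) (λ b → b2n (lt b a ∧ p b a)))) ⟩
    (sum λ a → sum λ b → b2n (lt a b ∧ p a b) ℕ.+ b2n (lt b a ∧ p b a))
      ≡⟨ sum-cong-≗ (λ a → sum-cong-≗ λ b → go a b) ⟩
    (sum λ a → sum λ b → b2n (p a b)) ∎
    where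
    open ≡.≡-Reasoning
    go : ∀ a b → b2n (lt a b ∧ p a b) ℕ.+ b2n (lt b a ∧ p b a) ≡ b2n (p a b)
    go a b with a Finₚ.≟ b
    ... | yes ≡.refl rewrite lt-irrefl (toℕ a) | irref s a = ≡.refl
    ... | no a≢b rewrite lt-flip a≢b | symm s b a with lt a b | p a b
    ...   | true  | true  = ≡.refl
    ...   | true  | false = ≡.refl
    ...   | false | true  = ≡.refl
    ...   | false | false = ≡.refl

  self-sum-injective : ∀ {m n} → m ℕ.+ m ≡ n ℕ.+ n → m ≡ n
  self-sum-injective {m} {n} e = ℕₚ.*-cancelˡ-≡ m n 2
    (≡.trans (cong (m ℕ.+_) (ℕₚ.+-identityʳ m)) (≡.trans e (≡.sym (cong (n ℕ.+_) (ℕₚ.+-identityʳ n)))))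

  weight-permute : ∀ {N} {p : Fin N → Fin N → Bool} (τ : Perm N) → Symm p →
                   weight (λ a b → p (τ ⟨$⟩ʳ a) (τ ⟨$⟩ʳ b)) ≡ weight p
  weight-permute {p = p} τ s = self-sum-injective (begin
    w′ ℕ.+ w′ ≡⟨ weight-double {p = λ a b → p (τ ⟨$⟩ʳ a) (τ ⟨$⟩ʳ b)} (record
               { symm = λ a b → symm s (τ ⟨$⟩ʳ a) (τ ⟨$⟩ʳ b) ; irref = λ a → irref s (τ ⟨$⟩ʳ a) }) ⟩
    (sum λ a → sum λ b → b2n (p (τ ⟨$⟩ʳ a) (τ ⟨$⟩ʳ b)))
      ≡⟨ sum-cong-≗ (λ a → ≡.sym (sum-permute (λ b → b2n (p (τ ⟨$⟩ʳ a) b)) τ)) ⟩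
    (sum λ a → sum λ b → b2n (p (τ ⟨$⟩ʳ a) b))
      ≡⟨ sum-permute (λ a → sum λ b → b2n (p a b)) τ ⟨
    (sum λ a → sum λ b → b2n (p a b)) ≡⟨ weight-double s ⟨
    weight p ℕ.+ weight p ∎)
    where
    open ≡.≡-Reasoning
    w′ = weight (λ a b → p (τ ⟨$⟩ʳ a) (τ ⟨$⟩ʳ b))

  parity-xor-sum : ∀ {N} (u v w z : Fin N → ℕ) → (∀ a → u a ℕ.+ (w a ℕ.+ w a) ≡ v a ℕ.+ z a) →
                   sum u ℕ.+ (sum w ℕ.+ sum w) ≡ sum v ℕ.+ sum z
  parity-xor-sum u v w z e = begin
    sum u ℕ.+ (sum w ℕ.+ sum w)          ≡⟨ cong (sum u ℕ.+_) (∑-distrib-+ w w) ⟨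
    sum u ℕ.+ sum (λ a → w a ℕ.+ w a)    ≡⟨ ∑-distrib-+ u _ ⟨
    sum (λ a → u a ℕ.+ (w a ℕ.+ w a))    ≡⟨ sum-cong-≗ e ⟩
    sum (λ a → v a ℕ.+ z a)              ≡⟨ ∑-distrib-+ v z ⟩
    sum v ℕ.+ sum z                      ∎
    where open ≡.≡-Reasoning

  weight-xor : ∀ {N} (p q : Fin N → Fin N → Bool) →
    weight (λ a b → p a b xor q a b) ℕ.+ (weight (λ a b → p a b ∧ q a b) ℕ.+ weight (λ a b → p a b ∧ q a b))
      ≡ weight p ℕ.+ weight q
  weight-xor p q = parity-xor-sum
    (λ a → sum (x a)) (λ a → sum (y a)) (λ a → sum (w a)) (λ a → sum (z a))
    λ a → parity-xor-sum (x a) (y a) (w a) (z a) λ b → go (lt a b) (p a b) (q a b)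
    where
    x y z w : Fin _ → Fin _ → ℕ
    x a b = b2n (lt a b ∧ (p a b xor q a b))
    w a b = b2n (lt a b ∧ (p a b ∧ q a b))
    y a b = b2n (lt a b ∧ p a b)
    z a b = b2n (lt a b ∧ q a b)
    go : ∀ x y z → b2n (x ∧ (y xor z)) ℕ.+ (b2n (x ∧ (y ∧ z)) ℕ.+ b2n (x ∧ (y ∧ z))) ≡ b2n (x ∧ y) ℕ.+ b2n (x ∧ z)
    go false y     z     = ≡.refl
    go true  true  true  = ≡.refl
    go true  true  false = ≡.refl
    go true  false true  = ≡.refl
    go true  false false = ≡.refl

  parity-double : ∀ m n → ℕ.parity (m ℕ.+ (n ℕ.+ n)) ≡ ℕ.parity m
  parity-double m n = ≡.trans (ℙₚ.+-homo-+ m (n ℕ.+ n)) (≡.trans (cong (ℕ.parity m ℙ.+_)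
    (≡.trans (ℙₚ.+-homo-+ n n) (ℙₚ.p+p≡0ℙ (ℕ.parity n)))) (ℙₚ.+-identityʳ _))

-- The product reverses a pair exactly when one but not both of these hold: τ reverses the pair, σ
-- reverses its image under τ. An xor of indicators is a sum modulo 2, and transport along τ does
-- not change the count for σ.
parity-inversions-· : ∀ {N} (σ τ : Perm N) →
  ℕ.parity (inversions (σ · τ)) ≡ ℕ.parity (inversions σ) ℙ.+ ℕ.parity (inversions τ)
parity-inversions-· σ τ = begin
  ℕ.parity (inversions (σ · τ))
    ≡⟨ cong ℕ.parity (inversions-weight (σ · τ)) ⟩
  ℕ.parity (weight (discord (σ · τ)))
    ≡⟨ cong ℕ.parity (sum-cong-≗ λ a → sum-cong-≗ λ b → cong (λ x → b2n (lt a b ∧ x)) (xor-chain (lt a b) (lt (τ ⟨$⟩ʳ a) (τ ⟨$⟩ʳ b)) (lt (σ ⟨$⟩ʳ (τ ⟨$⟩ʳ a)) (σ ⟨$⟩ʳ (τ ⟨$⟩ʳ b))))) ⟩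
  ℕ.parity (weight (λ a b → p a b xor q a b))
    ≡⟨ parity-double (weight λ a b → p a b xor q a b) (weight λ a b → p a b ∧ q a b) ⟨
  ℕ.parity (weight (λ a b → p a b xor q a b) ℕ.+ (weight (λ a b → p a b ∧ q a b) ℕ.+ weight (λ a b → p a b ∧ q a b)))
    ≡⟨ cong ℕ.parity (weight-xor p q) ⟩
  ℕ.parity (weight p ℕ.+ weight q)
    ≡⟨ cong (λ w → ℕ.parity (w ℕ.+ weight q)) (weight-permute τ (discord-symm σ)) ⟩
  ℕ.parity (weight (discord σ) ℕ.+ weight q)
    ≡⟨ ℙₚ.+-homo-+ (weight (discord σ)) _ ⟩
  ℕ.parity (weight (discord σ)) ℙ.+ ℕ.parity (weight (discord τ))
    ≡⟨ cong₂ (λ m n → ℕ.parity m ℙ.+ ℕ.parity n) (inversions-weight σ) (inversions-weight τ) ⟨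
  ℕ.parity (inversions σ) ℙ.+ ℕ.parity (inversions τ) ∎
  where
  open ≡.≡-Reasoning
  p q : Fin _ → Fin _ → Bool
  p a b = discord σ (τ ⟨$⟩ʳ a) (τ ⟨$⟩ʳ b)
  q = discord τ
  xor-chain : ∀ x y z → x xor z ≡ (y xor z) xor (x xor y)
  xor-chain true  true  z = ≡.sym (Boolₚ.xor-identityʳ _)
  xor-chain true  false z = ≡.sym (Boolₚ.xor-comm z true)
  xor-chain false true  z = ≡.sym (≡.trans (Boolₚ.xor-comm (not z) true) (Boolₚ.not-involutive z))
  xor-chain false false z = ≡.sym (Boolₚ.xor-identityʳ z)

inversions-≐ : ∀ {N} {π ρ : Perm N} → π ≐ ρ → inversions π ≡ inversions ρ
inversions-≐ {π = π} {ρ} e = ≡.trans (inversions-sum π) (≡.trans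
  (sum-cong-≗ λ a → sum-cong-≗ λ b → cong₂ (λ x y → b2n (lt a b ∧ lt x y)) (at e b) (at e a))
  (≡.sym (inversions-sum ρ)))

<ᵇ-asym : ∀ m n → (m <ᵇ n) ∧ (n <ᵇ m) ≡ false
<ᵇ-asym zero    zero    = ≡.refl
<ᵇ-asym zero    (suc n) = ≡.refl
<ᵇ-asym (suc m) zero    = ≡.refl
<ᵇ-asym (suc m) (suc n) = <ᵇ-asym m n

inversions-id : ∀ {N} → inversions (idₚ {N}) ≡ 0
inversions-id {N} = ≡.trans (inversions-sum (idₚ {N})) (≡.trans
  (sum-cong-≗ λ (a : Fin N) → ≡.trans (sum-cong-≗ λ (b : Fin N) → cong b2n (<ᵇ-asym (toℕ a) (toℕ b))) (sum-replicate-zero N))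
  (sum-replicate-zero N))

private
  inversions-swap : ∀ {N} → inversions (transpose {suc (suc N)} fzero (fsuc fzero)) ≡ 1
  inversions-swap {N} = ≡.trans (inversions-sum (transpose {suc (suc N)} fzero (fsuc fzero))) (≡.trans
    (cong₂ ℕ._+_ (cong suc (sum-replicate-zero N)) (cong₂ ℕ._+_ (sum-replicate-zero N) rest)) ≡.refl)
    where
    rest : sum {N} (λ a → sum {N} λ b → b2n (lt (fsuc (fsuc a)) (fsuc (fsuc b)) ∧ lt (fsuc (fsuc b)) (fsuc (fsuc a)))) ≡ 0
    rest = ≡.trans (≡.sym (inversions-sum (idₚ {N}))) (inversions-id {N})

  parity-conj : ∀ {N} (π τ : Perm N) {ρ} → π · τ ≐ ρ · π → ℕ.parity (inversions τ) ≡ ℕ.parity (inversions ρ)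
  parity-conj π τ {ρ} e = cancel (ℕ.parity (inversions π)) (≡.trans (≡.sym (parity-inversions-· π τ))
    (≡.trans (cong ℕ.parity (inversions-≐ {π = π · τ} {ρ · π} e)) (≡.trans (parity-inversions-· ρ π) (ℙₚ.+-comm (ℕ.parity (inversions ρ)) _))))
    where
    cancel : ∀ x {y z} → x ℙ.+ y ≡ x ℙ.+ z → y ≡ z
    cancel 0ℙ e = e
    cancel 1ℙ e = ℙₚ.⁻¹-injective e

parity-transpose : ∀ {N} {x y : Fin N} → x ≢ y → ℕ.parity (inversions (transpose x y)) ≡ 1ℙ
parity-transpose {suc zero} {fzero} {fzero} p = contradiction ≡.refl p
parity-transpose {suc (suc N)} {x} {y} x≢y =
  ≡.trans (≡.sym (parity-conj π (transpose fzero (fsuc fzero)) {transpose x y}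
    (≐-trans (transpose-conj π fzero (fsuc fzero)) (ptw λ a → cong₂ (λ u v → transpose u v ⟨$⟩ʳ (π ⟨$⟩ʳ a)) π0 π1))))
    (cong ℕ.parity (inversions-swap {N}))
  where
  -- The permutation π = (0 x)(1 y′) carries 0 to x and 1 to y, so it conjugates (0 1) to (x y). The
  -- point y′ differs from 0 because (0 x) sends 0 to x, not to y.
  y′ = transpose fzero x ⟨$⟩ˡ y
  π = transpose fzero x · transpose (fsuc fzero) y′
  π0 : π ⟨$⟩ʳ fzero ≡ x
  π0 = ≡.trans (cong (transpose fzero x ⟨$⟩ʳ_) (transpose-other {i = fsuc fzero} {y′} {fzero} (λ ())
         λ e → x≢y (≡.trans (≡.sym (transpose-fst fzero x)) (≡.trans (cong (transpose fzero x ⟨$⟩ʳ_) e) (inverseʳ (transpose fzero x) {y})))))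
         (transpose-fst fzero x)
  π1 : π ⟨$⟩ʳ fsuc fzero ≡ y
  π1 = ≡.trans (cong (transpose fzero x ⟨$⟩ʳ_) (transpose-fst (fsuc fzero) y′)) (inverseʳ (transpose fzero x) {y})

-- Moments of a permutation

-- The right side exceeds the left by (b - a)(w - u).
rearrange-≤ : ∀ {a b u w} → a ≤ b → u ≤ w → a ℕ.* w ℕ.+ b ℕ.* u ≤ a ℕ.* u ℕ.+ b ℕ.* w
rearrange-≤ {a} {b} {u} {w} a≤b u≤w with ℕₚ.m≤n⇒∃[o]m+o≡n a≤b | ℕₚ.m≤n⇒∃[o]m+o≡n u≤w
... | e , ≡.refl | f , ≡.refl = ℕₚ.≤-trans (ℕₚ.m≤m+n _ (e ℕ.* f)) (ℕₚ.≤-reflexive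
  (solve 4 (λ a e u f → (a :* (u :+ f) :+ (a :+ e) :* u) :+ e :* f := a :* u :+ (a :+ e) :* (u :+ f)) ≡.refl a e u f))
  where open +-*-Solver

rearrange-< : ∀ {a b u w} → a < b → u < w → a ℕ.* w ℕ.+ b ℕ.* u < a ℕ.* u ℕ.+ b ℕ.* w
rearrange-< {a} {b} {u} {w} a<b u<w with ℕₚ.m≤n⇒∃[o]m+o≡n a<b | ℕₚ.m≤n⇒∃[o]m+o≡n u<w
... | e , ≡.refl | f , ≡.refl = ℕₚ.≤-trans (ℕₚ.m≤m+n _ (e ℕ.+ f ℕ.+ e ℕ.* f)) (ℕₚ.≤-reflexive
  (solve 4 (λ a e u f → (con 1 :+ (a :* (con 1 :+ u :+ f) :+ (con 1 :+ a :+ e) :* u)) :+ (e :+ f :+ e :* f)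
     := a :* u :+ (con 1 :+ a :+ e) :* (con 1 :+ u :+ f)) ≡.refl a e u f))
  where open +-*-Solver

sum-single : ∀ {N} (x : Fin N) k → sum (λ s → if does (s Finₚ.≟ x) then k else 0) ≡ k
sum-single {suc N} fzero    k = ≡.trans (cong (k ℕ.+_) (sum-replicate-zero N)) (ℕₚ.+-identityʳ k)
sum-single {suc N} (fsuc x) k = sum-single x k

sum-mono : ∀ {N} {u v : Fin N → ℕ} → (∀ i → u i ≤ v i) → sum u ≤ sum v
sum-mono {zero}  p = z≤n
sum-mono {suc N} p = ℕₚ.+-mono-≤ (p fzero) (sum-mono (p ∘ fsuc))

sum-mono-≡ : ∀ {N} {u v : Fin N → ℕ} → (∀ i → u i ≤ v i) → sum u ≡ sum v → ∀ i → u i ≡ v i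
sum-mono-≡ {suc N} {u} {v} p e = λ where
    fzero    → head≡
    (fsuc i) → sum-mono-≡ (p ∘ fsuc) (ℕₚ.+-cancelˡ-≡ (v fzero) _ _
                 (≡.trans (cong (ℕ._+ sum (u ∘ fsuc)) (≡.sym head≡)) e)) i
  where
  head≡ : u fzero ≡ v fzero
  head≡ = ℕₚ.≤-antisym (p fzero) (ℕₚ.+-cancelʳ-≤ (sum (v ∘ fsuc)) (v fzero) (u fzero)
    (ℕₚ.≤-trans (ℕₚ.≤-reflexive (≡.sym e)) (ℕₚ.+-monoʳ-≤ (u fzero) (sum-mono (p ∘ fsuc)))))

sum-bound : ∀ {N} (u : Fin N → ℕ) i → u i ≤ sum u
sum-bound u fzero    = ℕₚ.m≤m+n _ _
sum-bound u (fsuc i) = ℕₚ.≤-trans (sum-bound (u ∘ fsuc) i) (ℕₚ.m≤n+m _ _)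

abstract
  -- The potentials of the inductions on permutations have this form: `v` is a row or column
  -- function and `W` weighs the entries.
  moment : ∀ {N} → (Fin N → ℕ) → (Fin N → ℕ) → Perm N → ℕ
  moment v W π = sum λ s → v (π ⟨$⟩ʳ s) ℕ.* W s

  moment-def : ∀ {N} (v W : Fin N → ℕ) π → moment v W π ≡ sum λ s → v (π ⟨$⟩ʳ s) ℕ.* W s
  moment-def v W π = ≡.refl

  -- Only the summands at x and y change. The old ones are added on the left and the new ones on the
  -- right because subtraction of naturals truncates.
  moment-swap : ∀ {N} (v W : Fin N → ℕ) π {x y} → x ≢ y →
    moment v W (π · transpose x y) ℕ.+ (v (π ⟨$⟩ʳ x) ℕ.* W x ℕ.+ v (π ⟨$⟩ʳ y) ℕ.* W y)
      ≡ moment v W π ℕ.+ (v (π ⟨$⟩ʳ y) ℕ.* W x ℕ.+ v (π ⟨$⟩ʳ x) ℕ.* W y)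
  moment-swap {N} v W π {x} {y} x≢y = begin
    moment v W (π · transpose x y) ℕ.+ (v (π ⟨$⟩ʳ x) ℕ.* W x ℕ.+ v (π ⟨$⟩ʳ y) ℕ.* W y)
      ≡⟨ split (λ s → v ((π · transpose x y) ⟨$⟩ʳ s) ℕ.* W s) _ _ ⟨
    sum (λ s → v ((π · transpose x y) ⟨$⟩ʳ s) ℕ.* W s ℕ.+ (at? s x (v (π ⟨$⟩ʳ x) ℕ.* W x) ℕ.+ at? s y (v (π ⟨$⟩ʳ y) ℕ.* W y)))
      ≡⟨ sum-cong-≗ (λ s → go s (s Finₚ.≟ x) (s Finₚ.≟ y)) ⟩
    sum (λ s → v (π ⟨$⟩ʳ s) ℕ.* W s ℕ.+ (at? s x (v (π ⟨$⟩ʳ y) ℕ.* W x) ℕ.+ at? s y (v (π ⟨$⟩ʳ x) ℕ.* W y)))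
      ≡⟨ split (λ s → v (π ⟨$⟩ʳ s) ℕ.* W s) _ _ ⟩
    moment v W π ℕ.+ (v (π ⟨$⟩ʳ y) ℕ.* W x ℕ.+ v (π ⟨$⟩ʳ x) ℕ.* W y) ∎
    where
    open ≡.≡-Reasoning
    at? : Fin N → Fin N → ℕ → ℕ
    at? s x k = if does (s Finₚ.≟ x) then k else 0
    split : ∀ f k l → sum (λ s → f s ℕ.+ (at? s x k ℕ.+ at? s y l)) ≡ sum f ℕ.+ (k ℕ.+ l)
    split f k l = ≡.trans (∑-distrib-+ f _) (cong (sum f ℕ.+_)
      (≡.trans (∑-distrib-+ (λ s → at? s x k) (λ s → at? s y l)) (cong₂ ℕ._+_ (sum-single x k) (sum-single y l))))
    at-yes : ∀ x k → at? x x k ≡ k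
    at-yes x k = cong (λ b → if b then k else 0) (dec-true (x Finₚ.≟ x) ≡.refl)
    at-no : ∀ {s x} k → s ≢ x → at? s x k ≡ 0
    at-no {s} {x} k p = cong (λ b → if b then k else 0) (dec-false (s Finₚ.≟ x) p)
    go : ∀ s → Dec (s ≡ x) → Dec (s ≡ y) →
      v ((π · transpose x y) ⟨$⟩ʳ s) ℕ.* W s ℕ.+ (at? s x (v (π ⟨$⟩ʳ x) ℕ.* W x) ℕ.+ at? s y (v (π ⟨$⟩ʳ y) ℕ.* W y))
      ≡ v (π ⟨$⟩ʳ s) ℕ.* W s ℕ.+ (at? s x (v (π ⟨$⟩ʳ y) ℕ.* W x) ℕ.+ at? s y (v (π ⟨$⟩ʳ x) ℕ.* W y))
    go s (yes ≡.refl) _ rewrite at-yes x (v (π ⟨$⟩ʳ x) ℕ.* W x) | at-yes x (v (π ⟨$⟩ʳ y) ℕ.* W x)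
      | at-no (v (π ⟨$⟩ʳ y) ℕ.* W y) x≢y | at-no (v (π ⟨$⟩ʳ x) ℕ.* W y) x≢y | transpose-fst x y
      | ℕₚ.+-identityʳ (v (π ⟨$⟩ʳ x) ℕ.* W x) | ℕₚ.+-identityʳ (v (π ⟨$⟩ʳ y) ℕ.* W x) = ℕₚ.+-comm (v (π ⟨$⟩ʳ y) ℕ.* W x) _
    go s (no p) (yes ≡.refl) rewrite at-no (v (π ⟨$⟩ʳ x) ℕ.* W x) p | at-no (v (π ⟨$⟩ʳ y) ℕ.* W x) p
      | at-yes y (v (π ⟨$⟩ʳ x) ℕ.* W y) | at-yes y (v (π ⟨$⟩ʳ y) ℕ.* W y) | transpose-snd x y = ℕₚ.+-comm (v (π ⟨$⟩ʳ x) ℕ.* W y) _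
    go s (no p) (no q) rewrite at-no (v (π ⟨$⟩ʳ x) ℕ.* W x) p | at-no (v (π ⟨$⟩ʳ y) ℕ.* W x) p
      | at-no (v (π ⟨$⟩ʳ x) ℕ.* W y) q | at-no (v (π ⟨$⟩ʳ y) ℕ.* W y) q | transpose-other {i = x} {y} {s} p q = ≡.refl

moment-swap-< : ∀ {N} (v W : Fin N → ℕ) π {x y} → v (π ⟨$⟩ʳ x) < v (π ⟨$⟩ʳ y) → W x < W y →
                moment v W (π · transpose x y) < moment v W π
moment-swap-< v W π {x} {y} p q = ℕₚ.+-cancelʳ-< (vx ℕ.* W x ℕ.+ vy ℕ.* W y) _ _ (begin-strict
  moment v W (π · transpose x y) ℕ.+ (vx ℕ.* W x ℕ.+ vy ℕ.* W y)
    ≡⟨ moment-swap v W π (λ { ≡.refl → ℕₚ.<-irrefl ≡.refl p }) ⟩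
  moment v W π ℕ.+ (vy ℕ.* W x ℕ.+ vx ℕ.* W y)
    ≡⟨ cong (moment v W π ℕ.+_) (ℕₚ.+-comm (vy ℕ.* W x) _) ⟩
  moment v W π ℕ.+ (vx ℕ.* W y ℕ.+ vy ℕ.* W x)
    <⟨ ℕₚ.+-monoʳ-< (moment v W π) (rearrange-< p q) ⟩
  moment v W π ℕ.+ (vx ℕ.* W x ℕ.+ vy ℕ.* W y) ∎)
  where
  open ℕₚ.≤-Reasoning
  vx = v (π ⟨$⟩ʳ x)
  vy = v (π ⟨$⟩ʳ y)

moment-swap-≤ : ∀ {N} (v W : Fin N → ℕ) π {x y} → v (π ⟨$⟩ʳ x) < v (π ⟨$⟩ʳ y) → W x ≤ W y →
                moment v W (π · transpose x y) ≤ moment v W π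
moment-swap-≤ v W π {x} {y} p q = ℕₚ.+-cancelʳ-≤ (vx ℕ.* W x ℕ.+ vy ℕ.* W y) _ _ (begin
  moment v W (π · transpose x y) ℕ.+ (vx ℕ.* W x ℕ.+ vy ℕ.* W y)
    ≡⟨ moment-swap v W π (λ { ≡.refl → ℕₚ.<-irrefl ≡.refl p }) ⟩
  moment v W π ℕ.+ (vy ℕ.* W x ℕ.+ vx ℕ.* W y)
    ≡⟨ cong (moment v W π ℕ.+_) (ℕₚ.+-comm (vy ℕ.* W x) _) ⟩
  moment v W π ℕ.+ (vx ℕ.* W y ℕ.+ vy ℕ.* W x)
    ≤⟨ ℕₚ.+-monoʳ-≤ (moment v W π) (rearrange-≤ (ℕₚ.<⇒≤ p) q) ⟩
  moment v W π ℕ.+ (vx ℕ.* W x ℕ.+ vy ℕ.* W y) ∎)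
  where
  open ℕₚ.≤-Reasoning
  vx = v (π ⟨$⟩ʳ x)
  vy = v (π ⟨$⟩ʳ y)

abstract
  moment-reindex : ∀ {N} (v W W′ : Fin N → ℕ) π τ → (∀ s → W′ (τ ⟨$⟩ʳ s) ≡ W s) → moment v W (π · τ) ≡ moment v W′ π
  moment-reindex v W W′ π τ e = ≡.trans
    (sum-cong-≗ λ s → cong (v (π ⟨$⟩ʳ (τ ⟨$⟩ʳ s)) ℕ.*_) (≡.sym (e s)))
    (≡.sym (sum-permute (λ s → v (π ⟨$⟩ʳ s) ℕ.* W′ s) τ))

  moment-cong : ∀ {N} (v W : Fin N → ℕ) π π′ → (∀ s → v (π ⟨$⟩ʳ s) ≡ v (π′ ⟨$⟩ʳ s)) → moment v W π ≡ moment v W π′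
  moment-cong v W π π′ e = sum-cong-≗ λ s → cong (ℕ._* W s) (e s)

  moment-tight : ∀ {N} (v W : Fin N → ℕ) π π′ → (∀ s → v (π ⟨$⟩ʳ s) ℕ.* W s ≤ v (π′ ⟨$⟩ʳ s) ℕ.* W s) →
    moment v W π ≡ moment v W π′ → ∀ s → v (π ⟨$⟩ʳ s) ℕ.* W s ≡ v (π′ ⟨$⟩ʳ s) ℕ.* W s
  moment-tight v W π π′ le e = sum-mono-≡ le e

-- Entries of A₀ and their home columns

module Column {N : ℕ} (c : Fin N → ℕ) (in0 : Fin N → Bool) where

  -- The permutations preserving isolate l are those which preserve l on A₀ = { a ∣ in0 a }
  -- and fix every point outside A₀.
  isolate : (Fin N → ℕ) → Fin N → ℕ
  isolate l a = if in0 a then 2 ℕ.* l a else suc (2 ℕ.* toℕ a)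

  isolate-∈ : ∀ l {a} → in0 a ≡ true → isolate l a ≡ 2 ℕ.* l a
  isolate-∈ l {a} p = cong (λ b → if b then 2 ℕ.* l a else suc (2 ℕ.* toℕ a)) p

  isolate-injective : ∀ l {a b} → in0 a ≡ true → in0 b ≡ true → isolate l a ≡ isolate l b → l a ≡ l b
  isolate-injective l {a} {b} p q e = ℕₚ.*-cancelˡ-≡ (l a) (l b) 2
    (≡.trans (≡.sym (isolate-∈ l p)) (≡.trans e (isolate-∈ l q)))

  isolate-cong : ∀ l {a b} → in0 a ≡ true → in0 b ≡ true → l a ≡ l b → isolate l a ≡ isolate l b
  isolate-cong l p q e = ≡.trans (isolate-∈ l p) (≡.trans (cong (2 ℕ.*_) e) (≡.sym (isolate-∈ l q)))

  isolate-in0 : ∀ l a b → isolate l a ≡ isolate l b → in0 a ≡ in0 b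
  isolate-in0 l a b e with in0 a | in0 b
  ... | true  | true  = ≡.refl
  ... | false | false = ≡.refl
  ... | true  | false = contradiction e (ℕₚ.even≢odd (l a) (toℕ b))
  ... | false | true  = contradiction (≡.sym e) (ℕₚ.even≢odd (l b) (toℕ a))

  isolate-∉ : ∀ l {a b} → in0 a ≡ false → isolate l a ≡ isolate l b → a ≡ b
  isolate-∉ l {a} {b} p e with in0 a | in0 b | p
  ... | false | true  | _ = contradiction (≡.sym e) (ℕₚ.even≢odd (l b) (toℕ a))
  ... | false | false | _ = Finₚ.toℕ-injective (ℕₚ.*-cancelˡ-≡ (toℕ a) (toℕ b) 2 (ℕₚ.suc-injective e))

  c0 : Fin N → ℕ
  c0 = isolate c

  Fix : Perm N → Set
  Fix π = ∀ a → in0 a ≡ false → π ⟨$⟩ʳ a ≡ a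

  -- An entry of A₀ cannot land on a point q outside A₀, because q is already the image of itself.
  Fix⇒in0 : ∀ π → Fix π → ∀ a → in0 (π ⟨$⟩ʳ a) ≡ in0 a
  Fix⇒in0 π fx a with in0 a in p | in0 (π ⟨$⟩ʳ a) in q
  ... | true  | true  = ≡.refl
  ... | false | false = ≡.refl
  ... | true  | false = true≢false (≡.trans (cong in0 (perm-injective π (fx _ q))) p) q
  ... | false | true  = true≢false q (≡.trans (cong in0 (fx a p)) p)

  Pres-isolate⇒Fix : ∀ l {π} → Pres (isolate l) π → Fix π
  Pres-isolate⇒Fix l {π} p a q = ≡.sym (isolate-∉ l q (≡.sym (keep p a)))

  W0 : Fin N → ℕ
  W0 s = b2n (in0 s)

  W0-mono : ∀ {u v} s → (in0 s ≡ true → u ≤ v) → u ℕ.* W0 s ≤ v ℕ.* W0 s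
  W0-mono {u} {v} s le = cases (in0 s) ≡.refl
    where
    cases : ∀ b → in0 s ≡ b → u ℕ.* b2n b ≤ v ℕ.* b2n b
    cases true  s∈ = ℕₚ.*-monoˡ-≤ 1 (le s∈)
    cases false _  = ℕₚ.≤-reflexive (≡.trans (ℕₚ.*-zeroʳ u) (≡.sym (ℕₚ.*-zeroʳ v)))

  W0-cancel : ∀ {u v} s → in0 s ≡ true → u ℕ.* W0 s ≡ v ℕ.* W0 s → u ≡ v
  W0-cancel {u} {v} s s∈ e = ℕₚ.*-cancelʳ-≡ _ _ 1 (≡.subst (λ w → u ℕ.* w ≡ v ℕ.* w) (cong b2n s∈) e)

  -- The sum of the columns in which the entries of A₀ stand after π.
  pot : Perm N → ℕ
  pot = moment c W0

  Good : Perm N → Set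
  Good π = ∀ s → in0 s ≡ true → c (π ⟨$⟩ʳ s) ≤ c s

  -- Condition (1) of 𝒢 in terms of permutations: when no entry of A₀ moves right, a smaller sum of
  -- columns means that some entry moves strictly left.
  StrictlyLeft : Perm N → Set
  StrictlyLeft π = Good π × pot π < pot idₚ

  private
    M = sum c

    -- Home columns further left weigh more, and the successor keeps the entries of A₀ heavier than
    -- all entries outside. Since M bounds every column, the subtraction does not truncate.
    Wt : Fin N → ℕ
    Wt s = if in0 s then suc (M ℕ.∸ c s) else 0

    Bad : Perm N → Fin N → Set
    Bad π y = in0 y ≡ true × c y < c (π ⟨$⟩ʳ y)

    bad? : ∀ π y → Dec (Bad π y)
    bad? π y = (in0 y Boolₚ.≟ true) ×-dec (c y ℕ.<? c (π ⟨$⟩ʳ y))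

    minimal-bad : ∀ π y → Bad π y → Acc _<_ (c y) → Σ (Fin N) λ y → Bad π y × (∀ x → Bad π x → c y ≤ c x)
    minimal-bad π y b (acc rs) with Finₚ.any? (λ x → bad? π x ×-dec (c x ℕ.<? c y))
    ... | yes (x , bx , lt) = minimal-bad π x bx (rs lt)
    ... | no none = y , b , λ x bx → ℕₚ.≮⇒≥ λ lt → none (x , bx , lt)

  -- Swapping y with an element of its home column sorts the positions of the elements of A₀
  -- against their home columns, so the moment against a weight decreasing in the home column drops.
  sorting-induction : ∀ {q} (Q : Perm N → Set q) →
    (∀ π → Good π → Q π) →
    (∀ π y → in0 y ≡ true → c y < c (π ⟨$⟩ʳ y) →
      (∀ x → c (π ⟨$⟩ʳ x) ≡ c y → c0 x ≢ c0 y → Q (π · transpose x y)) → Q π) →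
    ∀ π → Q π
  sorting-induction Q base step π = go π (<-wellFounded _)
    where
    go : ∀ π → Acc _<_ (moment c Wt π) → Q π
    go π (acc rs) with Finₚ.any? (bad? π)
    ... | no none = base π λ s s∈ → ℕₚ.≮⇒≥ λ lt → none (s , s∈ , lt)
    ... | yes (y′ , b′) with minimal-bad π y′ b′ (<-wellFounded _)
    ...   | y , (y∈ , lt) , min = step π y y∈ lt λ x cx ne →
              go (π · transpose x y) (rs (moment-swap-< c Wt π
                (ℕₚ.≤-<-trans (ℕₚ.≤-reflexive cx) lt) (weights x cx ne)))
      where
      Wt-eq : ∀ s {b} → in0 s ≡ b → Wt s ≡ (if b then suc (M ℕ.∸ c s) else 0)
      Wt-eq s = cong (λ b → if b then suc (M ℕ.∸ c s) else 0)
      compare : ∀ x → in0 x ≡ true → c y < c x → Wt x < Wt y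
      compare x x∈ g = ≡.subst₂ _<_ (≡.sym (Wt-eq x x∈)) (≡.sym (Wt-eq y y∈)) (s≤s (ℕₚ.∸-monoʳ-< g (sum-bound c x)))
      weights : ∀ x → c (π ⟨$⟩ʳ x) ≡ c y → c0 x ≢ c0 y → Wt x < Wt y
      weights x cx ne = cases (in0 x) ≡.refl
        where
        cases : ∀ b → in0 x ≡ b → Wt x < Wt y
        cases false x∉ = ≡.subst₂ _<_ (≡.sym (Wt-eq x x∉)) (≡.sym (Wt-eq y y∈)) (s≤s z≤n)
        cases true x∈ with ℕₚ.<-cmp (c x) (c y)
        -- Here x as well would stand to the right of its home column, and that column is left of
        -- the one of y, against the choice of y.
        ... | tri< l _ _ = contradiction (min x (x∈ , ℕₚ.<-≤-trans l (ℕₚ.≤-reflexive (≡.sym cx)))) (ℕₚ.<⇒≱ l)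
        ... | tri≈ _ e _ = contradiction (isolate-cong c x∈ y∈ e) ne
        ... | tri> _ _ g = compare x x∈ g

-- Positions in a Young diagram

decreasing : ∀ {xs} → IsPartition xs → ∀ {i i′} → i ≤ i′ → xs ! i′ ≤ xs ! i
decreasing []              _ = z≤n
decreasing (single _)      {zero}  {zero}   _ = ℕₚ.≤-refl
decreasing (single _)      {zero}  {suc i′} _ = z≤n
decreasing (single _)      {suc i} {suc i′} _ = z≤n
decreasing (_ ∷ _)         {zero}  {zero}   _ = ℕₚ.≤-refl
decreasing (y≤x ∷ p)       {zero}  {suc i′} _ = ℕₚ.≤-trans (decreasing p {zero} {i′} z≤n) y≤x
decreasing (_ ∷ p)         {suc i} {suc i′} (s≤s le) = decreasing p le

tail-partition : ∀ {x xs} → IsPartition (x ∷ xs) → IsPartition xs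
tail-partition (single _) = []
tail-partition (_ ∷ p)    = p

-- The rows that reach column j form an initial segment; L is a part of the conjugate partition.
column-length : ∀ {xs} → IsPartition xs → ∀ j → Σ ℕ λ L → ∀ i → (j < xs ! i → i < L) × (i < L → j < xs ! i)
column-length {[]}     _ j = 0 , λ i → (λ ()) , λ ()
column-length {x ∷ xs} p j with j ℕ.<? x
... | no j≮x = 0 , λ i → (λ lt → contradiction (ℕₚ.<-≤-trans lt (decreasing p {0} {i} z≤n)) j≮x) , λ ()
... | yes j<x with column-length (tail-partition p) j
...   | L , spec = suc L , λ where
          zero    → (λ _ → s≤s z≤n) , λ _ → j<x
          (suc i) → (λ lt → s≤s (proj₁ (spec i) lt)) , λ { (s≤s lt) → proj₂ (spec i) lt }

box-≡ : ∀ {λ'} {a b : Box λ'} → row a ≡ row b → col a ≡ col b → a ≡ b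
box-≡ {a = box i j p} {box .i .j q} ≡.refl ≡.refl = cong (box i j) (ℕₚ.<-irrelevant p q)

module Positions {N : ℕ} {λ' : List ℕ} (part : IsPartition λ') (T : Box λ' ↔ Fin N) where

  r c : Fin N → ℕ
  r a = row (Inverse.from T a)
  c a = col (Inverse.from T a)

  rc-injective : ∀ {a b} → r a ≡ r b → c a ≡ c b → a ≡ b
  rc-injective {a} {b} p q = ≡.trans (≡.sym (Inverse.inverseˡ T ≡.refl))
    (≡.trans (cong (Inverse.to T) (box-≡ p q)) (Inverse.inverseˡ T ≡.refl))

  pos : ∀ i j → j < λ' ! i → Fin N
  pos i j p = Inverse.to T (box i j p)

  r-pos : ∀ i j p → r (pos i j p) ≡ i
  r-pos i j p = cong row (Inverse.inverseʳ T ≡.refl)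

  c-pos : ∀ i j p → c (pos i j p) ≡ j
  c-pos i j p = cong col (Inverse.inverseʳ T ≡.refl)

  c<λ : ∀ a → c a < λ' ! r a
  c<λ a = col<λrow (Inverse.from T a)

  left-closed : ∀ p j → j < c p → Σ (Fin N) λ w → c w ≡ j × r w ≡ r p
  left-closed p j lt = pos (r p) j q , c-pos _ _ q , r-pos _ _ q
    where q = ℕₚ.<-trans lt (c<λ p)

  up-closed : ∀ p i → i < r p → Σ (Fin N) λ w → c w ≡ c p × r w ≡ i
  up-closed p i lt = pos i (c p) q , c-pos _ _ q , r-pos _ _ q
    where q = ℕₚ.<-≤-trans (c<λ p) (decreasing part (ℕₚ.<⇒≤ lt))

  -- A hook of two adjacent columns: column j from row i downwards and column j + 1 down to row i.
  -- It has one more box than column j, so two of its boxes share a row after any column permutation.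
  module Hook (i j : ℕ) (corner : suc j < λ' ! i) where

    InHook : Fin N → Set
    InHook p = (c p ≡ j × i ≤ r p) ⊎ (c p ≡ suc j × r p ≤ i)

    inHook? : ∀ p → Dec (InHook p)
    inHook? p with c p ℕ.≟ j ×-dec i ℕ.≤? r p | c p ℕ.≟ suc j ×-dec r p ℕ.≤? i
    ... | yes q | _     = yes (inj₁ q)
    ... | no _  | yes q = yes (inj₂ q)
    ... | no q  | no q′ = no λ { (inj₁ x) → q x ; (inj₂ x) → q′ x }

    -- All boxes of the hook share the label 0 and the others have distinct labels, so `Pres hook`
    -- describes the permutations of the hook that fix everything else.
    hook : Fin N → ℕ
    hook p = if does (inHook? p) then 0 else suc (toℕ p)

    hook-∈ : ∀ {p} → InHook p → hook p ≡ 0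
    hook-∈ {p} q = cong (λ b → if b then 0 else suc (toℕ p)) (dec-true (inHook? p) q)

    hook-∉ : ∀ {p} → ¬ InHook p → hook p ≡ suc (toℕ p)
    hook-∉ {p} q = cong (λ b → if b then 0 else suc (toℕ p)) (dec-false (inHook? p) q)

    hook-stable : ∀ {ρ} → Pres hook ρ → ∀ {p} → InHook p → InHook (ρ ⟨$⟩ʳ p)
    hook-stable {ρ} pr {p} q with inHook? (ρ ⟨$⟩ʳ p)
    ... | yes q′ = q′
    ... | no q′ = contradiction (≡.trans (≡.sym (hook-∉ q′)) (≡.trans (keep pr p) (hook-∈ q))) λ ()

    hook-fixed : ∀ {ρ} → Pres hook ρ → ∀ {p} → ¬ InHook p → ρ ⟨$⟩ʳ p ≡ p
    hook-fixed {ρ} pr {p} q with inHook? (ρ ⟨$⟩ʳ p)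
    ... | yes q′ = contradiction (≡.trans (≡.sym (hook-∈ q′)) (≡.trans (keep pr p) (hook-∉ q))) λ ()
    ... | no q′ = Finₚ.toℕ-injective (ℕₚ.suc-injective (≡.trans (≡.sym (hook-∉ q′)) (≡.trans (keep pr p) (hook-∉ q))))

    private
      L = proj₁ (column-length part j)
      L-spec = proj₂ (column-length part j)

      -- The boxes of the hook are numbered from 0 to L: number m is row m of column j + 1 as long
      -- as m ≤ i, and row m - 1 of column j afterwards.
      Member : ℕ → Set
      Member m = Σ (Fin N) λ p → (c p ≡ j × i ≤ r p × suc (r p) ≡ m) ⊎ (c p ≡ suc j × r p ≤ i × r p ≡ m)

      member : ∀ m → m < suc L → Member m
      member m m<sL with m ℕ.≤? i
      ... | yes m≤i = pos m (suc j) q , inj₂ (c-pos _ _ q , ℕₚ.≤-trans (ℕₚ.≤-reflexive (r-pos _ _ q)) m≤i , r-pos _ _ q)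
        where q = ℕₚ.<-≤-trans corner (decreasing part m≤i)
      member zero _ | no m≰i = contradiction z≤n m≰i
      member (suc m) (s≤s m<L) | no m≰i = pos m j q
          , inj₁ (c-pos _ _ q , ℕₚ.≤-trans (ℕₚ.≤-pred (ℕₚ.≰⇒> m≰i)) (ℕₚ.≤-reflexive (≡.sym (r-pos _ _ q))) , cong suc (r-pos _ _ q))
        where q = proj₂ (L-spec m) m<L

      g : (m : Fin (suc L)) → Member (toℕ m)
      g m = member (toℕ m) (Finₚ.toℕ<n m)

      g∈ : ∀ m → InHook (proj₁ (g m))
      g∈ m with proj₂ (g m)
      ... | inj₁ (p , q , _) = inj₁ (p , q)
      ... | inj₂ (p , q , _) = inj₂ (p , q)

      separate : ∀ {m m′} (x : Member m) (y : Member m′) → proj₁ x ≡ proj₁ y → m ≡ m′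
      separate (p , inj₁ (_ , _ , e)) (.p , inj₁ (_ , _ , e′)) ≡.refl = ≡.trans (≡.sym e) e′
      separate (p , inj₂ (_ , _ , e)) (.p , inj₂ (_ , _ , e′)) ≡.refl = ≡.trans (≡.sym e) e′
      separate (p , inj₁ (e , _)) (.p , inj₂ (e′ , _)) ≡.refl = contradiction (≡.trans (≡.sym e) e′) (ℕₚ.<⇒≢ ℕₚ.≤-refl)
      separate (p , inj₂ (e , _)) (.p , inj₁ (e′ , _)) ≡.refl = contradiction (≡.trans (≡.sym e′) e) (ℕₚ.<⇒≢ ℕₚ.≤-refl)

      col≥j : ∀ {p} → InHook p → j ≤ c p
      col≥j (inj₁ (e , _)) = ℕₚ.≤-reflexive (≡.sym e)
      col≥j (inj₂ (e , _)) = ℕₚ.≤-trans (ℕₚ.n≤1+n j) (ℕₚ.≤-reflexive (≡.sym e))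

    hook-clash : ∀ τ → Pres c τ → Σ (Fin N) λ a → Σ (Fin N) λ b → a ≢ b × hook a ≡ hook b × r (τ ⟨$⟩ʳ a) ≡ r (τ ⟨$⟩ʳ b)
    hook-clash τ pr with Finₚ.pigeonhole (ℕₚ.n<1+n L) (λ m → Fin.fromℕ< (row<L m))
      where
      row<L : ∀ m → r (τ ⟨$⟩ʳ proj₁ (g m)) < L
      -- A column permutation leaves the box in column j or j + 1, where only the first L rows can
      -- have boxes.
      row<L m = proj₁ (L-spec _) (ℕₚ.≤-<-trans (ℕₚ.≤-trans (col≥j (g∈ m)) (ℕₚ.≤-reflexive (≡.sym (keep pr _)))) (c<λ _))
    ... | m , m′ , m<m′ , e = proj₁ (g m) , proj₁ (g m′)
        , (λ eq → ℕₚ.<⇒≢ m<m′ (separate (g m) (g m′) eq))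
        , ≡.trans (hook-∈ (g∈ m)) (≡.sym (hook-∈ (g∈ m′)))
        , ≡.trans (≡.sym (Finₚ.toℕ-fromℕ< _)) (≡.trans (cong toℕ e) (Finₚ.toℕ-fromℕ< _))

-- Monomials as kernels of labellings

record SameKernel {N} (f g : Label N) : Set where
  constructor same-kernel
  field
    to-ker   : ∀ a b → f a ≡ f b → g a ≡ g b
    from-ker : ∀ a b → g a ≡ g b → f a ≡ f b
open SameKernel

module _ {N : ℕ} where
  sk-sym : {f g : Label N} → SameKernel f g → SameKernel g f
  sk-sym (same-kernel p q) = same-kernel q p

  sk-trans : {f g h : Label N} → SameKernel f g → SameKernel g h → SameKernel f h
  sk-trans (same-kernel p q) (same-kernel p′ q′) = same-kernel (λ a b → p′ a b ∘ p a b) (λ a b → q a b ∘ q′ a b)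

  sk-≗ : {f g : Label N} → (∀ a → f a ≡ g a) → SameKernel f g
  sk-≗ e = same-kernel (λ a b p → ≡.trans (≡.sym (e a)) (≡.trans p (e b))) (λ a b p → ≡.trans (e a) (≡.trans p (≡.sym (e b))))

  sk-injective : {f g : Label N} (m : ℕ → ℕ) → (∀ {x y} → m x ≡ m y → x ≡ y) → (∀ a → f a ≡ m (g a)) → SameKernel f g
  sk-injective m inj e = same-kernel
    (λ a b p → inj (≡.trans (≡.sym (e a)) (≡.trans p (e b))))
    (λ a b p → ≡.trans (e a) (≡.trans (cong m p) (≡.sym (e b))))

  sk-act : {f g : Label N} (φ : Perm N) → SameKernel f g → SameKernel (actL φ f) (actL φ g)
  sk-act φ (same-kernel p q) = same-kernel (λ a b → p _ _) (λ a b → q _ _)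

  private
    xnor⇒≡ : ∀ x y → not (x xor y) ≡ true → x ≡ y
    xnor⇒≡ true  true  _ = ≡.refl
    xnor⇒≡ false false _ = ≡.refl

    ≡⇒xnor : ∀ x y → x ≡ y → not (x xor y) ≡ true
    ≡⇒xnor true  .true  ≡.refl = ≡.refl
    ≡⇒xnor false .false ≡.refl = ≡.refl

  sameKernel⇒ : (f g : Label N) → sameKernel f g ≡ true → SameKernel f g
  sameKernel⇒ f g t = same-kernel
    (λ a b p → ≡ᵇ⇒≡′ (≡.trans (≡.sym (entry a b)) (≡⇒≡ᵇ′ p)))
    (λ a b p → ≡ᵇ⇒≡′ (≡.trans (entry a b) (≡⇒≡ᵇ′ p)))
    where
    entry : ∀ a b → (f a ≡ᵇ f b) ≡ (g a ≡ᵇ g b)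
    entry a b = xnor⇒≡ _ _ (all-allFin⇒ (λ b → not ((f a ≡ᵇ f b) xor (g a ≡ᵇ g b)))
      (all-allFin⇒ _ t a) b)

  ⇒sameKernel : {f g : Label N} → SameKernel f g → sameKernel f g ≡ true
  ⇒sameKernel (same-kernel p q) = ⇒all-allFin _ λ a → ⇒all-allFin _ λ b → ≡⇒xnor _ _
    (Bool-ext (≡⇒≡ᵇ′ ∘ p a b ∘ ≡ᵇ⇒≡′) (≡⇒≡ᵇ′ ∘ q a b ∘ ≡ᵇ⇒≡′))

-- Permutations of a subset

-- The equation N₀ + M = N is not a field; it is recovered from the bijection. The disjoint union
-- suits the induction better than `Fin (N₀ + M)`.
record Splitting {N : ℕ} (P Q : Fin N → Set) : Set where
  field
    {N₀ M} : ℕ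
    bij    : (Fin N₀ ⊎ Fin M) ↔ Fin N
    left   : ∀ i → P (Inverse.to bij (inj₁ i))
    right  : ∀ j → Q (Inverse.to bij (inj₂ j))

splitting-suc : ∀ {N} {P Q : Fin (suc N) → Set} → P fzero → Splitting (P ∘ fsuc) (Q ∘ fsuc) → Splitting P Q
splitting-suc {N} p sp = record
  { N₀ = suc N₀ ; M = M ; bij = mk↔ₛ′ to from to-from from-to
  ; left = λ { fzero → p ; (fsuc i) → left i } ; right = right }
  where
  open Splitting sp
  to : Fin (suc N₀) ⊎ Fin M → Fin (suc N)
  to (inj₁ fzero)    = fzero
  to (inj₁ (fsuc i)) = fsuc (Inverse.to bij (inj₁ i))
  to (inj₂ j)        = fsuc (Inverse.to bij (inj₂ j))
  from : Fin (suc N) → Fin (suc N₀) ⊎ Fin M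
  from fzero    = inj₁ fzero
  from (fsuc a) = map₁ fsuc (Inverse.from bij a)
  to-map₁ : ∀ x → to (map₁ fsuc x) ≡ fsuc (Inverse.to bij x)
  to-map₁ (inj₁ i) = ≡.refl
  to-map₁ (inj₂ j) = ≡.refl
  to-from : ∀ a → to (from a) ≡ a
  to-from fzero    = ≡.refl
  to-from (fsuc a) = ≡.trans (to-map₁ _) (cong fsuc (Inverse.inverseˡ bij ≡.refl))
  from-to : ∀ x → from (to x) ≡ x
  from-to (inj₁ fzero)    = ≡.refl
  from-to (inj₁ (fsuc i)) = cong (map₁ fsuc) (Inverse.inverseʳ bij ≡.refl)
  from-to (inj₂ j)        = cong (map₁ fsuc) (Inverse.inverseʳ bij ≡.refl)

splitting-swap : ∀ {N} {P Q : Fin N → Set} → Splitting P Q → Splitting Q P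
splitting-swap sp = record
  { bij = mk↔ₛ′ (Inverse.to bij ∘ Sum.swap) (Sum.swap ∘ Inverse.from bij)
      (λ a → ≡.trans (cong (Inverse.to bij) (Sumₚ.swap-involutive _)) (Inverse.inverseˡ bij ≡.refl))
      (λ x → ≡.trans (cong Sum.swap (Inverse.inverseʳ bij ≡.refl)) (Sumₚ.swap-involutive x))
  ; left = right ; right = left }
  where open Splitting sp

splitting : ∀ {N} {P Q : Fin N → Set} → (∀ a → P a ⊎ Q a) → Splitting P Q
splitting {zero} _ = record
  { N₀ = 0 ; M = 0 ; bij = mk↔ₛ′ [ (λ x → x) , (λ x → x) ]′ inj₁ (λ ()) λ { (inj₁ ()) ; (inj₂ ()) }
  ; left = λ () ; right = λ () }
splitting {suc N} P∪Q with P∪Q fzero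
... | inj₁ p = splitting-suc p (splitting (P∪Q ∘ fsuc))
... | inj₂ q = splitting-swap (splitting-suc q (splitting (Sum.swap ∘ P∪Q ∘ fsuc)))

split-elim : ∀ {m n a} (P : Fin (m ℕ.+ n) → Set a) → (∀ i → P (i ↑ˡ n)) → (∀ j → P (m ↑ʳ j)) → ∀ x → P x
split-elim {m} {n} P l r x = subst P (Finₚ.join-splitAt m n x) (go (splitAt m x))
  where
  go : ∀ y → P (join m n y)
  go (inj₁ i) = l i
  go (inj₂ j) = r j

sum-split : ∀ m {n} (t : Fin (m ℕ.+ n) → ℕ) → sum t ≡ sum (λ i → t (i ↑ˡ n)) ℕ.+ sum (λ j → t (m ↑ʳ j))
sum-split zero    t = ≡.refl
sum-split (suc m) t = ≡.trans (cong (t fzero ℕ.+_) (sum-split m (t ∘ fsuc))) (≡.sym (ℕₚ.+-assoc (t fzero) _ _))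

sum-zero : ∀ {n} {t : Fin n → ℕ} → (∀ i → t i ≡ 0) → sum t ≡ 0
sum-zero {n} p = ≡.trans (sum-cong-≗ p) (sum-replicate-zero n)

module _ {m n : ℕ} where

  private
    embedding : (Fin m → Fin m) → Fin (m ℕ.+ n) → Fin (m ℕ.+ n)
    embedding f x = join m n (map₁ f (splitAt m x))

    embedding-inverse : ∀ {f g : Fin m → Fin m} → (∀ i → f (g i) ≡ i) → ∀ x → embedding f (embedding g x) ≡ x
    embedding-inverse {f} {g} e x = ≡.trans (cong (join m n ∘ map₁ f) (Finₚ.splitAt-join m n (map₁ g (splitAt m x))))
      (≡.trans (cong (join m n) (cancel (splitAt m x))) (Finₚ.join-splitAt m n x))
      where
      cancel : ∀ y → map₁ f (map₁ g y) ≡ y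
      cancel (inj₁ i) = cong inj₁ (e i)
      cancel (inj₂ j) = ≡.refl

  embed : Perm m → Perm (m ℕ.+ n)
  embed σ = Perm.permutation (embedding (σ ⟨$⟩ʳ_)) (embedding (σ ⟨$⟩ˡ_))
    (embedding-inverse λ i → inverseʳ σ) (embedding-inverse λ i → inverseˡ σ)

  embed-left : ∀ σ i → embed σ ⟨$⟩ʳ (i ↑ˡ n) ≡ (σ ⟨$⟩ʳ i) ↑ˡ n
  embed-left σ i = cong (join m n ∘ map₁ (σ ⟨$⟩ʳ_)) (Finₚ.splitAt-↑ˡ m i n)

  embed-right : ∀ σ j → embed σ ⟨$⟩ʳ (m ↑ʳ j) ≡ m ↑ʳ j
  embed-right σ j = cong (join m n ∘ map₁ (σ ⟨$⟩ʳ_)) (Finₚ.splitAt-↑ʳ m n j)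

  embed-leftˡ : ∀ σ i → embed σ ⟨$⟩ˡ (i ↑ˡ n) ≡ (σ ⟨$⟩ˡ i) ↑ˡ n
  embed-leftˡ σ i = cong (join m n ∘ map₁ (σ ⟨$⟩ˡ_)) (Finₚ.splitAt-↑ˡ m i n)

  embed-rightˡ : ∀ σ j → embed σ ⟨$⟩ˡ (m ↑ʳ j) ≡ m ↑ʳ j
  embed-rightˡ σ j = cong (join m n ∘ map₁ (σ ⟨$⟩ˡ_)) (Finₚ.splitAt-↑ʳ m n j)

  -- The first block precedes the second, is mapped to itself, and the second is fixed pointwise; so
  -- only pairs inside the first block can be inverted.
  inversions-embed : ∀ σ → inversions (embed σ) ≡ inversions σ
  inversions-embed σ = begin
    inversions (embed σ)
      ≡⟨ inversions-sum (embed σ) ⟩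
    sum (λ a → sum λ b → inv a b)
      ≡⟨ sum-split m (λ a → sum λ b → inv a b) ⟩
    sum (λ i → sum λ b → inv (i ↑ˡ n) b) ℕ.+ sum (λ j → sum λ b → inv (m ↑ʳ j) b)
      ≡⟨ cong₂ ℕ._+_ (sum-cong-≗ λ i → ≡.trans (sum-split m (inv (i ↑ˡ n)))
           (≡.trans (cong₂ ℕ._+_ (sum-cong-≗ λ i′ → inner i i′) (sum-zero λ j → mixed i j)) (ℕₚ.+-identityʳ _)))
         (sum-zero λ j → ≡.trans (sum-split m (inv (m ↑ʳ j)))
           (cong₂ ℕ._+_ (sum-zero λ i → mixed′ i j) (sum-zero λ j′ → outer j j′))) ⟩
    sum (λ i → sum λ i′ → b2n ((toℕ i <ᵇ toℕ i′) ∧ (toℕ (σ ⟨$⟩ʳ i′) <ᵇ toℕ (σ ⟨$⟩ʳ i)))) ℕ.+ 0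
      ≡⟨ ℕₚ.+-identityʳ _ ⟩
    sum (λ i → sum λ i′ → b2n ((toℕ i <ᵇ toℕ i′) ∧ (toℕ (σ ⟨$⟩ʳ i′) <ᵇ toℕ (σ ⟨$⟩ʳ i))))
      ≡⟨ inversions-sum σ ⟨
    inversions σ ∎
    where
    open ≡.≡-Reasoning
    s : Fin (m ℕ.+ n) → ℕ
    s x = toℕ (embed σ ⟨$⟩ʳ x)
    inv : Fin (m ℕ.+ n) → Fin (m ℕ.+ n) → ℕ
    inv a b = b2n ((toℕ a <ᵇ toℕ b) ∧ (s b <ᵇ s a))
    s-left : ∀ i → s (i ↑ˡ n) ≡ toℕ (σ ⟨$⟩ʳ i)
    s-left i = ≡.trans (cong toℕ (embed-left σ i)) (Finₚ.toℕ-↑ˡ _ n)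
    s-right : ∀ j → s (m ↑ʳ j) ≡ m ℕ.+ toℕ j
    s-right j = ≡.trans (cong toℕ (embed-right σ j)) (Finₚ.toℕ-↑ʳ m j)
    <ᵇ-false : ∀ {x y} → y ≤ x → (x <ᵇ y) ≡ false
    <ᵇ-false {x} {y} y≤x = Boolₚ.¬-not λ e → ℕₚ.<⇒≱ (ℕₚ.<ᵇ⇒< x y (subst T (≡.sym e) _)) y≤x
    inner : ∀ i i′ → inv (i ↑ˡ n) (i′ ↑ˡ n) ≡ b2n ((toℕ i <ᵇ toℕ i′) ∧ (toℕ (σ ⟨$⟩ʳ i′) <ᵇ toℕ (σ ⟨$⟩ʳ i)))
    inner i i′ rewrite s-left i | s-left i′ | Finₚ.toℕ-↑ˡ i n | Finₚ.toℕ-↑ˡ i′ n = ≡.refl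
    mixed : ∀ i j → inv (i ↑ˡ n) (m ↑ʳ j) ≡ 0
    mixed i j rewrite s-left i | s-right j
      | <ᵇ-false (ℕₚ.≤-trans (ℕₚ.<⇒≤ (Finₚ.toℕ<n (σ ⟨$⟩ʳ i))) (ℕₚ.m≤m+n m (toℕ j))) = cong b2n (Boolₚ.∧-zeroʳ _)
    mixed′ : ∀ i j → inv (m ↑ʳ j) (i ↑ˡ n) ≡ 0
    mixed′ i j rewrite Finₚ.toℕ-↑ˡ i n | Finₚ.toℕ-↑ʳ m j
      | <ᵇ-false (ℕₚ.≤-trans (ℕₚ.<⇒≤ (Finₚ.toℕ<n i)) (ℕₚ.m≤m+n m (toℕ j))) = ≡.refl
    outer : ∀ j j′ → inv (m ↑ʳ j) (m ↑ʳ j′) ≡ 0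
    outer j j′ rewrite s-right j | s-right j′ | Finₚ.toℕ-↑ʳ m j | Finₚ.toℕ-↑ʳ m j′ = cong b2n (<ᵇ-asym (m ℕ.+ toℕ j) (m ℕ.+ toℕ j′))

  only-left : ∀ x → (∀ j → x ≢ m ↑ʳ j) → Σ (Fin m) λ i → i ↑ˡ n ≡ x
  only-left = split-elim (λ x → (∀ j → x ≢ m ↑ʳ j) → Σ (Fin m) λ i → i ↑ˡ n ≡ x)
    (λ i _ → i , ≡.refl) (λ j p → contradiction ≡.refl (p j))

  left≢right : ∀ {i j} → i ↑ˡ n ≢ m ↑ʳ j
  left≢right {i} {j} e = contradiction (≡.trans (≡.sym (Finₚ.splitAt-↑ˡ m i n)) (≡.trans (cong (splitAt m) e) (Finₚ.splitAt-↑ʳ m n j))) λ ()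

  restrict : (s : Perm (m ℕ.+ n)) → (∀ j → s ⟨$⟩ʳ (m ↑ʳ j) ≡ m ↑ʳ j) → Σ (Perm m) λ σ → ∀ i → (σ ⟨$⟩ʳ i) ↑ˡ n ≡ s ⟨$⟩ʳ (i ↑ˡ n)
  restrict s fix = Perm.permutation (λ i → proj₁ (fwd i)) (λ i → proj₁ (bwd i))
      (λ i → Finₚ.↑ˡ-injective n _ _ (≡.trans (proj₂ (fwd _)) (≡.trans (cong (s ⟨$⟩ʳ_) (proj₂ (bwd i))) (inverseʳ s))))
      (λ i → Finₚ.↑ˡ-injective n _ _ (≡.trans (proj₂ (bwd _)) (≡.trans (cong (s ⟨$⟩ˡ_) (proj₂ (fwd i))) (inverseˡ s))))
    , λ i → proj₂ (fwd i)
    where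
    fwd : ∀ i → Σ (Fin m) λ i′ → i′ ↑ˡ n ≡ s ⟨$⟩ʳ (i ↑ˡ n)
    fwd i = only-left _ λ j e → left≢right (perm-injective s (≡.trans e (≡.sym (fix j))))
    bwd : ∀ i → Σ (Fin m) λ i′ → i′ ↑ˡ n ≡ s ⟨$⟩ˡ (i ↑ˡ n)
    bwd i = only-left _ λ j e → left≢right (≡.trans (≡.sym (inverseʳ s)) (≡.trans (cong (s ⟨$⟩ʳ_) e) (fix j)))

module Extension {N₀ M : ℕ} (φ : Perm (N₀ ℕ.+ M)) (in0 : Fin (N₀ ℕ.+ M) → Bool)
  (left-∈ : ∀ i → in0 (φ ⟨$⟩ʳ (i ↑ˡ M)) ≡ true) (right-∉ : ∀ j → in0 (φ ⟨$⟩ʳ (N₀ ↑ʳ j)) ≡ false) where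

  N = N₀ ℕ.+ M

  φ-elim : ∀ {a} (P : Fin N → Set a) → (∀ i → P (φ ⟨$⟩ʳ (i ↑ˡ M))) → (∀ j → P (φ ⟨$⟩ʳ (N₀ ↑ʳ j))) → ∀ x → P x
  φ-elim P l r x = subst P (inverseʳ φ) (split-elim (λ y → P (φ ⟨$⟩ʳ y)) l r (φ ⟨$⟩ˡ x))

  ext : Perm N₀ → Perm N
  ext σ = φ · (embed σ · flip φ)

  ext-left : ∀ σ i → ext σ ⟨$⟩ʳ (φ ⟨$⟩ʳ (i ↑ˡ M)) ≡ φ ⟨$⟩ʳ ((σ ⟨$⟩ʳ i) ↑ˡ M)
  ext-left σ i = cong (φ ⟨$⟩ʳ_) (≡.trans (cong (embed σ ⟨$⟩ʳ_) (inverseˡ φ)) (embed-left σ i))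

  ext-right : ∀ σ j → ext σ ⟨$⟩ʳ (φ ⟨$⟩ʳ (N₀ ↑ʳ j)) ≡ φ ⟨$⟩ʳ (N₀ ↑ʳ j)
  ext-right σ j = cong (φ ⟨$⟩ʳ_) (≡.trans (cong (embed σ ⟨$⟩ʳ_) (inverseˡ φ)) (embed-right σ j))

  ext-leftˡ : ∀ σ i → ext σ ⟨$⟩ˡ (φ ⟨$⟩ʳ (i ↑ˡ M)) ≡ φ ⟨$⟩ʳ ((σ ⟨$⟩ˡ i) ↑ˡ M)
  ext-leftˡ σ i = cong (φ ⟨$⟩ʳ_) (≡.trans (cong (embed σ ⟨$⟩ˡ_) (inverseˡ φ)) (embed-leftˡ σ i))

  ext-rightˡ : ∀ σ j → ext σ ⟨$⟩ˡ (φ ⟨$⟩ʳ (N₀ ↑ʳ j)) ≡ φ ⟨$⟩ʳ (N₀ ↑ʳ j)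
  ext-rightˡ σ j = cong (φ ⟨$⟩ʳ_) (≡.trans (cong (embed σ ⟨$⟩ˡ_) (inverseˡ φ)) (embed-rightˡ σ j))

  ext-cong : ∀ {σ τ} → σ ≐ τ → ext σ ≐ ext τ
  ext-cong {σ} {τ} e = ptw (φ-elim _
    (λ i → ≡.trans (ext-left σ i) (≡.trans (cong (λ z → φ ⟨$⟩ʳ (z ↑ˡ M)) (at e i)) (≡.sym (ext-left τ i))))
    (λ j → ≡.trans (ext-right σ j) (≡.sym (ext-right τ j))))

  FixOutside : Perm N → Set
  FixOutside π = ∀ a → in0 a ≡ false → π ⟨$⟩ʳ a ≡ a

  fix? : ∀ π → Dec (FixOutside π)
  fix? π = Finₚ.all? λ a → (in0 a Boolₚ.≟ false) →-dec (π ⟨$⟩ʳ a Finₚ.≟ a)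

  restriction : ∀ π → FixOutside π → Σ (Perm N₀) λ σ → ext σ ≐ π
  restriction π fx with restrict (flip φ · (π · φ)) (λ j → ≡.trans (cong (φ ⟨$⟩ˡ_) (fx _ (right-∉ j))) (inverseˡ φ))
  ... | σ , e = σ , ptw (φ-elim _
    (λ i → ≡.trans (ext-left σ i) (≡.trans (cong (φ ⟨$⟩ʳ_) (e i)) (inverseʳ φ)))
    (λ j → ≡.trans (ext-right σ j) (≡.sym (fx _ (right-∉ j)))))

  ext-injective : ∀ {σ τ} → ext σ ≐ ext τ → σ ≐ τ
  ext-injective {σ} {τ} e = ptw λ i → Finₚ.↑ˡ-injective M _ _ (perm-injective φ
    (≡.trans (≡.sym (ext-left σ i)) (≡.trans (at e _) (ext-left τ i))))

  ext-fixes : ∀ σ → FixOutside (ext σ)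
  ext-fixes σ = φ-elim _ (λ i e → true≢false (left-∈ i) e) (λ j _ → ext-right σ j)

  restr : Perm N → Perm N₀
  restr π with fix? π
  ... | yes fx = proj₁ (restriction π fx)
  -- An arbitrary value: the reindexing uses `restr` only where `fix?` holds.
  ... | no _   = idₚ

  restr-ext : ∀ π → FixOutside π → ext (restr π) ≐ π
  restr-ext π fx with fix? π
  ... | yes fx′ = proj₂ (restriction π fx′)
  ... | no ne   = contradiction fx ne

  module ExtSums {u ℓ : Level} (R : CommutativeRing u ℓ) where
    open CommutativeRing R
    open Sums R
    open PermSums R

    -- The column function of Column is irrelevant to isolate.
    open Column {N} (λ _ → 0) in0 using (isolate; isolate-injective; isolate-∈; Pres-isolate⇒Fix)

    -- Extension by the identity matches the group of `l₀` with that of `isolate l`. This is how the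
    -- symmetrizer of S, a sum over permutations of N₀ points, becomes a sum over permutations of
    -- all N entries.
    ∑G-ext : ∀ (l : Fin N → ℕ) (l₀ : Fin N₀ → ℕ) → (∀ i → l (φ ⟨$⟩ʳ (i ↑ˡ M)) ≡ l₀ i) →
             ∀ {h} → Resp h → ∑G l₀ (h ∘ ext) ≈ ∑G (isolate l) h
    ∑G-ext l l₀ e {h} rs = trans (∑G-def l₀ _) (trans
      (∑-cong (allPerms N₀) λ σ → reflexive (cong (_▸ h (ext σ)) (Bool-ext
        (λ t → Pres⇒inG (isolate l) (ext σ) (up σ (inG⇒Pres l₀ σ t)))
        (λ t → Pres⇒inG l₀ σ (down σ (inG⇒Pres (isolate l) (ext σ) t))))))
      (trans (∑P-reindex ext restr (λ π → does (fix? π)) ext-cong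
        (λ σ ρ eq → let fx = λ a p → ≡.trans (≡.sym (at eq a)) (ext-fixes σ a p) in
           dec-true (fix? ρ) fx , ext-injective (≐-trans eq (≐-sym (restr-ext ρ fx))))
        (λ ρ t → restr-ext ρ (does⇒ (fix? ρ) t)) (▸-resp (isolate l) rs))
      -- Preserving `isolate l` already forces the complement of A₀ to be fixed, so the guard for
      -- the image of `ext` disappears.
      (trans (∑-cong (allPerms N) λ π → absorb (inG (isolate l) π) (does (fix? π)) λ t →
          dec-true (fix? π) (Pres-isolate⇒Fix l (inG⇒Pres (isolate l) π t)))
        (sym (∑G-def (isolate l) h)))))
      where
      absorb : ∀ a b {x} → (a ≡ true → b ≡ true) → b ▸ a ▸ x ≈ a ▸ x
      absorb true  true  p = refl
      absorb true  false p = true≢false (p ≡.refl) ≡.refl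
      absorb false true  p = refl
      absorb false false p = refl
      up : ∀ σ → Pres l₀ σ → Pres (isolate l) (ext σ)
      up σ p = pres (φ-elim _
        (λ i → ≡.trans (cong (isolate l) (ext-left σ i)) (≡.trans (isolate-∈ l (left-∈ _)) (≡.trans
           (cong (2 ℕ.*_) (≡.trans (e _) (≡.trans (keep p i) (≡.sym (e i))))) (≡.sym (isolate-∈ l (left-∈ i))))))
        (λ j → cong (isolate l) (ext-right σ j)))
      down : ∀ σ → Pres (isolate l) (ext σ) → Pres l₀ σ
      down σ p = pres λ i → ≡.trans (≡.sym (e _)) (≡.trans (isolate-injective l (left-∈ _) (left-∈ i)
        (≡.trans (cong (isolate l) (≡.sym (ext-left σ i))) (keep p _))) (e i))

count-sum : ∀ {a p} {A : Set a} {P : A → Set p} (P? : ∀ x → Dec (P x)) {n} (f : Fin n → A) →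
            length (filter P? (tabulate f)) ≡ sum (λ i → b2n (does (P? (f i))))
count-sum P? {zero}  f = ≡.refl
count-sum P? {suc n} f with does (P? (f fzero))
... | true  = cong suc (count-sum P? (f ∘ fsuc))
... | false = count-sum P? (f ∘ fsuc)

-- A block that avoids the first m points lies entirely among the others and keeps its size. This
-- makes the blocks outside [k] a well-formed monomial of their own.
count-outside : ∀ {m n N} (φ : Fin (m ℕ.+ n) ↔ Fin N) (f : Fin N → ℕ) v → (∀ i → f (φ ⟨$⟩ʳ (i ↑ˡ n)) ≢ v) →
  length (filter (λ j → f (φ ⟨$⟩ʳ (m ↑ʳ j)) ℕ.≟ v) (allFin n)) ≡ length (filter (λ a → f a ℕ.≟ v) (allFin N))
count-outside {m} {n} φ f v outside = begin
  length (filter (λ j → f (φ ⟨$⟩ʳ (m ↑ʳ j)) ℕ.≟ v) (allFin n))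
    ≡⟨ count-sum (λ j → f (φ ⟨$⟩ʳ (m ↑ʳ j)) ℕ.≟ v) (λ j → j) ⟩
  sum (λ j → hit (φ ⟨$⟩ʳ (m ↑ʳ j)))
    ≡⟨ cong (ℕ._+ sum (λ j → hit (φ ⟨$⟩ʳ (m ↑ʳ j)))) (sum-zero λ i → cong b2n (dec-false (f (φ ⟨$⟩ʳ (i ↑ˡ n)) ℕ.≟ v) (outside i))) ⟨
  sum (λ i → hit (φ ⟨$⟩ʳ (i ↑ˡ n))) ℕ.+ sum (λ j → hit (φ ⟨$⟩ʳ (m ↑ʳ j)))
    ≡⟨ sum-split m (λ x → hit (φ ⟨$⟩ʳ x)) ⟨
  sum (λ x → hit (φ ⟨$⟩ʳ x))
    ≡⟨ sum-permute hit φ ⟨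
  sum hit
    ≡⟨ count-sum (λ a → f a ℕ.≟ v) (λ a → a) ⟨
  length (filter (λ a → f a ℕ.≟ v) (allFin _)) ∎
  where
  open ≡.≡-Reasoning
  hit : Fin _ → ℕ
  hit a = b2n (does (f a ℕ.≟ v))

-- Sorted lists and the set 𝒢

permute-bound : ∀ {xs ys ys′} → Pointwise _≤_ xs ys → ys ↭ ys′ → Σ (List ℕ) λ xs′ → xs ↭ xs′ × Pointwise _≤_ xs′ ys′
permute-bound p ↭.refl = _ , ↭-refl , p
permute-bound (x≤y ∷ p) (↭.prep y q) with permute-bound p q
... | xs′ , r , p′ = _ , ↭.prep _ r , x≤y ∷ p′
permute-bound (x≤y ∷ x≤y′ ∷ p) (↭.swap y y′ q) with permute-bound p q
... | xs′ , r , p′ = _ , ↭.swap _ _ r , x≤y′ ∷ x≤y ∷ p′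
permute-bound p (↭.trans q q′) with permute-bound p q
... | xs′ , r , p′ with permute-bound p′ q′
...   | xs″ , r′ , p″ = xs″ , ↭.trans r r′ , p″

-- `zs` is `xs` with z replaced by x, which lies below every bound in `ys`.
exchange-head : ∀ {x z xs ys} → z ∈ xs → All (x ≤_) ys → Pointwise _≤_ xs ys →
                Σ (List ℕ) λ zs → x ∷ xs ↭ z ∷ zs × Pointwise _≤_ zs ys
exchange-head {x} {z} (here ≡.refl) (x≤y ∷ _) (_ ∷ p) = _ , ↭-swap x z ↭-refl , x≤y ∷ p
exchange-head {x} {z} {w ∷ xs} (there z∈) (_ ∷ a) (w≤y ∷ p) with exchange-head z∈ a p
... | zs , r , p′ = w ∷ zs , ↭.trans (↭-swap x w ↭-refl) (↭.trans (↭.prep w r) (↭-swap w z ↭-refl)) , w≤y ∷ p′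

-- The head z of the sorted list is minimal, so z ≤ x ≤ y. If z comes from deeper in the list, x
-- takes its place there and still satisfies the bound, as y is the least of the bounds.
sorted-bound : ∀ {xs ys zs} → AllPairs _≤_ ys → AllPairs _≤_ zs → zs ↭ xs → Pointwise _≤_ xs ys → Pointwise _≤_ zs ys
sorted-bound {zs = []}     sy sz r [] = []
sorted-bound {zs = z ∷ zs} sy sz r [] = contradiction r ↭ₚ.¬x∷xs↭[]
sorted-bound {zs = []}     sy sz r (_ ∷ _) = contradiction (↭-sym r) ↭ₚ.¬x∷xs↭[]
sorted-bound {x ∷ xs} {y ∷ ys} {z ∷ zs} (ay ∷ sy) (az ∷ sz) r (x≤y ∷ p) with ↭ₚ.∈-resp-↭ r (here ≡.refl)
... | here ≡.refl = x≤y ∷ sorted-bound sy sz (↭ₚ.drop-∷ r) p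
... | there z∈ with exchange-head z∈ (All.map (ℕₚ.≤-trans x≤y) ay) p
...   | ws , r′ , p′ = ℕₚ.≤-trans z≤x x≤y ∷ sorted-bound sy sz (↭ₚ.drop-∷ (↭.trans r r′)) p′
  where
  z≤x : z ≤ x
  z≤x with ↭ₚ.∈-resp-↭ (↭-sym r) (here ≡.refl)
  ... | here e = ℕₚ.≤-reflexive (≡.sym e)
  ... | there x∈ = All.lookup az x∈

-- This links `Good`, which compares each entry with its own home column, to `⪯`, which compares
-- sorted lists of columns.
sort-mono : ∀ {xs ys} → Pointwise _≤_ xs ys → Pointwise _≤_ (sort xs) (sort ys)
sort-mono {xs} {ys} p with permute-bound p (↭-sym (sort-↭ ys))
... | xs′ , r , p′ = sorted-bound (Sorted⇒AllPairs ℕₚ.≤-totalOrder (sort-↗ ys)) (Sorted⇒AllPairs ℕₚ.≤-totalOrder (sort-↗ xs)) (↭.trans (sort-↭ xs) r) p′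

sort-resp-↭ : ∀ {xs ys} → xs ↭ ys → sort xs ≡ sort ys
sort-resp-↭ {xs} {ys} r = Pointwise.Pointwise-≡⇒≡ (go (≤≥ xs ys r) (≤≥ ys xs (↭-sym r)))
  where
  ≤≥ : ∀ xs ys → xs ↭ ys → Pointwise _≤_ (sort xs) (sort ys)
  ≤≥ xs ys r = sorted-bound (Sorted⇒AllPairs ℕₚ.≤-totalOrder (sort-↗ ys)) (Sorted⇒AllPairs ℕₚ.≤-totalOrder (sort-↗ xs))
    (↭.trans (sort-↭ xs) (↭.trans r (↭-sym (sort-↭ ys)))) (Pointwise.refl ℕₚ.≤-refl)
  go : ∀ {as bs} → Pointwise _≤_ as bs → Pointwise _≤_ bs as → Pointwise _≡_ as bs
  go []      []      = []
  go (p ∷ q) (r ∷ s) = ℕₚ.≤-antisym p r ∷ go q s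

-- Sorting forgets which entry moved but keeps the sum, so a strict position in the sorted lists has
-- to be found from the sums.
strict-somewhere : ∀ {xs ys} → Pointwise _≤_ xs ys → ListAction.sum xs < ListAction.sum ys → Any (uncurry _<_) (zip xs ys)
strict-somewhere {x ∷ xs} {y ∷ ys} (x≤y ∷ p) lt with ℕₚ.m≤n⇒m<n∨m≡n x≤y
... | inj₁ x<y = here x<y
... | inj₂ ≡.refl = there (strict-somewhere p (ℕₚ.+-cancelˡ-< x _ _ lt))

filter-map : ∀ {a b p} {A : Set a} {B : Set b} {P : B → Set p} (P? : ∀ x → Dec (P x)) (m : A → B) xs →
             filter P? (map m xs) ≡ map m (filter (λ x → P? (m x)) xs)
filter-map P? m []       = ≡.refl
filter-map P? m (x ∷ xs) with does (P? (m x))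
... | true  = cong (m x ∷_) (filter-map P? m xs)
... | false = filter-map P? m xs

row<length : ∀ xs {i j} → j < xs ! i → i < length xs
row<length (x ∷ xs) {zero}  _  = s≤s z≤n
row<length (x ∷ xs) {suc i} lt = s≤s (row<length xs lt)

boxRow : ∀ λ' i → List (Box λ')
boxRow λ' i = map (λ j → box i (toℕ j) (Finₚ.toℕ<n j)) (allFin (λ' ! i))

∈-boxRow⇒row : ∀ {λ' i} {b : Box λ'} → b ∈ boxRow λ' i → row b ≡ i
∈-boxRow⇒row b∈ with ∈-map⁻ _ b∈
... | j , _ , e = cong row e

allBoxes-unique : ∀ λ' → Unique (allBoxes λ')
allBoxes-unique λ' = Uniqueₚ.concat⁺
  (Allₚ.map⁺ (All.universal (λ i → Uniqueₚ.map⁺ (λ e → Finₚ.toℕ-injective (cong col e)) (Uniqueₚ.allFin⁺ (λ' ! i))) _))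
  (AllPairsₚ.map⁺ (AllPairs.map disjoint (Uniqueₚ.upTo⁺ (length λ'))))
  where
  disjoint : ∀ {i i′} → i ≢ i′ → ∀ {b} → ¬ (b ∈ boxRow λ' i × b ∈ boxRow λ' i′)
  disjoint i≢i′ (p , q) = i≢i′ (≡.trans (≡.sym (∈-boxRow⇒row p)) (∈-boxRow⇒row q))

allBoxes-complete : ∀ λ' b → b ∈ allBoxes λ'
allBoxes-complete λ' b@(box i j p) = ∈-concatMap⁺ (boxRow λ') (lose (∈-upTo⁺ (row<length λ' p))
  (subst (_∈ boxRow λ' i) (box-≡ {a = box i _ (Finₚ.toℕ<n (Fin.fromℕ< p))} {b} ≡.refl (Finₚ.toℕ-fromℕ< p)) (∈-map⁺ _ (∈-allFin (Fin.fromℕ< p)))))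

enumeration-↭ : ∀ {a} {A : Set a} {N} {xs : List A} → Unique xs → (∀ x → x ∈ xs) → (e : Fin N ↔ A) → xs ↭ map (Inverse.to e) (allFin N)
enumeration-↭ {xs = xs} uniq complete e = ∼bag⇒↭ (unique∧set⇒bag uniq
  (Uniqueₚ.map⁺ (λ p → ≡.trans (≡.sym (Inverse.inverseʳ e ≡.refl)) (≡.trans (cong (Inverse.from e) p) (Inverse.inverseʳ e ≡.refl))) (Uniqueₚ.allFin⁺ _))
  λ {x} → mk⇔ (λ _ → subst (_∈ map (Inverse.to e) (allFin _)) (Inverse.inverseˡ e ≡.refl) (∈-map⁺ (Inverse.to e) (∈-allFin (Inverse.from e x))))
              (λ _ → complete x))

fibre-↭ : ∀ {λ' N} (e : Fin N ↔ Box λ') (G : Box λ' → ℕ) (f : Fin N → ℕ) → (∀ s → G (Inverse.to e s) ≡ f s) → ∀ i →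
          filter (λ b → G b ℕ.≟ i) (allBoxes λ') ↭ map (Inverse.to e) (filter (λ s → f s ℕ.≟ i) (allFin N))
fibre-↭ {λ'} {N} e G f eq i = ↭-trans
  (↭ₚ.filter-↭ (λ b → G b ℕ.≟ i) (enumeration-↭ (allBoxes-unique λ') (allBoxes-complete λ') e))
  (≡.subst (λ z → filter (λ b → G b ℕ.≟ i) (map (Inverse.to e) (allFin N)) ↭ map (Inverse.to e) z)
    (Listₚ.filter-≐ (λ s → G (Inverse.to e s) ℕ.≟ i) (λ s → f s ℕ.≟ i)
      ((λ {s} p → ≡.trans (≡.sym (eq s)) p) , (λ {s} p → ≡.trans (eq s) p)) (allFin N))
    (≡.subst (filter (λ b → G b ℕ.≟ i) (map (Inverse.to e) (allFin N)) ↭_)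
      (filter-map (λ b → G b ℕ.≟ i) (Inverse.to e) (allFin N)) ↭-refl))

bounded-prefix : (P : ℕ → Set) → (∀ j → Dec (P j)) → (∀ {j j′} → j′ ≤ j → P j → P j′) → ∀ x → (∀ j → P j → j < x) →
                 Σ ℕ λ w → ∀ j → (P j → j < w) × (j < w → P j)
bounded-prefix P P? down zero    bound = 0 , λ j → (λ p → contradiction (bound j p) λ ()) , λ ()
bounded-prefix P P? down (suc x) bound with P? x
... | yes px = suc x , λ j → bound j , λ { (s≤s j≤x) → down j≤x px }
... | no npx = bounded-prefix P P? down x λ j p → ℕₚ.≤∧≢⇒< (ℕₚ.≤-pred (bound j p)) λ { ≡.refl → npx p }

down-closed⇒partition : (P : ℕ → ℕ → Set) → (∀ i j → Dec (P i j)) → (∀ {i i′ j j′} → i′ ≤ i → j′ ≤ j → P i j → P i′ j′) →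
  ∀ xs → (∀ i j → P i j → j < xs ! i) → Σ (List ℕ) λ δ → IsPartition δ × ∀ i j → (P i j → j < δ ! i) × (j < δ ! i → P i j)
down-closed⇒partition P P? down []       bound = [] , [] , λ i j → (λ p → contradiction (bound i j p) λ ()) , λ ()
down-closed⇒partition P P? down (x ∷ xs) bound
  with bounded-prefix (P 0) (P? 0) (down z≤n) x (bound 0)
     | down-closed⇒partition (λ i → P (suc i)) (λ i → P? (suc i)) (λ le → down (s≤s le)) xs (λ i → bound (suc i))
-- An empty first row ends δ, since parts are positive; by `down` all later rows are empty as well.
... | zero , empty | _ = [] , [] , λ i j → (λ p → contradiction (proj₁ (empty j) (down z≤n ℕₚ.≤-refl p)) λ ()) , λ ()
... | suc w , first | δ , part , spec = suc w ∷ δ , cons δ part spec , λ where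
      zero    j → first j
      (suc i) j → spec i j
  where
  cons : ∀ δ → IsPartition δ → (∀ i j → (P (suc i) j → j < δ ! i) × (j < δ ! i → P (suc i) j)) → IsPartition (suc w ∷ δ)
  cons []          _ _ = single (s≤s z≤n)
  cons (zero ∷ δ)  p s = z≤n ∷ p
  cons (suc y ∷ δ) p s = proj₁ (first y) (down z≤n ℕₚ.≤-refl (proj₂ (s 0 y) ℕₚ.≤-refl)) ∷ p

module Membership {N k n d : ℕ} {λ' : List ℕ} (part : IsPartition λ') (T : Box λ' ↔ Fin N)
  (F : Box λ' → ℕ) (tab : IsYoungTab d n λ' F) where

  open Positions part T

  f : Fin N → ℕ
  f a = F (Inverse.from T a)

  in0 : Fin N → Bool
  in0 a = does (f a ℕ.<? k)

  open Column c in0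

  fibre : ℕ → List (Fin N)
  fibre i = filter (λ s → f s ℕ.≟ i) (allFin N)

  module _ (π : Perm N) (G : Box λ' → ℕ) (G-def : ∀ b → G b ≡ f (π ⟨$⟩ˡ Inverse.to T b)) where

    private
      -- Entry s goes to the box that it occupies after π. In this numbering of the boxes G becomes
      -- f for every π, so the fibres of G are those of f moved by π.
      e : Fin N ↔ Box λ'
      e = record
        { to = λ s → Inverse.from T (π ⟨$⟩ʳ s) ; from = λ b → π ⟨$⟩ˡ Inverse.to T b
        ; to-cong = cong _ ; from-cong = cong _
        ; inverse = (λ { ≡.refl → ≡.trans (cong (Inverse.from T) (inverseʳ π)) (Inverse.inverseʳ T ≡.refl) })
                  , (λ { ≡.refl → ≡.trans (cong (π ⟨$⟩ˡ_) (Inverse.inverseˡ T ≡.refl)) (inverseˡ π) }) }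

      G-e : ∀ s → G (Inverse.to e s) ≡ f s
      G-e s = ≡.trans (G-def _) (cong f (Inverse.inverseʳ e ≡.refl))

    fiberSize-fibre : ∀ i → fiberSize λ' G i ≡ length (fibre i)
    fiberSize-fibre i = ≡.trans (↭ₚ.↭-length (fibre-↭ e G f G-e i)) (Listₚ.length-map _ (fibre i))

    colsOf-fibre : ∀ i → colsOf λ' G i ≡ sort (map (λ s → c (π ⟨$⟩ʳ s)) (fibre i))
    colsOf-fibre i = ≡.trans (sort-resp-↭ (↭ₚ.map⁺ col (fibre-↭ e G f G-e i)))
      (cong sort (≡.sym (Listₚ.map-∘ (fibre i))))

  F-def : ∀ b → F b ≡ f (idₚ ⟨$⟩ˡ Inverse.to T b)
  F-def b = cong F (≡.sym (Inverse.inverseʳ T ≡.refl))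

  saturated : ∀ a → length (filter (λ b → f b ℕ.≟ f a) (allFin N)) ≡ d
  saturated a = ≡.trans (≡.sym (fiberSize-fibre idₚ F F-def (f a))) (proj₂ tab (f a) (proj₁ tab _))

  module _ (π : Perm N) (G : Box λ' → ℕ) (G-def : ∀ b → G b ≡ f (π ⟨$⟩ˡ Inverse.to T b)) where

    youngTab : IsYoungTab d n λ' G
    youngTab = (λ b → ≡.subst (_< n) (≡.sym (G-def b)) (proj₁ tab _))
      , λ i i<n → ≡.trans (fiberSize-fibre π G G-def i) (≡.trans (≡.sym (fiberSize-fibre idₚ F F-def i)) (proj₂ tab i i<n))

    module _ (left : StrictlyLeft π) where

      private
        cols : Perm N → ℕ → List ℕ
        cols ρ i = map (λ s → c (ρ ⟨$⟩ʳ s)) (fibre i)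

        pointwise-map : ∀ {xs} → All (λ s → c (π ⟨$⟩ʳ s) ≤ c s) xs → Pointwise _≤_ (map (λ s → c (π ⟨$⟩ʳ s)) xs) (map c xs)
        pointwise-map []       = []
        pointwise-map (p ∷ ps) = p ∷ pointwise-map ps

        cols-≤ : ∀ i → i < k → Pointwise _≤_ (cols π i) (cols idₚ i)
        cols-≤ i i<k = pointwise-map (All.map (λ {s} fs≡i → proj₁ left s (dec-true (f s ℕ.<? k) (≡.subst (_< k) (≡.sym fs≡i) i<k)))
          (Allₚ.all-filter (λ s → f s ℕ.≟ i) (allFin N)))

        sum-strict : ∀ {xs s} → s ∈ xs → c (π ⟨$⟩ʳ s) < c s → Pointwise _≤_ (map (λ s → c (π ⟨$⟩ʳ s)) xs) (map c xs) →
                     ListAction.sum (map (λ s → c (π ⟨$⟩ʳ s)) xs) < ListAction.sum (map c xs)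
        sum-strict (here ≡.refl) lt (_ ∷ p) = ℕₚ.+-mono-<-≤ lt (sum-≤ p)
          where
          sum-≤ : ∀ {as bs} → Pointwise _≤_ as bs → ListAction.sum as ≤ ListAction.sum bs
          sum-≤ []      = z≤n
          sum-≤ (p ∷ q) = ℕₚ.+-mono-≤ p (sum-≤ q)
        sum-strict (there s∈) lt (q ∷ p) = ℕₚ.+-mono-≤-< q (sum-strict s∈ lt p)

        mover : Σ (Fin N) λ s → in0 s ≡ true × c (π ⟨$⟩ʳ s) < c s
        mover with Finₚ.any? (λ s → (in0 s Boolₚ.≟ true) ×-dec (c (π ⟨$⟩ʳ s) ℕ.<? c s))
        ... | yes found = found
        -- If no entry of A₀ moved left, no term of the sum of columns could fall below its initial
        -- value.
        ... | no none = contradiction (proj₂ left) (ℕₚ.≤⇒≯ (≡.subst₂ _≤_ (≡.sym (moment-def c W0 idₚ)) (≡.sym (moment-def c W0 π))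
                (sum-mono λ s → W0-mono s λ s∈ → ℕₚ.≮⇒≥ λ lt → none (s , s∈ , lt))))

      cols-⪯ : ∀ i → i < k → colsOf λ' G i ⪯ colsOf λ' F i
      cols-⪯ i i<k = ≡.subst₂ _⪯_ (≡.sym (colsOf-fibre π G G-def i)) (≡.sym (colsOf-fibre idₚ F F-def i)) (sort-mono (cols-≤ i i<k))

      cols-≺ : Σ ℕ λ i → i < k × colsOf λ' G i ≺ colsOf λ' F i
      cols-≺ = i , i<k , cols-⪯ i i<k , ≡.subst₂ (λ xs ys → Any (uncurry _<_) (zip xs ys))
          (≡.sym (colsOf-fibre π G G-def i)) (≡.sym (colsOf-fibre idₚ F F-def i))
          (strict-somewhere (sort-mono (cols-≤ i i<k)) (≡.subst₂ _<_ (≡.sym (sum-↭ (sort-↭ _))) (≡.sym (sum-↭ (sort-↭ _)))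
            (sum-strict s∈ (proj₂ (proj₂ mover)) (cols-≤ i i<k))))
        where
        s = proj₁ mover
        i = f s
        i<k : i < k
        i<k = does⇒ (f s ℕ.<? k) (proj₁ (proj₂ mover))
        s∈ : s ∈ fibre i
        s∈ = ∈-filter⁺ (λ s → f s ℕ.≟ i) (∈-allFin s) ≡.refl

    module _ (shaped : ∀ a b → in0 (π ⟨$⟩ˡ a) ≡ true → r b ≤ r a → c b ≤ c a → in0 (π ⟨$⟩ˡ b) ≡ true) where

      private
        Filled : ℕ → ℕ → Set
        Filled i j = Σ (j < λ' ! i) λ p → in0 (π ⟨$⟩ˡ pos i j p) ≡ true

        filled? : ∀ i j → Dec (Filled i j)
        filled? i j with j ℕ.<? λ' ! i
        ... | no np = no λ (p , _) → np p
        ... | yes p with in0 (π ⟨$⟩ˡ pos i j p) in eq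
        ...   | true  = yes (p , eq)
        ...   | false = no λ (p′ , q) → true≢false
                  (≡.trans (cong (λ z → in0 (π ⟨$⟩ˡ pos i j z)) (ℕₚ.<-irrelevant p p′)) q) eq

        filled-down : ∀ {i i′ j j′} → i′ ≤ i → j′ ≤ j → Filled i j → Filled i′ j′
        filled-down {i} {i′} {j} {j′} i≤ j≤ (p , q) = p′ , shaped _ _ q
            (≡.subst₂ _≤_ (≡.sym (r-pos i′ j′ p′)) (≡.sym (r-pos i j p)) i≤)
            (≡.subst₂ _≤_ (≡.sym (c-pos i′ j′ p′)) (≡.sym (c-pos i j p)) j≤)
          where
          p′ : j′ < λ' ! i′
          p′ = ℕₚ.≤-<-trans j≤ (ℕₚ.<-≤-trans p (decreasing part i≤))

      diagram : Σ (List ℕ) λ δ → IsPartition δ × δ ⊆ᵖ λ' × PreimageIsDiagram k λ' G δ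
      diagram with down-closed⇒partition Filled filled? filled-down λ' (λ i j → proj₁)
      ... | δ , partδ , spec = δ , partδ , sub , λ b → mk⇔
            (λ lt → proj₁ (spec (row b) (col b)) (col<λrow b , dec-true (f _ ℕ.<? k) (≡.subst (_< k) (G-def b) lt)))
            (λ lt → ≡.subst (_< k) (≡.sym (G-def b)) (does⇒ (f _ ℕ.<? k)
              (≡.trans (cong (λ z → in0 (π ⟨$⟩ˡ Inverse.to T z)) (box-≡ ≡.refl ≡.refl)) (proj₂ (proj₂ (spec (row b) (col b)) lt)))))
        where
        sub : δ ⊆ᵖ λ'
        sub i = ℕₚ.≮⇒≥ λ lt → ℕₚ.<-irrefl ≡.refl (proj₁ (proj₂ (spec i (λ' ! i)) lt))

    in𝒢 : StrictlyLeft π → (∀ a b → in0 (π ⟨$⟩ˡ a) ≡ true → r b ≤ r a → c b ≤ c a → in0 (π ⟨$⟩ˡ b) ≡ true) → In𝒢 k n d λ' F G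
    in𝒢 left shaped = youngTab , cols-⪯ left , cols-≺ left , diagram shaped

-- Young symmetrizers and ideals

module OverField {u ℓ : Level} (K : Field u ℓ) (cz : CharZero K) (d : ℕ) where
  open CommutativeRing (Field.commutativeRing K) hiding (zero)
  open Algebra𝒮 K d renaming (sgn to sgn₀)
  open Sums (Field.commutativeRing K)
  open PermSums (Field.commutativeRing K)
  open import Algebra.Properties.Ring ring
    using (-1*x≈-x; -‿involutive; -‿distribˡ-*; -‿distribʳ-*; -0#≈0#; -‿+-comm)
  open import Algebra.Properties.CommutativeSemigroup *-commutativeSemigroup using (x∙yz≈y∙xz)
  open import Relation.Binary.Reasoning.Setoid setoid

  sign : Parity → Carrier
  sign 0ℙ = 1#
  sign 1ℙ = - 1#

  -- The parity test inside sgn₀ is local to its definition: the unnamed left-hand side is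
  -- inferred from the use in sgn₀-parity, which makes an induction on it possible.
  mutual
    parity-test : ∀ {N} (π : Perm N) (n : ℕ) → _ ≡ sign (ℕ.parity n)

    sgn₀-parity : ∀ {N} (π : Perm N) → sgn₀ π ≡ sign (ℕ.parity (inversions π))
    sgn₀-parity π with inversions π
    ... | n = parity-test π n

    parity-test π zero          = ≡.refl
    parity-test π (suc zero)    = ≡.refl
    parity-test π (suc (suc n)) = parity-test π n

  sign-+ : ∀ p q → sign (p ℙ.+ q) ≈ sign p * sign q
  sign-+ 0ℙ q  = sym (*-identityˡ _)
  sign-+ 1ℙ 0ℙ = sym (*-identityʳ _)
  sign-+ 1ℙ 1ℙ = sym (trans (-1*x≈-x _) (-‿involutive 1#))

  abstract
    sgn : ∀ {N} → Perm N → Carrier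
    sgn = sgn₀

    sgn-def : ∀ {N} (π : Perm N) → sgn π ≡ sgn₀ π
    sgn-def π = ≡.refl

    sgn-parity : ∀ {N} (π : Perm N) → sgn π ≡ sign (ℕ.parity (inversions π))
    sgn-parity = sgn₀-parity

    sgn-· : ∀ {N} (σ τ : Perm N) → sgn (σ · τ) ≈ sgn σ * sgn τ
    sgn-· σ τ = begin
      sgn (σ · τ)                                ≡⟨ sgn-parity (σ · τ) ⟩
      sign (ℕ.parity (inversions (σ · τ)))       ≡⟨ cong sign (parity-inversions-· σ τ) ⟩
      sign (ℕ.parity (inversions σ) ℙ.+ ℕ.parity (inversions τ)) ≈⟨ sign-+ (ℕ.parity (inversions σ)) _ ⟩
      sign (ℕ.parity (inversions σ)) * sign (ℕ.parity (inversions τ)) ≡⟨ cong₂ _*_ (sgn-parity σ) (sgn-parity τ) ⟨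
      sgn σ * sgn τ ∎

    sgn-≡ : ∀ {M N} (σ : Perm M) (τ : Perm N) → ℕ.parity (inversions σ) ≡ ℕ.parity (inversions τ) → sgn σ ≈ sgn τ
    sgn-≡ σ τ e = reflexive (≡.trans (sgn-parity σ) (≡.trans (cong sign e) (≡.sym (sgn-parity τ))))

    sgn-resp : ∀ {N} {σ τ : Perm N} → σ ≐ τ → sgn σ ≈ sgn τ
    sgn-resp {σ = σ} {τ} e = sgn-≡ σ τ (cong ℕ.parity (inversions-≐ {π = σ} {τ} e))

    sgn-id : ∀ {N} → sgn (idₚ {N}) ≈ 1#
    sgn-id {N} = reflexive (≡.trans (sgn-parity (idₚ {N})) (cong (sign ∘ ℕ.parity) (inversions-id {N})))

    sgn-transpose : ∀ {N} {x y : Fin N} → x ≢ y → sgn (transpose x y) ≈ - 1#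
    sgn-transpose {x = x} {y} p = reflexive (≡.trans (sgn-parity (transpose x y)) (cong sign (parity-transpose p)))

    sgn-square : ∀ {N} (σ : Perm N) → sgn σ * sgn σ ≈ 1#
    sgn-square σ = trans (sym (sgn-· σ σ)) (reflexive (≡.trans (sgn-parity (σ · σ))
      (cong sign (≡.trans (parity-inversions-· σ σ) (ℙₚ.p+p≡0ℙ (ℕ.parity (inversions σ)))))))

    sgn-flip : ∀ {N} (σ : Perm N) → sgn (flip σ) ≈ sgn σ
    sgn-flip {N} σ = begin
      sgn (flip σ)                    ≈⟨ *-identityʳ _ ⟨
      sgn (flip σ) * 1#               ≈⟨ *-congˡ (sgn-square σ) ⟨
      sgn (flip σ) * (sgn σ * sgn σ)  ≈⟨ *-assoc _ _ _ ⟨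
      (sgn (flip σ) * sgn σ) * sgn σ  ≈⟨ *-congʳ (trans (sym (sgn-· (flip σ) σ)) (trans (sgn-resp {σ = flip σ · σ} {idₚ} (ptw λ a → inverseˡ σ)) (sgn-id {N}))) ⟩
      1# * sgn σ                      ≈⟨ *-identityˡ _ ⟩
      sgn σ                           ∎

  natK⁻¹ : ∀ n → Σ Carrier λ y → natK K (suc n) * y ≈ 1#
  natK⁻¹ n = Field.inverse K (natK K (suc n)) (cz n)

  self-negative⇒0 : ∀ {x} → x ≈ - x → x ≈ 0#
  self-negative⇒0 {x} e with natK⁻¹ 1
  ... | y , 2y≈1 = begin
    x                                ≈⟨ *-identityʳ x ⟨
    x * 1#                           ≈⟨ *-congˡ 2y≈1 ⟨
    x * ((1# + (1# + 0#)) * y)       ≈⟨ *-assoc _ _ _ ⟨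
    (x * (1# + (1# + 0#))) * y       ≈⟨ *-congʳ (*-congˡ (+-congˡ (+-identityʳ 1#))) ⟩
    (x * (1# + 1#)) * y              ≈⟨ *-congʳ (distribˡ x 1# 1#) ⟩
    (x * 1# + x * 1#) * y            ≈⟨ *-congʳ (+-cong (*-identityʳ x) (trans (*-identityʳ x) e)) ⟩
    (x + - x) * y                    ≈⟨ *-congʳ (-‿inverseʳ x) ⟩
    0# * y                           ≈⟨ zeroˡ y ⟩
    0#                               ∎

  -- An element Σ m_π π of the group algebra is represented by the functional h ↦ Σ m_π h(π).
  record PFun (N : ℕ) : Set (u ⊔ ℓ) where
    constructor pfun
    field
      app  : Perm N → Carrier
      app-cong : Resp app
  open PFun public

  -- As a function of `h`, Φ (translate ρ h) is the product ρ·Φ in the group algebra.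
  translate : ∀ {N} → Perm N → PFun N → PFun N
  translate ρ h = pfun (λ π → app h (ρ · π)) (λ e → app-cong h (·-congˡ ρ e))

  module _ {N : ℕ} (r c : Fin N → ℕ) where

    -- The element c_λ(T)·π, where r and c are the row and the column of an entry in T.
    Y : Perm N → PFun N → Carrier
    Y π h = ∑G r λ σ → ∑G c λ τ → sgn τ * app h (σ · (τ · π))

    -- The element a·π for the row symmetrizer a.
    rowsum : Perm N → PFun N → Carrier
    rowsum π h = ∑G r λ σ → app h (σ · π)

    Y-resp : ∀ h → Resp (λ π → Y π h)
    Y-resp h e = ∑G-cong r λ σ _ → ∑G-cong c λ τ _ → *-congˡ (app-cong h (·-congˡ σ (·-congˡ τ e)))

    rowsum-resp : ∀ h → Resp (λ π → rowsum π h)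
    rowsum-resp h e = ∑G-cong r λ σ _ → app-cong h (·-congˡ σ e)

    rowsum-invariant : ∀ {s} → Pres r s → ∀ π h → rowsum (s · π) h ≈ rowsum π h
    rowsum-invariant {s} p π h = sym (trans
      (∑G-right r p {λ σ → app h (σ · π)} (λ e → app-cong h (·-congʳ π e)))
      (∑G-cong r λ σ _ → app-cong h {(σ · s) · π} {σ · (s · π)} (ptw λ _ → ≡.refl)))

    Y-rowsum : ∀ π h → Y π h ≈ ∑G c λ τ → sgn τ * rowsum (τ · π) h
    Y-rowsum π h = trans (∑G-swap r c _) (∑G-cong c λ τ _ → sym (∑G-*ˡ r (sgn τ) _))

    Y-col : ∀ {κ} → Pres c κ → ∀ π h → Y (κ · π) h ≈ sgn κ * Y π h
    Y-col {κ} p π h = begin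
      Y (κ · π) h                                              ≈⟨ Y-rowsum (κ · π) h ⟩
      (∑G c λ τ → sgn τ * rowsum (τ · (κ · π)) h)              ≈⟨ ∑G-cong c (λ τ _ → *-cong (sgn-cancel τ) (rowsum-resp h {τ · (κ · π)} {(τ · κ) · π} (ptw λ _ → ≡.refl))) ⟩
      (∑G c λ τ → (sgn κ * sgn (τ · κ)) * rowsum ((τ · κ) · π) h) ≈⟨ ∑G-cong c (λ τ _ → *-assoc _ _ _) ⟩
      (∑G c λ τ → sgn κ * (sgn (τ · κ) * rowsum ((τ · κ) · π) h)) ≈⟨ ∑G-*ˡ c (sgn κ) _ ⟨
      sgn κ * (∑G c λ τ → sgn (τ · κ) * rowsum ((τ · κ) · π) h) ≈⟨ *-congˡ (∑G-right c p {λ τ → sgn τ * rowsum (τ · π) h} (λ e → *-cong (sgn-resp e) (rowsum-resp h (·-congʳ π e)))) ⟨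
      sgn κ * (∑G c λ τ → sgn τ * rowsum (τ · π) h)            ≈⟨ *-congˡ (Y-rowsum π h) ⟨
      sgn κ * Y π h                                            ∎
      where
      sgn-cancel : ∀ τ → sgn τ ≈ sgn κ * sgn (τ · κ)
      sgn-cancel τ = begin
        sgn τ                     ≈⟨ *-identityʳ _ ⟨
        sgn τ * 1#                ≈⟨ *-congˡ (sgn-square κ) ⟨
        sgn τ * (sgn κ * sgn κ)   ≈⟨ *-assoc _ _ _ ⟨
        (sgn τ * sgn κ) * sgn κ   ≈⟨ *-comm _ _ ⟩
        sgn κ * (sgn τ * sgn κ)   ≈⟨ *-congˡ (sgn-· τ κ) ⟨
        sgn κ * sgn (τ · κ)       ∎

    -- Left multiplication by (x y) keeps A and reverses the sign, so the sum is its own negative,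
    -- and 2 is invertible.
    alternating-sum≈0 : ∀ (l : Fin N → ℕ) {x y} → x ≢ y → l x ≡ l y → ∀ {A : Perm N → Carrier} → Resp A →
      (∀ π → Pres l π → A (transpose x y · π) ≈ A π) → ∑G l (λ π → sgn π * A π) ≈ 0#
    alternating-sum≈0 l {x} {y} x≢y lx≡ly {A} rA inv = self-negative⇒0 (begin
      ∑G l (λ π → sgn π * A π)
        ≈⟨ ∑G-left l (transpose-pres l lx≡ly) {λ π → sgn π * A π} (λ e → *-cong (sgn-resp e) (rA e)) ⟩
      ∑G l (λ π → sgn (transpose x y · π) * A (transpose x y · π))
        ≈⟨ ∑G-cong l (λ π p → trans (*-cong (trans (sgn-· (transpose x y) π) (*-congʳ (sgn-transpose x≢y))) (inv π p)) (*-assoc _ _ _)) ⟩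
      ∑G l (λ π → - 1# * (sgn π * A π))  ≈⟨ ∑G-*ˡ l (- 1#) _ ⟨
      - 1# * ∑G l (λ π → sgn π * A π)    ≈⟨ -1*x≈-x _ ⟩
      - ∑G l (λ π → sgn π * A π)         ∎)

    -- Already the part belonging to one column permutation τ vanishes: moving (a b) across τ gives
    -- the transposition of τ(a) and τ(b), which share a row and are absorbed by the row
    -- symmetrizer, so the sum over ρ alternates.
    garnir : ∀ (z : Fin N → ℕ) →
      (∀ τ → Pres c τ → Σ (Fin N) λ a → Σ (Fin N) λ b → a ≢ b × z a ≡ z b × r (τ ⟨$⟩ʳ a) ≡ r (τ ⟨$⟩ʳ b)) →
      ∀ π h → ∑G z (λ ρ → sgn ρ * Y (ρ · π) h) ≈ 0#
    garnir z clash π h = begin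
      ∑G z (λ ρ → sgn ρ * Y (ρ · π) h)
        ≈⟨ ∑G-cong z (λ ρ _ → trans (*-congˡ (Y-rowsum (ρ · π) h)) (∑G-*ˡ c _ _)) ⟩
      ∑G z (λ ρ → ∑G c λ τ → sgn ρ * (sgn τ * rowsum (τ · (ρ · π)) h))
        ≈⟨ ∑G-swap z c _ ⟩
      ∑G c (λ τ → ∑G z λ ρ → sgn ρ * (sgn τ * rowsum (τ · (ρ · π)) h))
        ≈⟨ ∑G-cong c (λ τ q → step τ q (clash τ q)) ⟩
      ∑G c (λ τ → 0#)
        ≈⟨ ∑G-zero c (λ _ _ → refl) ⟩
      0# ∎
      where
      step : ∀ τ → Pres c τ → (Σ (Fin N) λ a → Σ (Fin N) λ b → a ≢ b × z a ≡ z b × r (τ ⟨$⟩ʳ a) ≡ r (τ ⟨$⟩ʳ b)) →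
             ∑G z (λ ρ → sgn ρ * (sgn τ * rowsum (τ · (ρ · π)) h)) ≈ 0#
      step τ q (a , b , a≢b , za≡zb , e) = alternating-sum≈0 z a≢b za≡zb
        {λ ρ → sgn τ * rowsum (τ · (ρ · π)) h}
        (λ e → *-congˡ (rowsum-resp h (·-congˡ τ (·-congʳ π e))))
        λ ρ _ → *-congˡ (trans
          (rowsum-resp h {τ · ((transpose a b · ρ) · π)} {transpose (τ ⟨$⟩ʳ a) (τ ⟨$⟩ʳ b) · (τ · (ρ · π))}
            (ptw λ x → at (transpose-conj τ a b) (ρ ⟨$⟩ʳ (π ⟨$⟩ʳ x))))
          (rowsum-invariant (transpose-pres r e) (τ · (ρ · π)) h))

    -- Moving (x p) across a column permutation τ gives the transposition of τ(x) and p′ = τ(p).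
    -- When τ(x) is the partner w of p′, the row symmetrizer absorbs it, and these terms make up the
    -- left side. The others cancel: writing x for τ(x) ≠ w, multiplication of τ by (w x) flips the
    -- sign, and (x p′)(w x) = (w p′)(x p′) with w and p′ in one row.
    exchange : ∀ (j : ℕ) (p : Fin N) → c p ≢ j →
      (∀ p′ → c p′ ≡ c p → Σ (Fin N) λ w → c w ≡ j × r w ≡ r p′) →
      ∀ π h → Y π h ≈ ∑ (allFin N) λ x → (c x ≡ᵇ j) ▸ Y (transpose x p · π) h
    exchange j p cp≢j partner π h = sym (begin
      ∑ (allFin N) (λ x → (c x ≡ᵇ j) ▸ Y (transpose x p · π) h)
        ≈⟨ ∑-cong (allFin N) (λ x → ▸-cong (c x ≡ᵇ j) λ _ → trans (Y-rowsum (transpose x p · π) h)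
             (∑G-cong c λ τ _ → *-congˡ (rowsum-resp h {τ · (transpose x p · π)} {transpose (τ ⟨$⟩ʳ x) (τ ⟨$⟩ʳ p) · (τ · π)} (ptw λ a → at (transpose-conj τ x p) (π ⟨$⟩ʳ a))))) ⟩
      ∑ (allFin N) (λ x → (c x ≡ᵇ j) ▸ ∑G c λ τ → sgn τ * H (τ ⟨$⟩ʳ x) (τ ⟨$⟩ʳ p) τ)
        ≈⟨ ∑-cong (allFin N) (λ x → trans (∑G-▸ c (c x ≡ᵇ j) _) (∑G-cong c λ τ _ → sym (▸-*ˡ (c x ≡ᵇ j) _ _))) ⟩
      ∑ (allFin N) (λ x → ∑G c λ τ → sgn τ * ((c x ≡ᵇ j) ▸ H (τ ⟨$⟩ʳ x) (τ ⟨$⟩ʳ p) τ))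
        ≈⟨ ∑G-∑ c (allFin N) _ ⟨
      ∑G c (λ τ → ∑ (allFin N) λ x → sgn τ * ((c x ≡ᵇ j) ▸ H (τ ⟨$⟩ʳ x) (τ ⟨$⟩ʳ p) τ))
        ≈⟨ ∑G-cong c (λ τ q → step τ q) ⟩
      ∑G c (λ τ → sgn τ * rowsum (τ · π) h + ∑ (allFin N) (λ x → sgn τ * ((c x ≡ᵇ j) ▸ E x (τ ⟨$⟩ʳ p) τ)))
        ≈⟨ ∑G-+ c _ _ ⟩
      ∑G c (λ τ → sgn τ * rowsum (τ · π) h) + ∑G c (λ τ → ∑ (allFin N) (λ x → sgn τ * ((c x ≡ᵇ j) ▸ E x (τ ⟨$⟩ʳ p) τ)))
        ≈⟨ +-cong (sym (Y-rowsum π h)) (trans (∑G-∑ c (allFin N) _) (∑-zero (allFin N) vanish)) ⟩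
      Y π h + 0#
        ≈⟨ +-identityʳ _ ⟩
      Y π h ∎)
      where
      H : Fin N → Fin N → Perm N → Carrier
      H x p′ τ = rowsum (transpose x p′ · (τ · π)) h

      W : Fin N → Fin N
      W p′ with c p′ ℕ.≟ c p
      ... | yes e = proj₁ (partner p′ e)
      -- A default outside the column of p, chosen so that `W-row` holds everywhere.
      ... | no _  = p′

      W-col : ∀ p′ → c p′ ≡ c p → c (W p′) ≡ j
      W-col p′ e with c p′ ℕ.≟ c p
      ... | yes e′ = proj₁ (proj₂ (partner p′ e′))
      ... | no ne  = contradiction e ne

      W-row : ∀ p′ → r (W p′) ≡ r p′
      W-row p′ with c p′ ℕ.≟ c p
      ... | yes e = proj₂ (proj₂ (partner p′ e))
      ... | no _  = ≡.refl

      E : Fin N → Fin N → Perm N → Carrier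
      E x p′ τ = not (does (x Finₚ.≟ W p′)) ▸ H x p′ τ

      step : ∀ τ → Pres c τ → ∑ (allFin N) (λ x → sgn τ * ((c x ≡ᵇ j) ▸ H (τ ⟨$⟩ʳ x) (τ ⟨$⟩ʳ p) τ))
             ≈ sgn τ * rowsum (τ · π) h + ∑ (allFin N) (λ x → sgn τ * ((c x ≡ᵇ j) ▸ E x (τ ⟨$⟩ʳ p) τ))
      step τ q = begin
        ∑ (allFin N) (λ x → sgn τ * ((c x ≡ᵇ j) ▸ H (τ ⟨$⟩ʳ x) q′ τ))
          ≈⟨ ∑-cong (allFin N) (λ x → *-congˡ (reflexive (cong (λ k → (k ≡ᵇ j) ▸ H (τ ⟨$⟩ʳ x) q′ τ) (≡.sym (keep q x))))) ⟩
        ∑ (allFin N) (λ x → sgn τ * ((c (τ ⟨$⟩ʳ x) ≡ᵇ j) ▸ H (τ ⟨$⟩ʳ x) q′ τ))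
          ≈⟨ ∑F-reindex τ _ ⟨
        ∑ (allFin N) (λ x → sgn τ * ((c x ≡ᵇ j) ▸ H x q′ τ))
          ≈⟨ ∑-*ˡ (allFin N) (sgn τ) _ ⟨
        sgn τ * ∑ (allFin N) (λ x → (c x ≡ᵇ j) ▸ H x q′ τ)
          ≈⟨ *-congˡ (∑-cong (allFin N) λ x → trans (▸-split (does (x Finₚ.≟ W q′)) _)
               (+-congˡ (▸-comm (not (does (x Finₚ.≟ W q′))) (c x ≡ᵇ j) _))) ⟩
        sgn τ * ∑ (allFin N) (λ x → does (x Finₚ.≟ W q′) ▸ (c x ≡ᵇ j) ▸ H x q′ τ + (c x ≡ᵇ j) ▸ E x q′ τ)
          ≈⟨ *-congˡ (∑-+ (allFin N) _ _) ⟩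
        sgn τ * (∑ (allFin N) (λ x → does (x Finₚ.≟ W q′) ▸ (c x ≡ᵇ j) ▸ H x q′ τ) + ∑ (allFin N) (λ x → (c x ≡ᵇ j) ▸ E x q′ τ))
          ≈⟨ distribˡ _ _ _ ⟩
        sgn τ * ∑ (allFin N) (λ x → does (x Finₚ.≟ W q′) ▸ (c x ≡ᵇ j) ▸ H x q′ τ) + sgn τ * ∑ (allFin N) (λ x → (c x ≡ᵇ j) ▸ E x q′ τ)
          ≈⟨ +-cong (*-congˡ (trans (∑-δ (W q′) _) diag)) (∑-*ˡ (allFin N) (sgn τ) _) ⟩
        sgn τ * rowsum (τ · π) h + ∑ (allFin N) (λ x → sgn τ * ((c x ≡ᵇ j) ▸ E x q′ τ)) ∎
        where
        q′ = τ ⟨$⟩ʳ p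
        diag : (c (W q′) ≡ᵇ j) ▸ H (W q′) q′ τ ≈ rowsum (τ · π) h
        diag = trans (reflexive (cong (_▸ H (W q′) q′ τ) (≡⇒≡ᵇ′ (W-col q′ (keep q p)))))
                     (rowsum-invariant (transpose-pres r (W-row q′)) (τ · π) h)

      vanish : ∀ x → ∑G c (λ τ → sgn τ * ((c x ≡ᵇ j) ▸ E x (τ ⟨$⟩ʳ p) τ)) ≈ 0#
      vanish x with c x ≡ᵇ j in eq
      ... | false = ∑G-zero c λ τ _ → zeroʳ _
      ... | true  = begin
        ∑G c (λ τ → sgn τ * E x (τ ⟨$⟩ʳ p) τ)
          -- The partner w depends on τ only through p′ = τ(p), so the τ are grouped by p′ before
          -- they are paired.
          ≈⟨ ∑G-cong c (λ τ _ → sym (∑-δ (τ ⟨$⟩ʳ p) (λ p′ → sgn τ * E x p′ τ))) ⟩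
        ∑G c (λ τ → ∑ (allFin N) λ p′ → does (p′ Finₚ.≟ τ ⟨$⟩ʳ p) ▸ (sgn τ * E x p′ τ))
          ≈⟨ ∑G-∑ c (allFin N) _ ⟩
        ∑ (allFin N) (λ p′ → ∑G c λ τ → does (p′ Finₚ.≟ τ ⟨$⟩ʳ p) ▸ (sgn τ * E x p′ τ))
          ≈⟨ ∑-zero (allFin N) fixed ⟩
        0# ∎
        where
        cx≡j : c x ≡ j
        cx≡j = ≡ᵇ⇒≡′ eq
        fixed : ∀ p′ → ∑G c (λ τ → does (p′ Finₚ.≟ τ ⟨$⟩ʳ p) ▸ (sgn τ * E x p′ τ)) ≈ 0#
        fixed p′ = cases (c p′ ℕ.≟ c p) (x Finₚ.≟ W p′)
          where
          Goal : Set ℓ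
          Goal = ∑G c (λ τ → does (p′ Finₚ.≟ τ ⟨$⟩ʳ p) ▸ (sgn τ * E x p′ τ)) ≈ 0#
          unequal : x ≢ W p′ → ∑G c (λ τ → does (p′ Finₚ.≟ τ ⟨$⟩ʳ p) ▸ (sgn τ * H x p′ τ)) ≈ 0# → Goal
          unequal ne = trans (∑G-cong c λ τ _ → reflexive (cong (λ b → does (p′ Finₚ.≟ τ ⟨$⟩ʳ p) ▸ (sgn τ * (not b ▸ H x p′ τ)))
            (dec-false (x Finₚ.≟ W p′) ne)))
          equal : x ≡ W p′ → ∑G c (λ τ → does (p′ Finₚ.≟ τ ⟨$⟩ʳ p) ▸ (sgn τ * 0#)) ≈ 0# → Goal
          equal e = trans (∑G-cong c λ τ _ → reflexive (cong (λ b → does (p′ Finₚ.≟ τ ⟨$⟩ʳ p) ▸ (sgn τ * (not b ▸ H x p′ τ)))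
            (dec-true (x Finₚ.≟ W p′) e)))
          cases : Dec (c p′ ≡ c p) → Dec (x ≡ W p′) → Goal
          cases (no ne) _ = ∑G-zero c λ τ q → reflexive (cong (_▸ (sgn τ * E x p′ τ))
              (dec-false (p′ Finₚ.≟ τ ⟨$⟩ʳ p) λ e → ne (≡.trans (cong c e) (keep q p))))
          cases (yes e) (yes x≡w) = equal x≡w (∑G-zero c λ τ q → trans (▸-cong (does (p′ Finₚ.≟ τ ⟨$⟩ʳ p)) (λ _ → zeroʳ _))
              (trans (▸-cong (does (p′ Finₚ.≟ τ ⟨$⟩ʳ p)) (λ _ → sym (zeroʳ 0#))) (trans (sym (▸-*ˡ (does (p′ Finₚ.≟ τ ⟨$⟩ʳ p)) 0# 0#)) (zeroˡ _))))
          cases (yes e) (no x≢w) = unequal x≢w (trans (∑G-cong c λ τ _ → sym (▸-*ˡ (does (p′ Finₚ.≟ τ ⟨$⟩ʳ p)) _ _))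
              (alternating-sum≈0 c (x≢w ∘ ≡.sym) (≡.trans cw≡j (≡.sym cx≡j)) {λ τ → does (p′ Finₚ.≟ τ ⟨$⟩ʳ p) ▸ H x p′ τ}
                (λ {τ} {τ′} e′ → trans (▸-cong (does (p′ Finₚ.≟ τ ⟨$⟩ʳ p)) λ _ → rowsum-resp h (·-congˡ (transpose x p′) (·-congʳ π e′)))
                   (reflexive (cong (λ z → does (p′ Finₚ.≟ z) ▸ H x p′ τ′) (at e′ p))))
                λ τ q → trans (▸-cong (does (p′ Finₚ.≟ transpose w x ⟨$⟩ʳ (τ ⟨$⟩ʳ p))) λ _ → H-inv τ)
                   (reflexive (cong (_▸ H x p′ τ) (Bool-ext
                     (λ t → dec-true (p′ Finₚ.≟ τ ⟨$⟩ʳ p) (perm-injective (transpose w x)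
                               (≡.trans wx-fix (does⇒ (p′ Finₚ.≟ transpose w x ⟨$⟩ʳ (τ ⟨$⟩ʳ p)) t))))
                     (λ t → dec-true (p′ Finₚ.≟ transpose w x ⟨$⟩ʳ (τ ⟨$⟩ʳ p)) (≡.trans (≡.sym wx-fix)
                               (cong (transpose w x ⟨$⟩ʳ_) (does⇒ (p′ Finₚ.≟ τ ⟨$⟩ʳ p) t)))))))))
            where
            w = W p′
            cw≡j : c w ≡ j
            cw≡j = W-col p′ e
            p′≢ : ∀ {y} → c y ≡ j → p′ ≢ y
            p′≢ cy ≡.refl = cp≢j (≡.trans (≡.sym e) cy)
            wx-fix : transpose w x ⟨$⟩ʳ p′ ≡ p′
            wx-fix = transpose-other (p′≢ cw≡j) (p′≢ cx≡j)
            H-inv : ∀ τ → H x p′ (transpose w x · τ) ≈ H x p′ τ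
            H-inv τ = trans
              (rowsum-resp h {transpose x p′ · ((transpose w x · τ) · π)} {transpose w p′ · (transpose x p′ · (τ · π))}
                (ptw λ a → ≡.trans (at (transpose-conj (transpose x p′) w x) (τ ⟨$⟩ʳ (π ⟨$⟩ʳ a)))
                  (cong₂ (λ u v → transpose u v ⟨$⟩ʳ (transpose x p′ ⟨$⟩ʳ (τ ⟨$⟩ʳ (π ⟨$⟩ʳ a))))
                    (transpose-other (x≢w ∘ ≡.sym) (p′≢ cw≡j ∘ ≡.sym)) (transpose-fst x p′))))
              (rowsum-invariant (transpose-pres r (W-row p′)) (transpose x p′ · (τ · π)) h)

  -- The product of two symmetrizers in two readings. As a combination of left translates of the
  -- second factor it visibly lies in the ideal; as a combination of right multiples of the first it
  -- is open to the exchange relation.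
  young-product : ∀ {N} (r c r′ c′ : Fin N → ℕ) (h : PFun N) →
    (∑G r λ σ → ∑G c λ τ → sgn τ * ∑G r′ λ σ′ → ∑G c′ λ τ′ → sgn τ′ * app h ((σ · τ) · (σ′ · τ′)))
    ≈ (∑G r′ λ σ′ → ∑G c′ λ τ′ → sgn τ′ * Y r c (σ′ · τ′) h)
  young-product r c r′ c′ h = begin
    (∑G r λ σ → ∑G c λ τ → sgn τ * ∑G r′ λ σ′ → ∑G c′ λ τ′ → sgn τ′ * app h ((σ · τ) · (σ′ · τ′)))
      ≈⟨ ∑G-cong r (λ σ _ → trans (∑G-cong c λ τ _ → ∑G-*ˡ r′ _ _) (∑G-swap c r′ _)) ⟩
    (∑G r λ σ → ∑G r′ λ σ′ → ∑G c λ τ → sgn τ * ∑G c′ λ τ′ → sgn τ′ * app h ((σ · τ) · (σ′ · τ′)))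
      ≈⟨ ∑G-swap r r′ _ ⟩
    (∑G r′ λ σ′ → ∑G r λ σ → ∑G c λ τ → sgn τ * ∑G c′ λ τ′ → sgn τ′ * app h ((σ · τ) · (σ′ · τ′)))
      ≈⟨ ∑G-cong r′ (λ σ′ _ → trans (∑G-cong r λ σ _ → inner σ σ′) (trans (∑G-swap r c′ _) (∑G-cong c′ λ τ′ _ → sym (∑G-*ˡ r _ _)))) ⟩
    (∑G r′ λ σ′ → ∑G c′ λ τ′ → sgn τ′ * Y r c (σ′ · τ′) h) ∎
    where
    inner : ∀ σ σ′ → (∑G c λ τ → sgn τ * ∑G c′ λ τ′ → sgn τ′ * app h ((σ · τ) · (σ′ · τ′)))
                   ≈ (∑G c′ λ τ′ → sgn τ′ * ∑G c λ τ → sgn τ * app h (σ · (τ · (σ′ · τ′))))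
    inner σ σ′ = begin
      (∑G c λ τ → sgn τ * ∑G c′ λ τ′ → sgn τ′ * app h ((σ · τ) · (σ′ · τ′)))
        ≈⟨ ∑G-cong c (λ τ _ → ∑G-*ˡ c′ _ _) ⟩
      (∑G c λ τ → ∑G c′ λ τ′ → sgn τ * (sgn τ′ * app h ((σ · τ) · (σ′ · τ′))))
        ≈⟨ ∑G-swap c c′ _ ⟩
      (∑G c′ λ τ′ → ∑G c λ τ → sgn τ * (sgn τ′ * app h ((σ · τ) · (σ′ · τ′))))
        ≈⟨ ∑G-cong c′ (λ τ′ _ → ∑G-cong c λ τ _ → trans (x∙yz≈y∙xz _ _ _)
             (*-congˡ (*-congˡ (app-cong h {(σ · τ) · (σ′ · τ′)} {σ · (τ · (σ′ · τ′))} (ptw λ _ → ≡.refl))))) ⟩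
      (∑G c′ λ τ′ → ∑G c λ τ → sgn τ′ * (sgn τ * app h (σ · (τ · (σ′ · τ′)))))
        ≈⟨ ∑G-cong c′ (λ τ′ _ → sym (∑G-*ˡ c _ _)) ⟩
      (∑G c′ λ τ′ → sgn τ′ * ∑G c λ τ → sgn τ * app h (σ · (τ · (σ′ · τ′)))) ∎

  -- Integers in K and the nonvanishing of the square of a symmetrizer

  natK-+ : ∀ m n → natK K (m ℕ.+ n) ≈ natK K m + natK K n
  natK-+ zero    n = sym (+-identityˡ _)
  natK-+ (suc m) n = trans (+-congˡ (natK-+ m n)) (sym (+-assoc _ _ _))

  natK-* : ∀ m n → natK K (m ℕ.* n) ≈ natK K m * natK K n
  natK-* zero    n = sym (zeroˡ _)
  natK-* (suc m) n = begin
    natK K (n ℕ.+ m ℕ.* n)              ≈⟨ natK-+ n _ ⟩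
    natK K n + natK K (m ℕ.* n)         ≈⟨ +-cong (sym (*-identityˡ _)) (natK-* m n) ⟩
    1# * natK K n + natK K m * natK K n ≈⟨ distribʳ _ _ _ ⟨
    (1# + natK K m) * natK K n          ∎

  -- K has no order. Positivity is replaced by being the image of a positive integer, which
  -- characteristic zero keeps away from 0.
  IsNat IsPos IsInt : Carrier → Set ℓ
  IsNat x = Σ ℕ λ n → x ≈ natK K n
  IsPos x = Σ ℕ λ n → x ≈ natK K (suc n)
  IsInt x = Σ ℕ λ n → (x ≈ natK K n) ⊎ (x ≈ - natK K n)

  IsNat-+ : ∀ {x y} → IsNat x → IsNat y → IsNat (x + y)
  IsNat-+ (m , p) (n , q) = m ℕ.+ n , trans (+-cong p q) (sym (natK-+ m n))

  IsPos-+ : ∀ {x y} → IsPos x → IsNat y → IsPos (x + y)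
  IsPos-+ (m , p) (n , q) = m ℕ.+ n , trans (+-cong p q) (sym (natK-+ (suc m) n))

  IsNat-∑ : ∀ {a} {A : Set a} (xs : List A) {f} → (∀ x → IsNat (f x)) → IsNat (∑ xs f)
  IsNat-∑ []       p = 0 , ∑-nil _
  IsNat-∑ (x ∷ xs) p with IsNat-+ (p x) (IsNat-∑ xs p)
  ... | n , e = n , trans (∑-∷ x xs _) e

  IsNat-▸ : ∀ b {x} → (b ≡ true → IsNat x) → IsNat (b ▸ x)
  IsNat-▸ true  p = p ≡.refl
  IsNat-▸ false p = 0 , refl

  IsNat-one : ∀ b → IsNat (b ▸ 1#)
  IsNat-one b = IsNat-▸ b λ _ → 1 , sym (+-identityʳ _)

  private
    natK-sub : ∀ m n → IsInt (natK K m + - natK K n)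
    natK-sub zero    n       = n , inj₂ (+-identityˡ _)
    natK-sub (suc m) zero    = suc m , inj₁ (trans (+-congˡ -0#≈0#) (+-identityʳ _))
    natK-sub (suc m) (suc n) with natK-sub m n
    ... | k , e = k , shift {k} e
      where
      same : natK K (suc m) + - natK K (suc n) ≈ natK K m + - natK K n
      same = begin
        (1# + natK K m) + - (1# + natK K n)    ≈⟨ +-cong (+-comm _ _) (sym (-‿+-comm _ _)) ⟩
        (natK K m + 1#) + (- 1# + - natK K n)  ≈⟨ +-assoc _ _ _ ⟩
        natK K m + (1# + (- 1# + - natK K n))  ≈⟨ +-congˡ (sym (+-assoc _ _ _)) ⟩
        natK K m + ((1# + - 1#) + - natK K n)  ≈⟨ +-congˡ (trans (+-congʳ (-‿inverseʳ 1#)) (+-identityˡ _)) ⟩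
        natK K m + - natK K n                  ∎
      shift : ∀ {k} → (natK K m + - natK K n ≈ natK K k) ⊎ (natK K m + - natK K n ≈ - natK K k) →
              (natK K (suc m) + - natK K (suc n) ≈ natK K k) ⊎ (natK K (suc m) + - natK K (suc n) ≈ - natK K k)
      shift (inj₁ e) = inj₁ (trans same e)
      shift (inj₂ e) = inj₂ (trans same e)

    IsInt-resp : ∀ {x y} → x ≈ y → IsInt y → IsInt x
    IsInt-resp e (n , inj₁ p) = n , inj₁ (trans e p)
    IsInt-resp e (n , inj₂ p) = n , inj₂ (trans e p)

  IsInt-+ : ∀ {x y} → IsInt x → IsInt y → IsInt (x + y)
  IsInt-+ (m , inj₁ p) (n , inj₁ q) = m ℕ.+ n , inj₁ (trans (+-cong p q) (sym (natK-+ m n)))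
  IsInt-+ (m , inj₁ p) (n , inj₂ q) = IsInt-resp (+-cong p q) (natK-sub m n)
  IsInt-+ (m , inj₂ p) (n , inj₁ q) = IsInt-resp (trans (+-cong p q) (+-comm _ _)) (natK-sub n m)
  IsInt-+ (m , inj₂ p) (n , inj₂ q) = m ℕ.+ n , inj₂ (trans (+-cong p q) (trans (-‿+-comm _ _) (-‿cong (sym (natK-+ m n)))))

  IsInt-neg : ∀ {x} → IsInt x → IsInt (- x)
  IsInt-neg (n , inj₁ p) = n , inj₂ (-‿cong p)
  IsInt-neg (n , inj₂ p) = n , inj₁ (trans (-‿cong p) (-‿involutive _))

  IsInt-▸ : ∀ b {x} → IsInt x → IsInt (b ▸ x)
  IsInt-▸ true  p = p
  IsInt-▸ false p = 0 , inj₁ refl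

  IsInt-∑ : ∀ {a} {A : Set a} (xs : List A) {f} → (∀ x → IsInt (f x)) → IsInt (∑ xs f)
  IsInt-∑ []       p = 0 , inj₁ (∑-nil _)
  IsInt-∑ (x ∷ xs) p = IsInt-resp (∑-∷ x xs _) (IsInt-+ (p x) (IsInt-∑ xs p))

  IsInt-∑G : ∀ {N} (l : Fin N → ℕ) {f} → (∀ x → IsInt (f x)) → IsInt (∑G l f)
  IsInt-∑G l {f} p = IsInt-resp (∑G-def l f) (IsInt-∑ (allPerms _) λ π → IsInt-▸ (inG l π) (p π))

  IsInt-sgn : ∀ {N} (π : Perm N) {x} → IsInt x → IsInt (sgn π * x)
  IsInt-sgn π {x} p with ℕ.parity (inversions π) | sgn-parity π
  ... | 0ℙ | e = IsInt-resp (trans (*-congʳ (reflexive e)) (*-identityˡ x)) p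
  ... | 1ℙ | e = IsInt-resp (trans (*-congʳ (reflexive e)) (-1*x≈-x x)) (IsInt-neg p)

  square-IsNat : ∀ {x} → IsInt x → IsNat (x * x)
  square-IsNat (n , inj₁ p) = n ℕ.* n , trans (*-cong p p) (sym (natK-* n n))
  square-IsNat {x} (n , inj₂ p) = n ℕ.* n , (begin
    x * x                       ≈⟨ *-cong p p ⟩
    - natK K n * - natK K n     ≈⟨ -‿distribˡ-* _ _ ⟨
    - (natK K n * - natK K n)   ≈⟨ -‿cong (sym (-‿distribʳ-* _ _)) ⟩
    - (- (natK K n * natK K n)) ≈⟨ -‿involutive _ ⟩
    natK K n * natK K n         ≈⟨ natK-* n n ⟨
    natK K (n ℕ.* n)            ∎)

  IsPos-∑P : ∀ {N} {f : Perm N → Carrier} → Resp f → (∀ π → IsNat (f π)) → IsPos (f idₚ) → IsPos (∑P f)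
  IsPos-∑P {N} {f} rs nat pos with IsPos-+ pos (IsNat-∑ (allPerms N) λ π → IsNat-▸ (not (eqᵇ π idₚ)) λ _ → nat π)
  ... | n , e = n , (begin
    ∑P f
      ≈⟨ ∑-cong (allPerms N) (λ π → ▸-split (eqᵇ π idₚ) (f π)) ⟩
    ∑P (λ π → eqᵇ π idₚ ▸ f π + not (eqᵇ π idₚ) ▸ f π)
      ≈⟨ ∑-+ (allPerms N) _ _ ⟩
    ∑P (λ π → eqᵇ π idₚ ▸ f π) + ∑P (λ π → not (eqᵇ π idₚ) ▸ f π)
      ≈⟨ +-congʳ (trans (∑-cong (allPerms N) λ π → ▸-cong (eqᵇ π idₚ) λ t → rs (eqᵇ⇒≐ t)) (∑P-δ idₚ (f idₚ))) ⟩
    f idₚ + ∑P (λ π → not (eqᵇ π idₚ) ▸ f π)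
      ≈⟨ e ⟩
    natK K (suc n) ∎)

  IsPos-∑G : ∀ {N} (l : Fin N → ℕ) {f : Perm N → Carrier} → Resp f → (∀ π → Pres l π → IsNat (f π)) →
             IsPos (f idₚ) → IsPos (∑G l f)
  IsPos-∑G {N} l {f} rs nat (k , pos) with IsPos-∑P (▸-resp l rs) (λ π → IsNat-▸ (inG l π) λ t → nat π (inG⇒Pres l π t))
    (k , trans (reflexive (cong (_▸ f idₚ) (Pres⇒inG l idₚ (pres λ _ → ≡.refl)))) pos)
  ... | n , e = n , trans (∑G-def l f) e

  module _ {N : ℕ} (r c : Fin N → ℕ) (trivial : ∀ π → Pres r π → Pres c π → π ≐ idₚ) where

    δ : Perm N → Perm N → Carrier
    δ π ρ = eqᵇ π ρ ▸ 1#

    δ-≡ : ∀ {π ρ π′ ρ′ : Perm N} → (π ≐ ρ → π′ ≐ ρ′) → (π′ ≐ ρ′ → π ≐ ρ) → δ π ρ ≈ δ π′ ρ′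
    δ-≡ p q = reflexive (cong (_▸ 1#) (Bool-ext (≐⇒eqᵇ ∘ p ∘ eqᵇ⇒≐) (≐⇒eqᵇ ∘ q ∘ eqᵇ⇒≐)))

    δ-respˡ : ∀ ρ → Resp (λ π → δ π ρ)
    δ-respˡ ρ e = δ-≡ (≐-trans (≐-sym e)) (≐-trans e)

    δ-respʳ : ∀ π → Resp (λ ρ → δ π ρ)
    δ-respʳ π e = δ-≡ (λ p → ≐-trans p e) (λ p → ≐-trans p (≐-sym e))

    -- With a and b the row symmetrizer and the column antisymmetrizer, the coefficient of ρ in a b a.
    m : Perm N → Carrier
    m ρ = ∑G r λ σ → ∑G c λ τ → sgn τ * ∑G r λ σ′ → δ (σ · (τ · σ′)) ρ

    m-resp : Resp m
    m-resp e = ∑G-cong r λ σ _ → ∑G-cong c λ τ _ → *-congˡ (∑G-cong r λ σ′ _ → δ-respʳ (σ · (τ · σ′)) e)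

    h₀ : PFun N
    h₀ = pfun (λ π → ∑G r λ σ → δ (π · σ) idₚ) (λ e → ∑G-cong r λ σ _ → δ-respˡ idₚ (·-congʳ σ e))

    -- The coefficient of ρ⁻¹ in a b a, arranged as a value at `h₀` so that `young-product` applies
    -- to it.
    n : Perm N → Carrier
    n ρ = ∑G r λ σ → ∑G c λ τ → sgn τ * app h₀ (ρ · (σ · τ))

    n-resp : Resp n
    n-resp e = ∑G-cong r λ σ _ → ∑G-cong c λ τ _ → *-congˡ (app-cong h₀ (·-congʳ (σ · τ) e))

    -- The sums a and b are invariant under inversion, which reverses the order of the factors; so a
    -- b a has equal coefficients at ρ and ρ⁻¹.
    m≈n : ∀ ρ → m ρ ≈ n ρ
    m≈n ρ = begin
      m ρ
        ≈⟨ ∑G-flip r {λ σ → ∑G c λ τ → sgn τ * ∑G r λ σ′ → δ (σ · (τ · σ′)) ρ}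
             (λ e → ∑G-cong c λ τ _ → *-congˡ (∑G-cong r λ σ′ _ → δ-respˡ ρ (·-congʳ (τ · σ′) e))) ⟩
      (∑G r λ σ → ∑G c λ τ → sgn τ * ∑G r λ σ′ → δ (flip σ · (τ · σ′)) ρ)
        ≈⟨ ∑G-cong r (λ σ _ → trans (∑G-flip c {λ τ → sgn τ * ∑G r λ σ′ → δ (flip σ · (τ · σ′)) ρ}
             (λ e → *-cong (sgn-resp e) (∑G-cong r λ σ′ _ → δ-respˡ ρ (·-congˡ (flip σ) (·-congʳ σ′ e)))))
             (∑G-cong c λ τ _ → *-cong (sgn-flip τ) (∑G-flip r {λ σ′ → δ (flip σ · (flip τ · σ′)) ρ}
               λ e → δ-respˡ ρ (·-congˡ (flip σ) (·-congˡ (flip τ) e))))) ⟩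
      (∑G r λ σ → ∑G c λ τ → sgn τ * ∑G r λ σ′ → δ (flip σ · (flip τ · flip σ′)) ρ)
        ≈⟨ ∑G-cong r (λ σ _ → ∑G-cong c λ τ _ → trans (*-congˡ (∑G-cong r λ σ′ _ → turn σ τ σ′)) (∑G-*ˡ r _ _)) ⟩
      (∑G r λ σ → ∑G c λ τ → ∑G r λ σ′ → sgn τ * δ ((ρ · (σ′ · τ)) · σ) idₚ)
        ≈⟨ ∑G-cong r (λ σ _ → ∑G-swap c r _) ⟩
      (∑G r λ σ → ∑G r λ σ′ → ∑G c λ τ → sgn τ * δ ((ρ · (σ′ · τ)) · σ) idₚ)
        ≈⟨ ∑G-swap r r _ ⟩
      (∑G r λ σ′ → ∑G r λ σ → ∑G c λ τ → sgn τ * δ ((ρ · (σ′ · τ)) · σ) idₚ)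
        ≈⟨ ∑G-cong r (λ σ′ _ → trans (∑G-swap r c _) (∑G-cong c λ τ _ → sym (∑G-*ˡ r _ _))) ⟩
      n ρ ∎
      where
      turn : ∀ σ τ σ′ → δ (flip σ · (flip τ · flip σ′)) ρ ≈ δ ((ρ · (σ′ · τ)) · σ) idₚ
      turn σ τ σ′ = δ-≡ {flip σ · (flip τ · flip σ′)} {ρ} {(ρ · (σ′ · τ)) · σ} {idₚ}
        (λ p → ptw λ a → ≡.trans (≡.sym (at p _)) (cancel a))
        (λ p → ptw λ a → ≡.sym (≡.trans (≡.sym (cong (ρ ⟨$⟩ʳ_) (uncancel a))) (at p _)))
        where
        cancel : ∀ a → flip σ ⟨$⟩ʳ (flip τ ⟨$⟩ʳ (flip σ′ ⟨$⟩ʳ (σ′ ⟨$⟩ʳ (τ ⟨$⟩ʳ (σ ⟨$⟩ʳ a))))) ≡ a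
        cancel a = ≡.trans (cong (λ z → flip σ ⟨$⟩ʳ (flip τ ⟨$⟩ʳ z)) (inverseˡ σ′))
          (≡.trans (cong (flip σ ⟨$⟩ʳ_) (inverseˡ τ)) (inverseˡ σ))
        uncancel : ∀ a → σ′ ⟨$⟩ʳ (τ ⟨$⟩ʳ (σ ⟨$⟩ʳ (flip σ ⟨$⟩ʳ (flip τ ⟨$⟩ʳ (flip σ′ ⟨$⟩ʳ a))))) ≡ a
        uncancel a = ≡.trans (cong (λ z → σ′ ⟨$⟩ʳ (τ ⟨$⟩ʳ z)) (inverseʳ σ))
          (≡.trans (cong (σ′ ⟨$⟩ʳ_) (inverseʳ τ)) (inverseʳ σ′))

    m-IsInt : ∀ ρ → IsInt (m ρ)
    m-IsInt ρ = IsInt-∑G r λ σ → IsInt-∑G c λ τ → IsInt-sgn τ (IsInt-∑G r λ σ′ →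
      IsInt-▸ (eqᵇ (σ · (τ · σ′)) ρ) (1 , inj₁ (sym (+-identityʳ 1#))))

    -- If στσ′ = 1 with σ and σ′ in the row group, then τ preserves rows and columns and is trivial.
    -- So every contributing sign is +1, and σ = τ = σ′ = 1 does contribute.
    m-id-IsPos : IsPos (m idₚ)
    m-id-IsPos = IsPos-∑G r
      (λ e → ∑G-cong c λ τ _ → *-congˡ (∑G-cong r λ σ′ _ → δ-respˡ idₚ (·-congʳ (τ · σ′) e)))
      (λ σ p → IsNat-∑G c λ τ q → term-nat σ τ p q)
      (IsPos-∑G c (λ e → *-cong (sgn-resp e) (∑G-cong r λ σ′ _ → δ-respˡ idₚ (·-congˡ idₚ (·-congʳ σ′ e))))
        (λ τ q → term-nat idₚ τ (pres λ _ → ≡.refl) q)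
        (resp-pos (sym (trans (*-congʳ (sgn-id {N})) (*-identityˡ _)))
          (IsPos-∑G r (λ e → δ-respˡ idₚ (·-congˡ idₚ (·-congˡ idₚ e))) (λ σ′ _ → IsNat-one _)
            (0 , trans (reflexive (cong (_▸ 1#) (≐⇒eqᵇ {π = idₚ · (idₚ · idₚ)} {idₚ} (ptw λ _ → ≡.refl)))) (sym (+-identityʳ 1#))))))
      where
      resp-pos : ∀ {x y} → x ≈ y → IsPos x → IsPos y
      resp-pos e (k , p) = k , trans (sym e) p
      IsNat-∑G : ∀ (l : Fin N → ℕ) {f} → (∀ x → Pres l x → IsNat (f x)) → IsNat (∑G l f)
      IsNat-∑G l {f} p with IsNat-∑ (allPerms N) (λ π → IsNat-▸ (inG l π) λ t → p π (inG⇒Pres l π t))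
      ... | k , e = k , trans (∑G-def l f) e
      term-nat : ∀ σ τ → Pres r σ → Pres c τ → IsNat (sgn τ * ∑G r λ σ′ → δ (σ · (τ · σ′)) idₚ)
      term-nat σ τ p q with IsNat-∑G r (λ σ′ p′ → IsNat-one (eqᵇ (σ · (τ · σ′)) idₚ))
      ... | k , e = k , trans (∑G-*ˡ r _ _) (trans (∑G-cong r λ σ′ p′ → trans (▸-*ˡ (eqᵇ (σ · (τ · σ′)) idₚ) (sgn τ) 1#)
          (▸-cong (eqᵇ (σ · (τ · σ′)) idₚ) λ t → trans (*-identityʳ _) (trans (sgn-resp (τ-trivial σ′ p′ (eqᵇ⇒≐ t))) (sgn-id {N})))) e)
        where
        τ-trivial : ∀ σ′ → Pres r σ′ → σ · (τ · σ′) ≐ idₚ → τ ≐ idₚ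
        τ-trivial σ′ p′ e = trivial τ (Pres-≐ {l = r} {flip σ · flip σ′} {τ}
          (ptw λ a → ≡.sym (≡.trans (≡.sym (inverseˡ σ)) (cong (σ ⟨$⟩ˡ_)
             (≡.trans (cong (λ z → σ ⟨$⟩ʳ (τ ⟨$⟩ʳ z)) (≡.sym (inverseʳ σ′))) (at e (σ′ ⟨$⟩ˡ a))))))
          (Pres-· (Pres-flip p) (Pres-flip p′))) q

    -- The sum is the coefficient of the identity in (a b a)(a b a). The inner a a only repeats a,
    -- and `h₀` reads the coefficient of the identity in (a b)(a b) a off from (a b)(a b).
    norm≈0 : (∀ h → (∑G r λ σ′ → ∑G c λ τ′ → sgn τ′ * Y r c (σ′ · τ′) h) ≈ 0#) → ∑P (λ ρ → m ρ * m ρ) ≈ 0#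
    norm≈0 vanish = begin
      ∑P (λ ρ → m ρ * m ρ)
        ≈⟨ ∑-cong (allPerms N) (λ ρ → *-congˡ (m≈n ρ)) ⟩
      ∑P (λ ρ → m ρ * n ρ)
        ≈⟨ ∑-cong (allPerms N) (λ ρ → expand ρ) ⟩
      ∑P (λ ρ → ∑G r λ σ → ∑G c λ τ → ∑G r λ σ′ → sgn τ * (eqᵇ ρ (σ · (τ · σ′)) ▸ n ρ))
        ≈⟨ ∑G-∑ r (allPerms N) _ ⟨
      (∑G r λ σ → ∑P λ ρ → ∑G c λ τ → ∑G r λ σ′ → sgn τ * (eqᵇ ρ (σ · (τ · σ′)) ▸ n ρ))
        ≈⟨ ∑G-cong r (λ σ _ → trans (sym (∑G-∑ c (allPerms N) _)) (∑G-cong c λ τ _ → trans (sym (∑G-∑ r (allPerms N) _))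
             (∑G-cong r λ σ′ _ → trans (sym (∑-*ˡ (allPerms N) _ _)) (*-congˡ (collapse (σ · (τ · σ′))))))) ⟩
      (∑G r λ σ → ∑G c λ τ → ∑G r λ σ′ → sgn τ * n (σ · (τ · σ′)))
        ≈⟨ ∑G-cong r (λ σ _ → ∑G-cong c λ τ _ → ∑G-cong r λ σ′ p′ → *-congˡ (absorb σ τ σ′ p′)) ⟩
      (∑G r λ σ → ∑G c λ τ → ∑G r λ σ′ → sgn τ * n (σ · τ))
        ≈⟨ ∑G-cong r (λ σ _ → ∑G-swap c r _) ⟩
      (∑G r λ σ → ∑G r λ σ′ → ∑G c λ τ → sgn τ * n (σ · τ))
        ≈⟨ ∑G-swap r r _ ⟩
      (∑G r λ σ′ → ∑G r λ σ → ∑G c λ τ → sgn τ * n (σ · τ))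
        ≈⟨ ∑G-zero r (λ _ _ → trans (young-product r c r c h₀) (vanish h₀)) ⟩
      0# ∎
      where
      expand : ∀ ρ → m ρ * n ρ ≈ ∑G r λ σ → ∑G c λ τ → ∑G r λ σ′ → sgn τ * (eqᵇ ρ (σ · (τ · σ′)) ▸ n ρ)
      expand ρ = begin
        m ρ * n ρ  ≈⟨ trans (*-comm _ _) (∑G-*ˡ r _ _) ⟩
        (∑G r λ σ → n ρ * ∑G c λ τ → sgn τ * ∑G r λ σ′ → δ (σ · (τ · σ′)) ρ)
          ≈⟨ ∑G-cong r (λ σ _ → trans (∑G-*ˡ c _ _) (∑G-cong c λ τ _ → trans (*-congˡ (∑G-*ˡ r _ _))
               (trans (∑G-*ˡ r _ _) (∑G-cong r λ σ′ _ → entry (σ · (τ · σ′)) τ)))) ⟩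
        (∑G r λ σ → ∑G c λ τ → ∑G r λ σ′ → sgn τ * (eqᵇ ρ (σ · (τ · σ′)) ▸ n ρ)) ∎
        where
        entry : ∀ (A τ : Perm N) → n ρ * (sgn τ * δ A ρ) ≈ sgn τ * (eqᵇ ρ A ▸ n ρ)
        entry A τ = begin
          n ρ * (sgn τ * δ A ρ)    ≈⟨ *-assoc _ _ _ ⟨
          (n ρ * sgn τ) * δ A ρ    ≈⟨ *-congʳ (*-comm _ _) ⟩
          (sgn τ * n ρ) * δ A ρ    ≈⟨ *-assoc _ _ _ ⟩
          sgn τ * (n ρ * δ A ρ)    ≈⟨ *-congˡ (trans (▸-*ˡ (eqᵇ A ρ) (n ρ) 1#)
                                        (trans (▸-cong (eqᵇ A ρ) λ _ → *-identityʳ _)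
                                          (reflexive (cong (_▸ n ρ) (Bool-ext (≐⇒eqᵇ ∘ ≐-sym ∘ eqᵇ⇒≐) (≐⇒eqᵇ ∘ ≐-sym ∘ eqᵇ⇒≐)))))) ⟩
          sgn τ * (eqᵇ ρ A ▸ n ρ)  ∎
      collapse : ∀ A → ∑P (λ ρ → eqᵇ ρ A ▸ n ρ) ≈ n A
      collapse A = trans (∑-cong (allPerms N) λ ρ → ▸-cong (eqᵇ ρ A) λ t → n-resp (eqᵇ⇒≐ t)) (∑P-δ A (n A))
      absorb : ∀ σ τ σ′ → Pres r σ′ → n (σ · (τ · σ′)) ≈ n (σ · τ)
      absorb σ τ σ′ p′ = sym (trans
        (∑G-left r p′ {λ ρ → ∑G c λ κ → sgn κ * app h₀ ((σ · τ) · (ρ · κ))}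
          (λ e → ∑G-cong c λ κ _ → *-congˡ (app-cong h₀ (·-congˡ (σ · τ) (·-congʳ κ e)))))
        (∑G-cong r λ ρ _ → ∑G-cong c λ κ _ → *-congˡ
          (app-cong h₀ {(σ · τ) · ((σ′ · ρ) · κ)} {(σ · (τ · σ′)) · (ρ · κ)} (ptw λ _ → ≡.refl))))

    square-nonvanishing : ¬ (∀ h → (∑G r λ σ′ → ∑G c λ τ′ → sgn τ′ * Y r c (σ′ · τ′) h) ≈ 0#)
    square-nonvanishing vanish = cz (proj₁ norm-IsPos) (trans (sym (proj₂ norm-IsPos)) (norm≈0 vanish))
      where
      pos-square : ∀ {x} → IsPos x → IsPos (x * x)
      pos-square (k , p) = k ℕ.+ k ℕ.* suc k , trans (*-cong p p) (sym (natK-* (suc k) (suc k)))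
      norm-IsPos : IsPos (∑P (λ ρ → m ρ * m ρ))
      norm-IsPos = IsPos-∑P {f = λ ρ → m ρ * m ρ} (λ e → *-cong (m-resp e) (m-resp e))
        (λ ρ → square-IsNat (m-IsInt ρ)) (pos-square m-id-IsPos)

  -- Subspaces of the group algebra

  Functional : ℕ → Set (u ⊔ ℓ)
  Functional N = PFun N → Carrier

  record Subspace (N : ℕ) : Set (lsuc (u ⊔ ℓ)) where
    infix 4 _∋_
    field
      _∋_    : Functional N → Set (u ⊔ ℓ)
      ∋-resp : ∀ {Φ Ψ} → (∀ h → Φ h ≈ Ψ h) → _∋_ Φ → _∋_ Ψ
      ∋-zero : _∋_ λ _ → 0#
      ∋-+    : ∀ {Φ Ψ} → _∋_ Φ → _∋_ Ψ → _∋_ λ h → Φ h + Ψ h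
      ∋-*    : ∀ k {Φ} → _∋_ Φ → _∋_ λ h → k * Φ h

    ∋-∑ : ∀ {a} {A : Set a} (xs : List A) {Φ : A → Functional N} → (∀ x → _∋_ (Φ x)) → _∋_ λ h → ∑ xs λ x → Φ x h
    ∋-∑ []       p = ∋-resp (λ h → sym (∑-nil _)) ∋-zero
    ∋-∑ (x ∷ xs) p = ∋-resp (λ h → sym (∑-∷ x xs _)) (∋-+ (p x) (∋-∑ xs p))

    ∋-▸ : ∀ b {Φ} → (b ≡ true → _∋_ Φ) → _∋_ λ h → b ▸ Φ h
    ∋-▸ true  p = p ≡.refl
    ∋-▸ false p = ∋-zero

    ∋-∑G : ∀ {M} (l : Fin M → ℕ) {Φ : Perm M → Functional N} → (∀ π → Pres l π → _∋_ (Φ π)) → _∋_ λ h → ∑G l λ π → Φ π h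
    ∋-∑G l p = ∋-resp (λ h → sym (∑G-def l _)) (∋-∑ (allPerms _) λ π → ∋-▸ (inG l π) λ t → p π (inG⇒Pres l π t))

    ∋-cancel : ∀ {k k⁻¹ Φ} → k * k⁻¹ ≈ 1# → _∋_ (λ h → k * Φ h) → _∋_ Φ
    ∋-cancel {k} {k⁻¹} {Φ} e p = ∋-resp
      (λ h → trans (sym (*-assoc _ _ _)) (trans (*-congʳ (trans (*-comm _ _) e)) (*-identityˡ _))) (∋-* k⁻¹ p)

    ∋-difference : ∀ {Φ Ψ} → _∋_ (λ h → Φ h + Ψ h) → _∋_ Φ → _∋_ Ψ
    ∋-difference {Φ} {Ψ} p q = ∋-resp
      (λ h → begin
        (Φ h + Ψ h) + - 1# * Φ h   ≈⟨ +-cong (+-comm _ _) (-1*x≈-x _) ⟩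
        (Ψ h + Φ h) + - Φ h        ≈⟨ +-assoc _ _ _ ⟩
        Ψ h + (Φ h + - Φ h)        ≈⟨ +-congˡ (-‿inverseʳ _) ⟩
        Ψ h + 0#                   ≈⟨ +-identityʳ _ ⟩
        Ψ h                        ∎)
      (∋-+ p (∋-* (- 1#) q))

  zeroSubspace : ∀ {N} → Subspace N
  zeroSubspace = record
    { _∋_    = λ Φ → Lift u (∀ h → Φ h ≈ 0#)
    ; ∋-resp = λ e p → lift λ h → trans (sym (e h)) (lower p h)
    ; ∋-zero = lift λ _ → refl
    ; ∋-+    = λ p q → lift λ h → trans (+-cong (lower p h) (lower q h)) (+-identityˡ 0#)
    ; ∋-*    = λ k p → lift λ h → trans (*-congˡ (lower p h)) (zeroʳ k)
    }

  -- This identifies κ as a natural number, so that 1 + κ is the image of a positive one and has an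
  -- inverse.
  ∑-ones : ∀ {a} {A : Set a} (xs : List A) (p : A → Bool) → Σ ℕ λ n → ∑ xs (λ x → p x ▸ 1#) ≈ natK K n
  ∑-ones []       p = 0 , ∑-nil _
  ∑-ones (x ∷ xs) p = extend (p x) (∑-ones xs p)
    where
    extend : ∀ b → (Σ ℕ λ n → ∑ xs (λ x → p x ▸ 1#) ≈ natK K n) → Σ ℕ λ n → ∑ (x ∷ xs) (λ x → p x ▸ 1#) ≈ natK K n
    extend _ (n , e) with p x in eq
    ... | true  = suc n , trans (∑-∷ x xs _) (+-cong (reflexive (cong (_▸ 1#) eq)) e)
    ... | false = n , trans (∑-∷ x xs _) (trans (+-cong (reflexive (cong (_▸ 1#) eq)) e) (+-identityˡ _))

  module Alternating {N : ℕ} (r c z : Fin N → ℕ) where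

    -- The element c_λ(T)·π·b, where b is the column antisymmetrizer given by z.
    B : Perm N → Functional N
    B π h = ∑G z λ τ → sgn τ * Y r c (π · τ) h

    B-resp : ∀ h → Resp (λ π → B π h)
    B-resp h e = ∑G-cong z λ τ _ → *-congˡ (Y-resp r c h (·-congʳ τ e))

    B-right : ∀ {κ} → Pres z κ → ∀ π h → B (π · κ) h ≈ sgn κ * B π h
    B-right {κ} p π h = sym (begin
      sgn κ * B π h
        ≈⟨ *-congˡ (∑G-left z p {λ τ → sgn τ * Y r c (π · τ) h} λ e → *-cong (sgn-resp e) (Y-resp r c h (·-congˡ π e))) ⟩
      sgn κ * ∑G z (λ τ → sgn (κ · τ) * Y r c (π · (κ · τ)) h)
        ≈⟨ ∑G-*ˡ z _ _ ⟩
      ∑G z (λ τ → sgn κ * (sgn (κ · τ) * Y r c (π · (κ · τ)) h))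
        ≈⟨ ∑G-cong z (λ τ _ → trans (sym (*-assoc _ _ _)) (*-cong (sgn-cancel τ)
             (Y-resp r c h {π · (κ · τ)} {(π · κ) · τ} (ptw λ _ → ≡.refl)))) ⟩
      B (π · κ) h ∎)
      where
      sgn-cancel : ∀ τ → sgn κ * sgn (κ · τ) ≈ sgn τ
      sgn-cancel τ = begin
        sgn κ * sgn (κ · τ)      ≈⟨ *-congˡ (sgn-· κ τ) ⟩
        sgn κ * (sgn κ * sgn τ)  ≈⟨ *-assoc _ _ _ ⟨
        (sgn κ * sgn κ) * sgn τ  ≈⟨ *-congʳ (sgn-square κ) ⟩
        1# * sgn τ               ≈⟨ *-identityˡ _ ⟩
        sgn τ                    ∎

    B-id : (∀ τ → Pres z τ → Pres c τ) → ∀ h → B idₚ h ≈ ∑G z (λ _ → 1#) * Y r c idₚ h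
    B-id sub h = begin
      B idₚ h
        ≈⟨ ∑G-cong z (λ τ p → trans (*-congˡ (trans (Y-resp r c h {idₚ · τ} {τ · idₚ} (ptw λ _ → ≡.refl)) (Y-col r c (sub τ p) idₚ h)))
             (trans (sym (*-assoc _ _ _)) (trans (*-congʳ (sgn-square τ)) (trans (*-identityˡ _) (sym (*-identityʳ _)))))) ⟩
      ∑G z (λ τ → Y r c idₚ h * 1#)    ≈⟨ ∑G-*ˡ z _ _ ⟨
      Y r c idₚ h * ∑G z (λ _ → 1#)    ≈⟨ *-comm _ _ ⟩
      ∑G z (λ _ → 1#) * Y r c idₚ h    ∎

    module _ (π : Perm N) (y : Fin N) (j : ℕ) (away : c (π ⟨$⟩ʳ y) ≢ j)
             (partner : ∀ p′ → c p′ ≡ c (π ⟨$⟩ʳ y) → Σ (Fin N) λ w → c w ≡ j × r w ≡ r p′) where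

      private
        inCol same : Fin N → Bool
        inCol x = c (π ⟨$⟩ʳ x) ≡ᵇ j
        same x = z x ≡ᵇ z y

      B-exchange : ∀ h → B π h ≈ ∑ (allFin N) λ x → inCol x ▸ B (π · transpose x y) h
      B-exchange h = begin
        B π h
          ≈⟨ ∑G-cong z (λ τ _ → trans (*-congˡ (exchange r c j (π ⟨$⟩ʳ y) away partner (π · τ) h)) (∑-*ˡ (allFin N) _ _)) ⟩
        (∑G z λ τ → ∑ (allFin N) λ x → sgn τ * ((c x ≡ᵇ j) ▸ Y r c (transpose x (π ⟨$⟩ʳ y) · (π · τ)) h))
          ≈⟨ ∑G-∑ z (allFin N) _ ⟩
        (∑ (allFin N) λ x → ∑G z λ τ → sgn τ * ((c x ≡ᵇ j) ▸ Y r c (transpose x (π ⟨$⟩ʳ y) · (π · τ)) h))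
          ≈⟨ ∑F-reindex π _ ⟩
        (∑ (allFin N) λ x → ∑G z λ τ → sgn τ * (inCol x ▸ Y r c (transpose (π ⟨$⟩ʳ x) (π ⟨$⟩ʳ y) · (π · τ)) h))
          ≈⟨ ∑-cong (allFin N) (λ x → trans (∑G-cong z λ τ _ → ▸-*ˡ (inCol x) _ _) (sym (∑G-▸ z (inCol x) _))) ⟩
        (∑ (allFin N) λ x → inCol x ▸ ∑G z λ τ → sgn τ * Y r c (transpose (π ⟨$⟩ʳ x) (π ⟨$⟩ʳ y) · (π · τ)) h)
          ≈⟨ ∑-cong (allFin N) (λ x → ▸-cong (inCol x) λ _ → ∑G-cong z λ τ _ → *-congˡ (Y-resp r c h
               {transpose (π ⟨$⟩ʳ x) (π ⟨$⟩ʳ y) · (π · τ)} {(π · transpose x y) · τ}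
               (ptw λ a → ≡.sym (at (transpose-conj π x y) (τ ⟨$⟩ʳ a))))) ⟩
        (∑ (allFin N) λ x → inCol x ▸ B (π · transpose x y) h) ∎

      -- For x in the same block of `z` as y, the transposition (x y) lies in the group of `z`, and
      -- the term is -B π. Moving these terms to the left side leaves the factor 1 + κ, with κ their
      -- number.
      B-step : ∀ h → (1# + ∑ (allFin N) (λ x → (inCol x ∧ same x) ▸ 1#)) * B π h
                     ≈ ∑ (allFin N) λ x → (inCol x ∧ not (same x)) ▸ B (π · transpose x y) h
      B-step h = begin
        (1# + κ) * B π h
          ≈⟨ distribʳ _ _ _ ⟩
        1# * B π h + κ * B π h
          ≈⟨ +-congʳ (trans (*-identityˡ _) (B-exchange h)) ⟩
        (∑ (allFin N) λ x → inCol x ▸ B (π · transpose x y) h) + κ * B π h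
          ≈⟨ +-congʳ (trans (∑-cong (allFin N) λ x → split (inCol x) (same x) (swap-same x)) (∑-+ (allFin N) _ _)) ⟩
        (rest + ∑ (allFin N) (λ x → - (B π h) * ((inCol x ∧ same x) ▸ 1#))) + κ * B π h
          ≈⟨ +-congʳ (+-congˡ (sym (∑-*ˡ (allFin N) _ _))) ⟩
        (rest + - (B π h) * κ) + κ * B π h
          ≈⟨ +-assoc _ _ _ ⟩
        rest + (- (B π h) * κ + κ * B π h)
          ≈⟨ +-congˡ (trans (+-cong (sym (-‿distribˡ-* _ _)) (*-comm _ _)) (-‿inverseˡ _)) ⟩
        rest + 0#
          ≈⟨ +-identityʳ _ ⟩
        rest ∎
        where
        κ = ∑ (allFin N) λ x → (inCol x ∧ same x) ▸ 1#
        rest = ∑ (allFin N) λ x → (inCol x ∧ not (same x)) ▸ B (π · transpose x y) h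
        swap-same : ∀ x → inCol x ≡ true → same x ≡ true → B (π · transpose x y) h ≈ - (B π h)
        swap-same x p q = trans (B-right (transpose-pres z (≡ᵇ⇒≡′ q)) π h) (trans
          (*-congʳ (sgn-transpose λ { ≡.refl → away (≡ᵇ⇒≡′ p) })) (-1*x≈-x _))
        split : ∀ a b {v} → (a ≡ true → b ≡ true → v ≈ - (B π h)) →
                a ▸ v ≈ (a ∧ not b) ▸ v + - (B π h) * ((a ∧ b) ▸ 1#)
        split true  true  p = trans (p ≡.refl ≡.refl) (trans (sym (*-identityʳ _)) (sym (+-identityˡ _)))
        split true  false p = sym (trans (+-congˡ (zeroʳ _)) (+-identityʳ _))
        split false b     p = sym (trans (+-congˡ (zeroʳ _)) (+-identityʳ _))

  -- The coefficient of c_λ(T) in the product c_λ(T) c_μ(S)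

  module Core {N : ℕ} (r c : Fin N → ℕ) (in0 : Fin N → Bool)
    (rc-injective : ∀ {a b} → r a ≡ r b → c a ≡ c b → a ≡ b)
    (left-closed : ∀ p j → j < c p → Σ (Fin N) λ w → c w ≡ j × r w ≡ r p)
    (left-closed₀ : ∀ p j → in0 p ≡ true → j < c p → Σ (Fin N) λ w → in0 w ≡ true × c w ≡ j × r w ≡ r p)
    (S : Subspace N)
    where

    open Column c in0

    r0 : Fin N → ℕ
    r0 = isolate r

    -- The two instances are T modulo the subspace S, and the restriction of T to A₀ modulo zero;
    -- comparing them identifies the coefficient α.
    record System : Set (lsuc (u ⊔ ℓ)) where
      field
        row′ col′ : Fin N → ℕ
        sub       : Subspace N
      open Alternating row′ col′ c0 public
      open Subspace sub public
      field
        col′⇒c0 : ∀ {a b} → in0 a ≡ true → in0 b ≡ true → col′ a ≡ col′ b → c0 a ≡ c0 b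
        c0⇒col′ : ∀ {a b} → c0 a ≡ c0 b → col′ a ≡ col′ b
        partner : ∀ {y p} → in0 y ≡ true → in0 p ≡ true → c y < c p → ∀ p′ → col′ p′ ≡ col′ p →
                  Σ (Fin N) λ w → col′ w ≡ col′ y × row′ w ≡ row′ p′
        -- Exchanges with entries outside A₀ are placed in the subspace by this field and therefore
        -- never contribute to the scalar.
        outside : ∀ π → Fix π → ∀ {x y} → in0 y ≡ true → c y < c (π ⟨$⟩ʳ y) → in0 x ≡ false → col′ x ≡ col′ y →
                  _∋_ (B (π · transpose x y))

      E : Functional N
      E = Y row′ col′ idₚ

      Pres-c0 : ∀ τ → Pres c0 τ → Pres col′ τ
      Pres-c0 τ p = pres λ a → c0⇒col′ (keep p a)

    -- Φ is congruent to a multiple of E, with the same coefficient in all systems.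
    Multiple : (System → Functional N) → Set (lsuc (u ⊔ ℓ))
    Multiple Φ = Σ Carrier λ α → ∀ s → System._∋_ s λ h → Φ s h + - α * System.E s h

    Multiple-resp : ∀ {Φ Ψ} → (∀ s h → Φ s h ≈ Ψ s h) → Multiple Φ → Multiple Ψ
    Multiple-resp e (α , p) = α , λ s → System.∋-resp s (λ h → +-congʳ (e s h)) (p s)

    Multiple-∋ : ∀ {Φ} → (∀ s → System._∋_ s (Φ s)) → Multiple Φ
    Multiple-∋ p = 0# , λ s → System.∋-resp s
      (λ h → sym (trans (+-congˡ (trans (*-congʳ -0#≈0#) (zeroˡ _))) (+-identityʳ _))) (p s)

    Multiple-E : ∀ α → Multiple (λ s h → α * System.E s h)
    Multiple-E α = α , λ s → System.∋-resp s
      (λ h → sym (trans (sym (distribʳ _ _ _)) (trans (*-congʳ (-‿inverseʳ α)) (zeroˡ _)))) (System.∋-zero s)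

    Multiple-+ : ∀ {Φ Ψ} → Multiple Φ → Multiple Ψ → Multiple (λ s h → Φ s h + Ψ s h)
    Multiple-+ {Φ} {Ψ} (α , p) (β , q) = α + β , λ s → System.∋-resp s
      (λ h → trans (interchange _ _ _ _) (+-congˡ (trans (sym (distribʳ _ _ _)) (*-congʳ (-‿+-comm α β)))))
      (System.∋-+ s (p s) (q s))
      where open import Algebra.Properties.CommutativeSemigroup +-commutativeSemigroup using (interchange)

    Multiple-* : ∀ k {Φ} → Multiple Φ → Multiple (λ s h → k * Φ s h)
    Multiple-* k (α , p) = k * α , λ s → System.∋-resp s
      (λ h → trans (distribˡ _ _ _) (+-congˡ (trans (sym (*-assoc _ _ _)) (*-congʳ (sym (-‿distribʳ-* k α))))))
      (System.∋-* s k (p s))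

    Multiple-∑ : ∀ {a} {A : Set a} (xs : List A) {Φ : A → System → Functional N} →
                 (∀ x → Multiple (Φ x)) → Multiple (λ s h → ∑ xs λ x → Φ x s h)
    Multiple-∑ []       p = Multiple-resp (λ s h → sym (∑-nil _)) (Multiple-∋ λ s → System.∋-zero s)
    Multiple-∑ (x ∷ xs) p = Multiple-resp (λ s h → sym (∑-∷ x xs _)) (Multiple-+ (p x) (Multiple-∑ xs p))

    Multiple-▸ : ∀ b {Φ} → (b ≡ true → Multiple Φ) → Multiple (λ s h → b ▸ Φ s h)
    Multiple-▸ true  p = p ≡.refl
    Multiple-▸ false p = Multiple-∋ λ s → System.∋-zero s

    pot-Fix : ∀ π → Fix π → pot π ≡ pot idₚ
    pot-Fix π fx = moment-reindex c W0 W0 idₚ π λ s → cong b2n (Fix⇒in0 π fx s)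

    -- A permutation of A₀ preserves the sum of its columns, so if no entry moves right, none moves
    -- left either.
    good-Fix⇒Pres : ∀ π → Fix π → Good π → Pres c0 π
    good-Fix⇒Pres π fx good = pres λ a → cases a (in0 a) ≡.refl
      where
      cases : ∀ a b → in0 a ≡ b → c0 (π ⟨$⟩ʳ a) ≡ c0 a
      cases a false e = cong c0 (fx a e)
      cases a true  e = isolate-cong c (≡.trans (Fix⇒in0 π fx a) e) e (W0-cancel a e
        (moment-tight c W0 π idₚ (λ s → W0-mono s (good s)) (pot-Fix π fx) a))

    Fix-transpose : ∀ π {x y} → Fix π → in0 x ≡ true → in0 y ≡ true → Fix (π · transpose x y)
    Fix-transpose π {x} {y} fx x∈ y∈ a a∉ = ≡.trans (cong (π ⟨$⟩ʳ_) (transpose-other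
        (λ { ≡.refl → true≢false x∈ a∉ })
        (λ { ≡.refl → true≢false y∈ a∉ }))) (fx a a∉)

    -- Both systems pass through the same induction: an x in A₀ leads to the same recursive term in
    -- each, an x outside A₀ to a term in the subspace. At the end π preserves home columns, and B π
    -- is E times the sign of π and the order of the group of `c0`.
    B-Multiple : ∀ π → Fix π → Multiple (λ s → System.B s π)
    B-Multiple = sorting-induction (λ π → Fix π → Multiple (λ s → System.B s π)) base step
      where
      base : ∀ π → Good π → Fix π → Multiple (λ s → System.B s π)
      base π good fx = Multiple-resp
        (λ s h → trans (*-assoc _ _ _) (sym (trans (System.B-resp s h {π} {idₚ · π} (ptw λ _ → ≡.refl))
          (trans (System.B-right s (good-Fix⇒Pres π fx good) idₚ h) (*-congˡ (System.B-id s (System.Pres-c0 s) h))))))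
        (Multiple-E (sgn π * ∑G c0 (λ _ → 1#)))
      step : ∀ π y → in0 y ≡ true → c y < c (π ⟨$⟩ʳ y) →
        (∀ x → c (π ⟨$⟩ʳ x) ≡ c y → c0 x ≢ c0 y → Fix (π · transpose x y) → Multiple (λ s → System.B s (π · transpose x y))) →
        Fix π → Multiple (λ s → System.B s π)
      step π y y∈ lt IH fx = Multiple-resp
        (λ s h → trans (*-congˡ (sym (System.B-step s π y (System.col′ s y) (away s) (System.partner s y∈ πy∈ lt) h)))
          (trans (*-congˡ (*-congʳ (+-congˡ (∑-cong (allFin N) λ x → uniform s x (in0 x) ≡.refl))))
          (trans (sym (*-assoc _ _ _)) (trans (*-congʳ (trans (*-comm _ _) inverted)) (*-identityˡ _)))))
        (Multiple-* κ⁻¹ (Multiple-∑ (allFin N) λ x → term x (in0 x) ≡.refl))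
        where
        πy∈ : in0 (π ⟨$⟩ʳ y) ≡ true
        πy∈ = ≡.trans (Fix⇒in0 π fx y) y∈
        same : Fin N → Bool
        same x = c0 x ≡ᵇ c0 y
        inCol₀ : Fin N → Bool
        inCol₀ x = c0 (π ⟨$⟩ʳ x) ≡ᵇ c0 y
        inCol : System → Fin N → Bool
        inCol s x = System.col′ s (π ⟨$⟩ʳ x) ≡ᵇ System.col′ s y
        inCol-≡ : ∀ s x → in0 x ≡ true → inCol s x ≡ inCol₀ x
        inCol-≡ s x x∈ = Bool-ext
          (λ t → ≡⇒≡ᵇ′ (System.col′⇒c0 s (≡.trans (Fix⇒in0 π fx x) x∈) y∈ (≡ᵇ⇒≡′ t)))
          (λ t → ≡⇒≡ᵇ′ (System.c0⇒col′ s (≡ᵇ⇒≡′ t)))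
        same-false : ∀ x → in0 x ≡ false → same x ≡ false
        same-false x x∉ = Boolₚ.¬-not λ t → true≢false (≡.trans (isolate-in0 c x y (≡ᵇ⇒≡′ t)) y∈) x∉
        away : ∀ s → System.col′ s (π ⟨$⟩ʳ y) ≢ System.col′ s y
        away s e = ℕₚ.<-irrefl (≡.sym (isolate-injective c πy∈ y∈ (System.col′⇒c0 s πy∈ y∈ e))) lt
        ones = ∑-ones (allFin N) (λ x → inCol₀ x ∧ same x)
        κ = ∑ (allFin N) λ x → (inCol₀ x ∧ same x) ▸ 1#
        κ⁻¹ = proj₁ (natK⁻¹ (proj₁ ones))
        inverted : (1# + κ) * κ⁻¹ ≈ 1#
        inverted = trans (*-congʳ (+-congˡ (proj₂ ones))) (proj₂ (natK⁻¹ (proj₁ ones)))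
        -- Entries outside A₀ never satisfy `same`, so κ counts entries of A₀ only and is one number
        -- for all systems.
        uniform : ∀ s x b → in0 x ≡ b → (inCol s x ∧ same x) ▸ 1# ≈ (inCol₀ x ∧ same x) ▸ 1#
        uniform s x true  e = reflexive (cong (λ b → (b ∧ same x) ▸ 1#) (inCol-≡ s x e))
        uniform s x false e = reflexive (cong (_▸ 1#) (≡.trans (cong (inCol s x ∧_) (same-false x e))
          (≡.trans (Boolₚ.∧-zeroʳ _) (≡.sym (≡.trans (cong (inCol₀ x ∧_) (same-false x e)) (Boolₚ.∧-zeroʳ _))))))
        term : ∀ x b → in0 x ≡ b → Multiple (λ s h → (inCol s x ∧ not (same x)) ▸ System.B s (π · transpose x y) h)
        term x true e = Multiple-resp
          (λ s h → reflexive (cong (λ b → (b ∧ not (same x)) ▸ System.B s (π · transpose x y) h) (≡.sym (inCol-≡ s x e))))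
          (Multiple-▸ (inCol₀ x ∧ not (same x)) λ t → IH x
            (isolate-injective c (≡.trans (Fix⇒in0 π fx x) e) y∈ (≡ᵇ⇒≡′ (∧-true₁ t)))
            (λ q → true≢false (∧-true₂ {inCol₀ x} t) (cong not (≡⇒≡ᵇ′ q)))
            (Fix-transpose π fx e y∈))
        term x false e = Multiple-∋ λ s → System.∋-▸ s (inCol s x ∧ not (same x)) λ t →
          System.outside s π fx y∈ lt e (≡.trans (cong (System.col′ s) (≡.sym (fx x e))) (≡ᵇ⇒≡′ (∧-true₁ t)))

    isolated : System
    isolated = record
      { row′ = r0 ; col′ = c0 ; sub = zeroSubspace
      ; col′⇒c0 = λ _ _ e → e
      ; c0⇒col′ = λ e → e
      ; partner = partner
      ; outside = λ π fx {x} {y} y∈ _ x∉ e → true≢false (≡.trans (isolate-in0 c x y e) y∈) x∉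
      }
      where
      partner : ∀ {y p} → in0 y ≡ true → in0 p ≡ true → c y < c p → ∀ p′ → c0 p′ ≡ c0 p →
                Σ (Fin N) λ w → c0 w ≡ c0 y × r0 w ≡ r0 p′
      partner {y} {p} y∈ p∈ lt p′ e with ≡.trans (isolate-in0 c p′ p e) p∈
      ... | p′∈ with left-closed₀ p′ (c y) p′∈ (ℕₚ.<-≤-trans lt (ℕₚ.≤-reflexive (≡.sym (isolate-injective c p′∈ p∈ e))))
      ...   | w , w∈ , cw , rw = w
              , isolate-cong c w∈ y∈ cw
              , isolate-cong r w∈ p′∈ rw

    trivial-intersection : ∀ π → Pres r0 π → Pres c0 π → π ≐ idₚ
    trivial-intersection π p q = ptw λ a → cases a (in0 a) ≡.refl
      where
      cases : ∀ a b → in0 a ≡ b → π ⟨$⟩ʳ a ≡ a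
      cases a false e = Pres-isolate⇒Fix r p a e
      cases a true  e = rc-injective (isolate-injective r πa∈ e (keep p a)) (isolate-injective c πa∈ e (keep q a))
        where
        πa∈ : in0 (π ⟨$⟩ʳ a) ≡ true
        πa∈ = ≡.trans (isolate-in0 r _ _ (keep p a)) e

    open Subspace S
    open Alternating r c c0 using (B; B-step)

    module _ (strictly-left : ∀ π → StrictlyLeft π → _∋_ (Y r c π)) where

      -- Here entries from outside may already have been exchanged into A₀. Further exchanges never
      -- raise the sum of columns, so the loss survives until no entry of A₀ is right of its home
      -- column; then every term of B π moves A₀ strictly left.
      lost⇒B∈ : ∀ π → pot π < pot idₚ → _∋_ (B π)
      lost⇒B∈ = sorting-induction (λ π → pot π < pot idₚ → _∋_ (B π)) base step
        where
        base : ∀ π → Good π → pot π < pot idₚ → _∋_ (B π)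
        base π good lost = ∋-∑G c0 λ τ p → ∋-* (sgn τ) (strictly-left (π · τ)
          ( (λ s s∈ → ℕₚ.≤-trans (good _ (≡.trans (τ-in0 p s) s∈)) (ℕₚ.≤-reflexive
              (isolate-injective c (≡.trans (τ-in0 p s) s∈) s∈ (keep p s))))
          , ≡.subst (_< pot idₚ) (≡.sym (moment-reindex c W0 W0 π τ λ s → cong b2n (τ-in0 p s))) lost))
          where
          τ-in0 : ∀ {τ} → Pres c0 τ → ∀ s → in0 (τ ⟨$⟩ʳ s) ≡ in0 s
          τ-in0 p s = isolate-in0 c _ _ (keep p s)
        step : ∀ π y → in0 y ≡ true → c y < c (π ⟨$⟩ʳ y) →
          (∀ x → c (π ⟨$⟩ʳ x) ≡ c y → c0 x ≢ c0 y → pot (π · transpose x y) < pot idₚ → _∋_ (B (π · transpose x y))) →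
          pot π < pot idₚ → _∋_ (B π)
        step π y y∈ lt IH lost = ∋-cancel {k = 1# + ∑ (allFin N) (λ x → ((c (π ⟨$⟩ʳ x) ≡ᵇ c y) ∧ (c0 x ≡ᵇ c0 y)) ▸ 1#)}
          (trans (*-congʳ (+-congˡ (proj₂ ones))) (proj₂ (natK⁻¹ (proj₁ ones))))
          (∋-resp (λ h → sym (B-step π y (c y) (λ e → ℕₚ.<-irrefl (≡.sym e) lt)
              (λ p′ e → left-closed p′ (c y) (ℕₚ.<-≤-trans lt (ℕₚ.≤-reflexive (≡.sym e)))) h))
            (∋-∑ (allFin N) λ x → ∋-▸ ((c (π ⟨$⟩ʳ x) ≡ᵇ c y) ∧ not (c0 x ≡ᵇ c0 y)) λ t →
              summand x (c (π ⟨$⟩ʳ x) ≡ᵇ c y) (c0 x ≡ᵇ c0 y) ≡.refl ≡.refl t))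
          where
          ones = ∑-ones (allFin N) (λ x → (c (π ⟨$⟩ʳ x) ≡ᵇ c y) ∧ (c0 x ≡ᵇ c0 y))
          summand : ∀ x a b → (c (π ⟨$⟩ʳ x) ≡ᵇ c y) ≡ a → (c0 x ≡ᵇ c0 y) ≡ b → a ∧ not b ≡ true → _∋_ (B (π · transpose x y))
          summand x true false p q _ = IH x (≡ᵇ⇒≡′ p) (λ e → true≢false (≡⇒≡ᵇ′ e) q)
            (ℕₚ.≤-<-trans (moment-swap-≤ c W0 π (ℕₚ.≤-<-trans (ℕₚ.≤-reflexive (≡ᵇ⇒≡′ p)) lt)
               (ℕₚ.≤-trans (b2n≤1 (in0 x)) (ℕₚ.≤-reflexive (≡.sym (cong b2n y∈))))) lost)
            where
            b2n≤1 : ∀ b → b2n b ≤ 1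
            b2n≤1 true  = ℕₚ.≤-refl
            b2n≤1 false = z≤n

      original : System
      original = record
        { row′ = r ; col′ = c ; sub = S
        ; col′⇒c0 = isolate-cong c
        ; c0⇒col′ = λ {a} {b} e → c0⇒c a b (in0 a) ≡.refl e
        ; partner = λ {y} {p} _ _ lt p′ e → left-closed p′ (c y) (ℕₚ.<-≤-trans lt (ℕₚ.≤-reflexive (≡.sym e)))
        ; outside = λ π fx {x} {y} y∈ lt x∉ e → lost⇒B∈ (π · transpose x y) (ℕₚ.<-≤-trans
            (moment-swap-< c W0 π (ℕₚ.≤-<-trans (ℕₚ.≤-reflexive (≡.trans (cong c (fx x x∉)) e)) lt)
              (≡.subst₂ _<_ (≡.sym (cong b2n x∉)) (≡.sym (cong b2n y∈)) (s≤s z≤n)))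
            (ℕₚ.≤-reflexive (pot-Fix π fx)))
        }
        where
        c0⇒c : ∀ a b k → in0 a ≡ k → c0 a ≡ c0 b → c a ≡ c b
        c0⇒c a b true  p e = isolate-injective c p (≡.trans (≡.sym (isolate-in0 c a b e)) p) e
        c0⇒c a b false p e = cong c (isolate-∉ c p e)

      reduce : (∀ ρ {Φ} → _∋_ Φ → _∋_ (λ h → Φ (translate ρ h))) →
               _∋_ (λ h → ∑G r0 λ σ → ∑G c0 λ τ → sgn τ * app h (σ · τ)) →
               _∋_ (Y r c idₚ)
      reduce translated young₀ = ∋-cancel {k = - α} {k⁻¹ = - α⁻¹} unit
        (∋-difference {λ h → ∑P λ σ → inG r0 σ ▸ B σ h} (proj₂ total original) total∈)
        where
        total : Multiple (λ s h → ∑P λ σ → inG r0 σ ▸ System.B s σ h)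
        total = Multiple-∑ (allPerms N) λ σ → Multiple-▸ (inG r0 σ) λ t → B-Multiple σ (Pres-isolate⇒Fix r (inG⇒Pres r0 σ t))
        α = proj₁ total
        α≉0 : ¬ (α ≈ 0#)
        -- In the isolated system the congruence is the identity c_μ(S)² = α c_μ(S).
        α≉0 α≈0 = square-nonvanishing r0 c0 trivial-intersection λ h → trans (∑G-def r0 _)
          (trans (sym (trans (+-congˡ (trans (*-congʳ (trans (-‿cong α≈0) -0#≈0#)) (zeroˡ _))) (+-identityʳ _)))
            (lower (proj₂ total isolated) h))
        α⁻¹ = proj₁ (Field.inverse K α α≉0)
        unit : - α * - α⁻¹ ≈ 1#
        unit = trans (sym (-‿distribˡ-* _ _)) (trans (-‿cong (sym (-‿distribʳ-* _ _))) (trans (-‿involutive _)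
          (proj₂ (Field.inverse K α α≉0))))
        total∈ : _∋_ (λ h → ∑P λ σ → inG r0 σ ▸ B σ h)
        total∈ = ∋-resp (λ h → trans (young-product r c r0 c0 h) (∑G-def r0 _))
          (∋-∑G r λ σ _ → ∋-∑G c λ τ _ → ∋-* (sgn τ) (translated (σ · τ) young₀))

  -- Removing gaps from the region occupied by A₀

  module Straighten {N : ℕ} {λ' : List ℕ} (part : IsPartition λ') (T : Box λ' ↔ Fin N) (in0 : Fin N → Bool) where
    open Positions part T
    open Column c in0

    occupied : Perm N → Fin N → Bool
    occupied π a = in0 (π ⟨$⟩ˡ a)

    Shaped : Perm N → Set
    Shaped π = ∀ a b → occupied π a ≡ true → r b ≤ r a → c b ≤ c a → occupied π b ≡ true

    UpGap LeftGap : Perm N → Fin N → Fin N → Set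
    UpGap   π a b = occupied π a ≡ true × occupied π b ≡ false × c b ≡ c a × r a ≡ suc (r b)
    LeftGap π a b = occupied π a ≡ true × occupied π b ≡ false × r b ≡ r a × c a ≡ suc (c b)

    upGap? : ∀ π a b → Dec (UpGap π a b)
    upGap? π a b = (occupied π a Boolₚ.≟ true) ×-dec (occupied π b Boolₚ.≟ false) ×-dec (c b ℕ.≟ c a) ×-dec (r a ℕ.≟ suc (r b))

    leftGap? : ∀ π a b → Dec (LeftGap π a b)
    leftGap? π a b = (occupied π a Boolₚ.≟ true) ×-dec (occupied π b Boolₚ.≟ false) ×-dec (r b ℕ.≟ r a) ×-dec (c a ℕ.≟ suc (c b))

    fill-up : ∀ π → (∀ a b → ¬ UpGap π a b) → ∀ n a b → occupied π a ≡ true → c b ≡ c a → r b ℕ.+ n ≡ r a → occupied π b ≡ true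
    fill-up π none zero a b o cb rb = ≡.trans (cong (occupied π) (rc-injective (≡.trans (≡.sym (ℕₚ.+-identityʳ _)) rb) cb)) o
    fill-up π none (suc n) a b o cb rb with up-closed a (r b ℕ.+ n) (ℕₚ.≤-reflexive (≡.trans (≡.sym (ℕₚ.+-suc (r b) n)) rb))
    ... | w , cw , rw with occupied π w in ow
    ...   | false = contradiction (o , ow , cw , ≡.trans (≡.sym rb) (≡.trans (ℕₚ.+-suc _ n) (cong suc (≡.sym rw)))) (none a w)
    ...   | true = fill-up π none n w b ow (≡.trans cb (≡.sym cw)) (≡.sym rw)

    fill-left : ∀ π → (∀ a b → ¬ LeftGap π a b) → ∀ n a b → occupied π a ≡ true → r b ≡ r a → c b ℕ.+ n ≡ c a → occupied π b ≡ true
    fill-left π none zero a b o rb cb = ≡.trans (cong (occupied π) (rc-injective rb (≡.trans (≡.sym (ℕₚ.+-identityʳ _)) cb))) o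
    fill-left π none (suc n) a b o rb cb with left-closed a (c b ℕ.+ n) (ℕₚ.≤-reflexive (≡.trans (≡.sym (ℕₚ.+-suc (c b) n)) cb))
    ... | w , cw , rw with occupied π w in ow
    ...   | false = contradiction (o , ow , rw , ≡.trans (≡.sym cb) (≡.trans (ℕₚ.+-suc _ n) (cong suc (≡.sym cw)))) (none a w)
    ...   | true = fill-left π none n w b ow (≡.trans rb (≡.sym rw)) (≡.sym cw)

    -- The way from a to b goes left in the row of a and then up, so that every box passed lies in
    -- the diagram.
    no-gaps⇒Shaped : ∀ π → (∀ a b → ¬ UpGap π a b) → (∀ a b → ¬ LeftGap π a b) → Shaped π
    no-gaps⇒Shaped π noUp noLeft a b o rle cle with ℕₚ.m≤n⇒∃[o]m+o≡n rle | ℕₚ.m≤n⇒∃[o]m+o≡n cle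
    ... | m , rm | n , cn = fill-up π noUp m w b
          (fill-left π noLeft n a w o (r-pos _ _ q) (≡.trans (cong (ℕ._+ n) (c-pos _ _ q)) cn))
          (≡.sym (c-pos _ _ q)) (≡.trans rm (≡.sym (r-pos _ _ q)))
      where
      q : c b < λ' ! r a
      q = ℕₚ.≤-<-trans cle (c<λ a)
      w = pos (r a) (c b) q

    rowpot : Perm N → ℕ
    rowpot = moment r W0

    module _ (S : Subspace N) where
      open Subspace S

      module FillUp (π : Perm N) (left : StrictlyLeft π) (a b : Fin N) (gap : UpGap π a b) where
        y = π ⟨$⟩ˡ a
        x = π ⟨$⟩ˡ b
        π′ = π · transpose x y

        πx : π ⟨$⟩ʳ x ≡ b
        πx = inverseʳ π
        πy : π ⟨$⟩ʳ y ≡ a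
        πy = inverseʳ π

        same-col : ∀ s → c (π′ ⟨$⟩ʳ s) ≡ c (π ⟨$⟩ʳ s)
        same-col = keep (transpose-pres (λ s → c (π ⟨$⟩ʳ s))
          (≡.trans (cong c πx) (≡.trans (proj₁ (proj₂ (proj₂ gap))) (≡.sym (cong c πy)))))

        pot-same : pot π′ ≡ pot π
        pot-same = moment-cong c W0 π′ π same-col

        rowpot-drops : rowpot π′ < rowpot π
        rowpot-drops = moment-swap-< r W0 π
          (≡.subst₂ _<_ (≡.sym (cong r πx)) (≡.sym (cong r πy)) (ℕₚ.≤-reflexive (≡.sym (proj₂ (proj₂ (proj₂ gap))))))
          (≡.subst₂ _<_ (≡.sym (cong b2n (proj₁ (proj₂ gap)))) (≡.sym (cong b2n (proj₁ gap))) (s≤s z≤n))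

        left′ : StrictlyLeft π′
        left′ = (λ s s∈ → ≡.subst (_≤ c s) (≡.sym (same-col s)) (proj₁ left s s∈)) , ≡.subst (_< pot idₚ) (≡.sym pot-same) (proj₂ left)

        a≢b : a ≢ b
        a≢b e = ℕₚ.<⇒≢ (ℕₚ.≤-reflexive (≡.sym (proj₂ (proj₂ (proj₂ gap))))) (cong r (≡.sym e))

        Y∈ : _∋_ (Y r c π′) → _∋_ (Y r c π)
        Y∈ p = ∋-resp (λ h → begin
          - 1# * Y r c π′ h                  ≈⟨ *-congˡ (Y-resp r c h {π′} {transpose b a · π} (≐-trans (transpose-conj π x y)
                                                  (ptw λ z → cong₂ (λ u v → transpose u v ⟨$⟩ʳ (π ⟨$⟩ʳ z)) πx πy))) ⟩
          - 1# * Y r c (transpose b a · π) h ≈⟨ *-congˡ (Y-col r c (transpose-pres c (proj₁ (proj₂ (proj₂ gap)))) π h) ⟩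
          - 1# * (sgn (transpose b a) * Y r c π h) ≈⟨ *-congˡ (*-congʳ (sgn-transpose (a≢b ∘ ≡.sym))) ⟩
          - 1# * (- 1# * Y r c π h)          ≈⟨ trans (*-congˡ (-1*x≈-x _)) (trans (-1*x≈-x _) (-‿involutive _)) ⟩
          Y r c π h                          ∎) (∋-* (- 1#) p)

      module FillLeft (π : Perm N) (left : StrictlyLeft π) (noUp : ∀ a b → ¬ UpGap π a b)
                      (a b : Fin N) (gap : LeftGap π a b) where
        i = r a
        j = c b

        open Hook i j (≡.subst (_< λ' ! r a) (proj₂ (proj₂ (proj₂ gap))) (c<λ a))

        -- An occupied box of column j in or below row i would, in the absence of vertical gaps,
        -- make b occupied. With `hook-occupied` this splits the hook into a vacant part in column j
        -- and an occupied part in column j + 1, so permutations of the hook can move A₀ only to the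
        -- left.
        occupied-col : ∀ {p} → InHook p → occupied π p ≡ true → c p ≡ suc j
        occupied-col {p} (inj₂ (e , _)) o = e
        occupied-col {p} (inj₁ (e , le)) o with ℕₚ.m≤n⇒∃[o]m+o≡n le
        ... | n , rn = true≢false (fill-up π noUp n p b o (≡.sym e)
                         (≡.trans (cong (ℕ._+ n) (proj₁ (proj₂ (proj₂ gap)))) rn)) (proj₁ (proj₂ gap))

        hook-occupied : ∀ {p} → c p ≡ suc j → r p ≤ i → occupied π p ≡ true
        hook-occupied {p} e le with ℕₚ.m≤n⇒∃[o]m+o≡n le
        ... | n , rn = fill-up π noUp n a p (proj₁ gap) (≡.trans e (≡.sym (proj₂ (proj₂ (proj₂ gap))))) rn

        col-bounds : ∀ {p} → InHook p → j ≤ c p × c p ≤ suc j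
        col-bounds (inj₁ (e , _)) = ℕₚ.≤-reflexive (≡.sym e) , ℕₚ.≤-trans (ℕₚ.≤-reflexive e) (ℕₚ.n≤1+n j)
        col-bounds (inj₂ (e , _)) = ℕₚ.≤-trans (ℕₚ.n≤1+n j) (ℕₚ.≤-reflexive (≡.sym e)) , ℕₚ.≤-reflexive e

        module _ (ρ : Perm N) (pr : Pres hook ρ) where

          moves-left : ∀ p → occupied π p ≡ true → c (ρ ⟨$⟩ʳ p) ≤ c p
          moves-left p o with inHook? p
          ... | no q  = ℕₚ.≤-reflexive (cong c (hook-fixed pr q))
          ... | yes q = ℕₚ.≤-trans (proj₂ (col-bounds (hook-stable pr q))) (ℕₚ.≤-reflexive (≡.sym (occupied-col q o)))

          moves-left-π : ∀ s → in0 s ≡ true → c (ρ ⟨$⟩ʳ (π ⟨$⟩ʳ s)) ≤ c (π ⟨$⟩ʳ s)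
          moves-left-π s s∈ = moves-left _ (≡.trans (cong in0 (inverseˡ π)) s∈)

          pot-≤ : pot (ρ · π) ≤ pot π
          pot-≤ = ≡.subst₂ _≤_ (≡.sym (moment-def c W0 (ρ · π))) (≡.sym (moment-def c W0 π)) (sum-mono λ s → W0-mono s (moves-left-π s))

          -- With an unchanged sum no occupied box changes its column, and a vacant box of the hook
          -- lies in column j and can only go right. So nothing moves left, and since ρ permutes the
          -- boxes, nothing moves right.
          pot-≡⇒Pres : pot (ρ · π) ≡ pot π → Pres c ρ
          pot-≡⇒Pres e = pres λ p → ≡.sym (sum-mono-≡ moves-right (sum-permute c ρ) p)
            where
            tight : ∀ s → in0 s ≡ true → c (ρ ⟨$⟩ʳ (π ⟨$⟩ʳ s)) ≡ c (π ⟨$⟩ʳ s)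
            tight s s∈ = W0-cancel s s∈ (moment-tight c W0 (ρ · π) π (λ s → W0-mono s (moves-left-π s)) e s)
            moves-right : ∀ p → c p ≤ c (ρ ⟨$⟩ʳ p)
            moves-right p with inHook? p
            ... | no q = ℕₚ.≤-reflexive (cong c (≡.sym (hook-fixed pr q)))
            ... | yes q@(inj₁ (e , _)) = ℕₚ.≤-trans (ℕₚ.≤-reflexive e) (proj₁ (col-bounds (hook-stable pr q)))
            ... | yes (inj₂ (e , le)) = ℕₚ.≤-reflexive (≡.sym (≡.subst (λ z → c (ρ ⟨$⟩ʳ z) ≡ c z) (inverseʳ π)
                    (tight (π ⟨$⟩ˡ p) (hook-occupied e le))))

          pot-drops : ¬ Pres c ρ → pot (ρ · π) < pot π
          pot-drops np = ℕₚ.≤∧≢⇒< pot-≤ (np ∘ pot-≡⇒Pres)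

          left′ : StrictlyLeft (ρ · π)
          left′ = (λ s s∈ → ℕₚ.≤-trans (moves-left-π s s∈) (proj₁ left s s∈)) , ℕₚ.≤-<-trans pot-≤ (proj₂ left)

        -- In the Garnir relation every ρ that preserves columns contributes Y π itself, the sign of
        -- ρ cancelling. Their number k is positive because of the identity, and all other ρ lower
        -- `pot`.
        Y∈ : (∀ ρ → pot (ρ · π) < pot π → StrictlyLeft (ρ · π) → _∋_ (Y r c (ρ · π))) → _∋_ (Y r c π)
        Y∈ IH = ∋-cancel {k = k} (trans (*-congʳ (proj₂ k-pos)) (proj₂ (natK⁻¹ (proj₁ k-pos))))
          (∋-difference {λ h → ∑G hook λ ρ → not (inG c ρ) ▸ (sgn ρ * Y r c (ρ · π) h)}
            (∋-resp (λ h → sym (vanish h)) ∋-zero)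
            (∋-∑G hook λ ρ pr → ∋-▸ (not (inG c ρ)) λ t → ∋-* (sgn ρ) (IH ρ (pot-drops ρ pr (not-Pres ρ t)) (left′ ρ pr))))
          where
          not-Pres : ∀ ρ → not (inG c ρ) ≡ true → ¬ Pres c ρ
          not-Pres ρ t p = true≢false t (cong not (Pres⇒inG c ρ p))
          k = ∑G hook λ ρ → inG c ρ ▸ 1#
          k-pos : IsPos k
          k-pos = IsPos-∑G hook (▸-resp c λ _ → refl) (λ ρ _ → IsNat-one (inG c ρ))
            (0 , trans (reflexive (cong (_▸ 1#) (Pres⇒inG c idₚ (pres λ _ → ≡.refl)))) (sym (+-identityʳ 1#)))
          vanish : ∀ h → ∑G hook (λ ρ → not (inG c ρ) ▸ (sgn ρ * Y r c (ρ · π) h)) + k * Y r c π h ≈ 0#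
          vanish h = begin
            ∑G hook (λ ρ → not (inG c ρ) ▸ (sgn ρ * Y r c (ρ · π) h)) + k * Y r c π h
              ≈⟨ +-congˡ (trans (*-comm _ _) (trans (∑G-*ˡ hook _ _) (∑G-cong hook λ ρ _ → trans (▸-*ˡ (inG c ρ) _ _)
                   (▸-cong (inG c ρ) λ t → trans (*-identityʳ _) (sym (preserved ρ (inG⇒Pres c ρ t))))))) ⟩
            ∑G hook (λ ρ → not (inG c ρ) ▸ (sgn ρ * Y r c (ρ · π) h)) + ∑G hook (λ ρ → inG c ρ ▸ (sgn ρ * Y r c (ρ · π) h))
              ≈⟨ +-comm _ _ ⟩
            ∑G hook (λ ρ → inG c ρ ▸ (sgn ρ * Y r c (ρ · π) h)) + ∑G hook (λ ρ → not (inG c ρ) ▸ (sgn ρ * Y r c (ρ · π) h))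
              ≈⟨ trans (∑G-cong hook λ ρ _ → ▸-split (inG c ρ) _) (∑G-+ hook _ _) ⟨
            ∑G hook (λ ρ → sgn ρ * Y r c (ρ · π) h)
              ≈⟨ garnir r c hook hook-clash π h ⟩
            0# ∎
            where
            preserved : ∀ ρ → Pres c ρ → sgn ρ * Y r c (ρ · π) h ≈ Y r c π h
            preserved ρ p = trans (*-congˡ (Y-col r c p π h)) (trans (sym (*-assoc _ _ _))
              (trans (*-congʳ (sgn-square ρ)) (*-identityˡ _)))

      -- Lexicographic induction: filling to the left lowers `pot`, filling upwards keeps `pot` and
      -- lowers `rowpot`.
      straighten : (∀ π → StrictlyLeft π → Shaped π → _∋_ (Y r c π)) → ∀ π → StrictlyLeft π → _∋_ (Y r c π)
      straighten shaped π left = go π left (<-wellFounded _) ≡.refl (<-wellFounded _)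
        where
        step : ∀ π → StrictlyLeft π →
          (∀ π′ → StrictlyLeft π′ → pot π′ < pot π → _∋_ (Y r c π′)) →
          (∀ π′ → StrictlyLeft π′ → pot π′ ≡ pot π → rowpot π′ < rowpot π → _∋_ (Y r c π′)) →
          _∋_ (Y r c π)
        step π left IH-col IH-row with Finₚ.any? (λ a → Finₚ.any? (upGap? π a))
        ... | yes (a , b , gap) = Y∈ (IH-row _ left′ pot-same rowpot-drops)
          where open FillUp π left a b gap
        ... | no noUp with Finₚ.any? (λ a → Finₚ.any? (leftGap? π a))
        ...   | yes (a , b , gap) = FillLeft.Y∈ π left (λ a b g → noUp (a , b , g)) a b gap
                  λ ρ lt left′ → IH-col (ρ · π) left′ lt
        ...   | no noLeft = shaped π left (no-gaps⇒Shaped π (λ a b g → noUp (a , b , g)) (λ a b g → noLeft (a , b , g)))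
        -- The index n stands for `pot π`, so that its accessibility proof can be passed on when
        -- only `rowpot` drops.
        go : ∀ π → StrictlyLeft π → ∀ {n} → Acc _<_ n → pot π ≡ n → Acc _<_ (rowpot π) → _∋_ (Y r c π)
        go π left (acc rs) e (acc rs′) = step π left
          (λ π′ left′ lt → go π′ left′ (rs (ℕₚ.<-≤-trans lt (ℕₚ.≤-reflexive e))) ≡.refl (<-wellFounded _))
          (λ π′ left′ e′ lt → go π′ left′ (acc rs) (≡.trans e′ e) (rs′ lt))

  -- From the group algebra to 𝒮 and its ideals

  record LFun (N : ℕ) : Set (u ⊔ ℓ) where
    constructor lfun
    field
      val   : Label N → Carrier
      kresp : ∀ {f g} → SameKernel f g → val f ≈ val g
  open LFun public

  ev : ∀ {N} → Elem N → LFun N → Carrier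
  ev v g = ∑ v λ t → proj₁ t * val g (proj₂ t)

  indicator : ∀ {N} → Label N → LFun N
  indicator g = lfun (λ f → sameKernel f g ▸ 1#) λ {f} {f′} p → reflexive (cong (_▸ 1#)
    (Bool-ext (λ t → ⇒sameKernel (sk-trans (sk-sym p) (sameKernel⇒ f g t)))
              (λ t → ⇒sameKernel (sk-trans p (sameKernel⇒ f′ g t)))))

  coeff-ev : ∀ {N} (v : Elem N) g → coeff v g ≈ ev v (indicator g)
  coeff-ev []            g = sym (∑-nil _)
  coeff-ev ((x , f) ∷ v) g = trans (step (sameKernel f g)) (sym (∑-∷ _ v _))
    where
    step : ∀ b → (if b then x + coeff v g else coeff v g) ≈ x * (b ▸ 1#) + ev v (indicator g)
    step true  = +-cong (sym (*-identityʳ x)) (coeff-ev v g)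
    step false = trans (coeff-ev v g) (sym (trans (+-congʳ (zeroʳ x)) (+-identityˡ _)))

  -- Coefficients are evaluations at indicators, so linear functionals separate elements.
  ev⇒≋ : ∀ {N} {v w : Elem N} → (∀ g → ev v g ≈ ev w g) → v ≋ w
  ev⇒≋ {v = v} {w} p g = trans (coeff-ev v g) (trans (p (indicator g)) (sym (coeff-ev w g)))

  actLF : ∀ {N} → Perm N → LFun N → LFun N
  actLF φ g = lfun (λ f → val g (actL φ f)) (λ p → kresp g (sk-act φ p))

  ev-• : ∀ {N} x (v : Elem N) g → ev (x • v) g ≈ x * ev v g
  ev-• x v g = trans (reflexive (∑-map _ v _)) (trans (∑-cong v λ t → *-assoc _ _ _) (sym (∑-*ˡ v x _)))

  ev-⊙ : ∀ {N} φ (v : Elem N) g → ev (φ ⊙ v) g ≈ ev v (actLF φ g)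
  ev-⊙ φ v g = reflexive (∑-map _ v _)

  -- The pullback of g along π ↦ π·z_f: for an element Φ of the group algebra, Φ (pull f g) is the
  -- value of g on Φ·z_f.
  pull : ∀ {N} → Label N → LFun N → PFun N
  pull f g = pfun (λ π → val g (actL π f)) λ {π} {ρ} e → kresp g (sk-≗ λ a → cong f (at (flip-cong e) a))

  -- A `Functional` may distinguish pointwise equal arguments, so membership is tested on every `h`
  -- that agrees with `pull f g`; translates of pullbacks are of this kind.
  Pulls : ∀ {N} → Label N → LFun N → PFun N → Set ℓ
  Pulls f g h = ∀ π → app h π ≈ val g (actL π f)

  ev-young : ∀ {N} λ' (T : Box λ' ↔ Fin N) (v : Elem N) g →
    ev (youngSym λ' T v) g
      ≈ ∑G (λ a → row (Inverse.from T a)) λ σ → ∑G (λ a → col (Inverse.from T a)) λ τ → sgn τ * ev v (actLF (σ · τ) g)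
  ev-young λ' T v g = begin
    ev (youngSym λ' T v) g
      ≈⟨ ∑-concatMap _ (rowGroup λ' T) _ ⟩
    (∑ (rowGroup λ' T) λ σ → ev (concatMap (λ τ → sgn₀ τ • (σ ⊙ (τ ⊙ v))) (colGroup λ' T)) g)
      ≈⟨ trans (∑-filterᵇ _ (allPerms _) _) (sym (∑G-def (λ a → row (Inverse.from T a)) _)) ⟩
    (∑G (λ a → row (Inverse.from T a)) λ σ → ev (concatMap (λ τ → sgn₀ τ • (σ ⊙ (τ ⊙ v))) (colGroup λ' T)) g)
      ≈⟨ ∑G-cong (λ a → row (Inverse.from T a)) (λ σ _ → inner σ) ⟩
    (∑G (λ a → row (Inverse.from T a)) λ σ → ∑G (λ a → col (Inverse.from T a)) λ τ → sgn τ * ev v (actLF (σ · τ) g)) ∎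
    where
    inner : ∀ σ → ev (concatMap (λ τ → sgn₀ τ • (σ ⊙ (τ ⊙ v))) (colGroup λ' T)) g
                ≈ ∑G (λ a → col (Inverse.from T a)) λ τ → sgn τ * ev v (actLF (σ · τ) g)
    inner σ = begin
      ev (concatMap (λ τ → sgn₀ τ • (σ ⊙ (τ ⊙ v))) (colGroup λ' T)) g
        ≈⟨ ∑-concatMap _ (colGroup λ' T) _ ⟩
      (∑ (colGroup λ' T) λ τ → ev (sgn₀ τ • (σ ⊙ (τ ⊙ v))) g)
        ≈⟨ trans (∑-filterᵇ _ (allPerms _) _) (sym (∑G-def (λ a → col (Inverse.from T a)) _)) ⟩
      (∑G (λ a → col (Inverse.from T a)) λ τ → ev (sgn₀ τ • (σ ⊙ (τ ⊙ v))) g)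
        ≈⟨ ∑G-cong (λ a → col (Inverse.from T a)) (λ τ _ → trans (ev-• _ (σ ⊙ (τ ⊙ v)) g)
             (*-cong (reflexive (≡.sym (sgn-def τ))) (trans (ev-⊙ σ (τ ⊙ v) g) (ev-⊙ τ v (actLF σ g))))) ⟩
      (∑G (λ a → col (Inverse.from T a)) λ τ → sgn τ * ev v (actLF (σ · τ) g)) ∎

  ev-single : ∀ {N} (f : Label N) g → ev ((1# , f) ∷ []) g ≈ val g f
  ev-single f g = trans (∑-∷ _ [] _) (trans (+-cong (*-identityˡ _) (∑-nil _)) (+-identityʳ _))

  ev-tabloid : ∀ {N} λ' F (T : Box λ' ↔ Fin N) g →
    ev (tabloidElem λ' F T) g
      ≈ Y (λ a → row (Inverse.from T a)) (λ a → col (Inverse.from T a)) idₚ (pull (λ a → F (Inverse.from T a)) g)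
  ev-tabloid λ' F T g = trans (ev-young λ' T _ g)
    (∑G-cong _ λ σ _ → ∑G-cong _ λ τ _ → *-congˡ (ev-single (λ a → F (Inverse.from T a)) (actLF (σ · τ) g)))

  -- It consists of the Φ for which Φ·z_f lies in the ideal, with Φ·z_f represented by an element
  -- having its values on all linear functionals.
  IdealSubspace : (Gen : (N : ℕ) → Elem N → Set (u ⊔ ℓ)) → ∀ {N} → Label N → Subspace N
  IdealSubspace Gen {N} f = record
    { _∋_    = λ Φ → Σ (Elem N) λ v → InIdeal Gen N v × (∀ g h → Pulls f g h → ev v g ≈ Φ h)
    ; ∋-resp = λ e (v , i , p) → v , i , λ g h o → trans (p g h o) (e h)
    ; ∋-zero = [] , zero , λ g h o → ∑-nil _
    ; ∋-+    = λ (v , i , p) (w , j , q) → v ++ w , add i j , λ g h o → trans (∑-++ v w _) (+-cong (p g h o) (q g h o))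
    ; ∋-*    = λ k (v , i , p) → k • v , scale k i , λ g h o → trans (ev-• k v g) (*-congˡ (p g h o))
    }

  Ideal-translate : ∀ Gen {N} (f : Label N) ρ {Φ} → Subspace._∋_ (IdealSubspace Gen f) Φ →
                    Subspace._∋_ (IdealSubspace Gen f) (λ h → Φ (translate ρ h))
  Ideal-translate Gen f ρ {Φ} (v , i , p) = ρ ⊙ v , act ρ i , λ g h o →
    trans (ev-⊙ ρ v g) (p (actLF ρ g) (translate ρ h) λ π → o (ρ · π))

  Ideal-tabloid : ∀ Gen {N} λ' F (T : Box λ' ↔ Fin N) →
    Subspace._∋_ (IdealSubspace Gen (λ a → F (Inverse.from T a)))
      (Y (λ a → row (Inverse.from T a)) (λ a → col (Inverse.from T a)) idₚ) →
    InIdeal Gen N (tabloidElem λ' F T)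
  Ideal-tabloid Gen λ' F T (v , i , p) = resp (ev⇒≋ {v = v} {tabloidElem λ' F T}
    λ g → trans (p g (pull (λ a → F (Inverse.from T a)) g) λ _ → refl) (sym (ev-tabloid λ' F T g))) i

  -- When G is f moved by π, the tabloid element of G is c_λ(T)·π·z_f.
  tabloid-translate : ∀ Gen {N} λ' G (T : Box λ' ↔ Fin N) (f : Label N) (π : Perm N) →
    (∀ a → G (Inverse.from T a) ≡ f (π ⟨$⟩ˡ a)) → InIdeal Gen N (tabloidElem λ' G T) →
    Subspace._∋_ (IdealSubspace Gen f) (Y (λ a → row (Inverse.from T a)) (λ a → col (Inverse.from T a)) π)
  tabloid-translate Gen λ' G T f π e i = tabloidElem λ' G T , i , λ g h o → trans (ev-tabloid λ' G T g)
    (∑G-cong _ λ σ _ → ∑G-cong _ λ τ _ → *-congˡ (trans (kresp g (sk-≗ λ a → e _)) (sym (o (σ · (τ · π))))))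

  sk-mul : ∀ {N M} {f f′ : Label N} (g : Label M) → SameKernel f f′ → SameKernel (mulL f g) (mulL f′ g)
  sk-mul {N} {M} g p = same-kernel (λ a b → transfer p (splitAt N a) (splitAt N b)) (λ a b → transfer (sk-sym p) (splitAt N a) (splitAt N b))
    where
    transfer : ∀ {f f′ : Label N} → SameKernel f f′ → ∀ x y →
      [ (λ a → 2 ℕ.* f a) , (λ b → suc (2 ℕ.* g b)) ]′ x ≡ [ (λ a → 2 ℕ.* f a) , (λ b → suc (2 ℕ.* g b)) ]′ y →
      [ (λ a → 2 ℕ.* f′ a) , (λ b → suc (2 ℕ.* g b)) ]′ x ≡ [ (λ a → 2 ℕ.* f′ a) , (λ b → suc (2 ℕ.* g b)) ]′ y
    transfer {f} {f′} p (inj₁ a) (inj₁ b) e = cong (2 ℕ.*_) (SameKernel.to-ker p a b (ℕₚ.*-cancelˡ-≡ (f a) (f b) 2 e))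
    transfer {f} {f′} p (inj₁ a) (inj₂ b) e = contradiction e (ℕₚ.even≢odd (f a) (g b))
    transfer {f} {f′} p (inj₂ a) (inj₁ b) e = contradiction (≡.sym e) (ℕₚ.even≢odd (f b) (g a))
    transfer p (inj₂ a) (inj₂ b) e = e

  mulLF : ∀ {N M} → Label M → LFun (N ℕ.+ M) → LFun N
  mulLF f₁ g = lfun (λ f → val g (mulL f f₁)) λ p → kresp g (sk-mul f₁ p)

  ev-⊗-single : ∀ {N M} (v : Elem N) (f₁ : Label M) g → ev (v ⊗ ((1# , f₁) ∷ [])) g ≈ ev v (mulLF f₁ g)
  ev-⊗-single v f₁ g = trans (∑-concatMap _ v _) (∑-cong v λ t →
    trans (∑-∷ _ [] _) (trans (+-cong (*-congʳ (*-identityʳ _)) (∑-nil _)) (+-identityʳ _)))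

  sgn-embed : ∀ {m n} (σ : Perm m) (φ : Perm (m ℕ.+ n)) → sgn (φ · (embed {m} {n} σ · flip φ)) ≈ sgn σ
  sgn-embed σ φ = begin
    sgn (φ · (embed σ · flip φ))          ≈⟨ trans (sgn-· φ _) (*-congˡ (sgn-· (embed σ) (flip φ))) ⟩
    sgn φ * (sgn (embed σ) * sgn (flip φ)) ≈⟨ *-congˡ (trans (*-comm _ _) (*-congʳ (sgn-flip φ))) ⟩
    sgn φ * (sgn φ * sgn (embed σ))       ≈⟨ *-assoc _ _ _ ⟨
    (sgn φ * sgn φ) * sgn (embed σ)       ≈⟨ trans (*-congʳ (sgn-square φ)) (*-identityˡ _) ⟩
    sgn (embed σ)                         ≈⟨ sgn-≡ (embed σ) σ (cong ℕ.parity (inversions-embed σ)) ⟩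
    sgn σ                                 ∎

  -- The tabloid of F₀ multiplied up to the degree of F

  module _ (Gen : (N : ℕ) → Elem N → Set (u ⊔ ℓ)) {λ' μ : List ℕ} (F : Box λ' → ℕ) (k : ℕ) (sub : μ ⊆ᵖ λ')
    (diagram : PreimageIsDiagram k λ' F μ)
    (has : ∀ N v → TabloidGen μ (F ∘ incl {μ} {λ'} sub) N v → Gen N v) where

    inc : Box μ → Box λ'
    inc = incl {μ} {λ'} sub

    below : ∀ {N} → Box λ' ↔ Fin N → Fin N → Bool
    below T a = does (F (Inverse.from T a) ℕ.<? k)

    -- This is c_μ(S) for the restriction S of T, written with permutations of all entries that fix
    -- those outside D_μ.
    Young₀ : ∀ {N} → Box λ' ↔ Fin N → Functional N
    Young₀ {N} T h = ∑G (isolate r) λ σ → ∑G (isolate c) λ τ → sgn τ * app h (σ · τ)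
      where
      r c : Fin N → ℕ
      r a = row (Inverse.from T a)
      c a = col (Inverse.from T a)
      open Column c (below T) using (isolate)

    Saturated : ∀ {N} → Box λ' ↔ Fin N → Set
    Saturated {N} T = ∀ a → k ≤ F (Inverse.from T a) →
      length (filter (λ b → F (Inverse.from T b) ℕ.≟ F (Inverse.from T a)) (allFin N)) ≡ d

    private
      module Transported {N₀ M : ℕ} (T : Box λ' ↔ Fin (N₀ ℕ.+ M)) (φ : Perm (N₀ ℕ.+ M))
        (left-∈ : ∀ i → below T (φ ⟨$⟩ʳ (i ↑ˡ M)) ≡ true) (right-∉ : ∀ j → below T (φ ⟨$⟩ʳ (N₀ ↑ʳ j)) ≡ false)
        (sat : Saturated T) where
        open Extension φ (below T) left-∈ right-∉
        open ExtSums (Field.commutativeRing K)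

        f : Label N
        f a = F (Inverse.from T a)

        f<k : ∀ {a} → below T a ≡ true → f a < k
        f<k {a} = does⇒ (f a ℕ.<? k)

        f≥k : ∀ {a} → below T a ≡ false → k ≤ f a
        f≥k {a} p = ℕₚ.≮⇒≥ λ lt → true≢false (dec-true (f a ℕ.<? k) lt) p

        boxAt : Fin N₀ → Box λ'
        boxAt i = Inverse.from T (φ ⟨$⟩ʳ (i ↑ˡ M))

        from-S : Fin N₀ → Box μ
        from-S i = box (row (boxAt i)) (col (boxAt i)) (Equivalence.to (diagram (boxAt i)) (f<k (left-∈ i)))

        in-μ : ∀ b → below T (Inverse.to T (inc b)) ≡ true
        in-μ b = dec-true (F (Inverse.from T (Inverse.to T (inc b))) ℕ.<? k)
          (subst (λ z → F z < k) (≡.sym (Inverse.inverseʳ T ≡.refl)) (Equivalence.from (diagram (inc b)) (col<λrow b)))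

        index : ∀ b → Σ (Fin N₀) λ i → i ↑ˡ M ≡ φ ⟨$⟩ˡ Inverse.to T (inc b)
        index b = only-left _ λ j e → true≢false (in-μ b) (≡.trans
            (cong (below T) (≡.trans (≡.sym (inverseʳ φ)) (cong (φ ⟨$⟩ʳ_) e))) (right-∉ j))

        boxAt-index : ∀ b → boxAt (proj₁ (index b)) ≡ inc b
        boxAt-index b = ≡.trans (cong (Inverse.from T) (≡.trans (cong (φ ⟨$⟩ʳ_) (proj₂ (index b))) (inverseʳ φ))) (Inverse.inverseʳ T ≡.refl)

        incl-from-S : ∀ i → inc (from-S i) ≡ boxAt i
        incl-from-S i = box-≡ ≡.refl ≡.refl

        S : Box μ ↔ Fin N₀
        S = mk↔ₛ′ (λ b → proj₁ (index b)) from-S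
          (λ i → Finₚ.↑ˡ-injective M _ _ (≡.trans (proj₂ (index (from-S i))) (≡.trans
             (cong (λ z → φ ⟨$⟩ˡ Inverse.to T z) (incl-from-S i)) (≡.trans (cong (φ ⟨$⟩ˡ_) (Inverse.inverseˡ T ≡.refl)) (inverseˡ φ)))))
          (λ b → box-≡ (cong row (boxAt-index b)) (cong col (boxAt-index b)))

        f₁ : Label M
        f₁ j = f (φ ⟨$⟩ʳ (N₀ ↑ʳ j))

        f₁-WF : WFLabel d M f₁
        f₁-WF j = ≡.trans (count-outside φ f (f₁ j) λ i e → ℕₚ.<⇒≢ (ℕₚ.<-≤-trans (f<k (left-∈ i)) (f≥k (right-∉ j))) e)
          (sat (φ ⟨$⟩ʳ (N₀ ↑ʳ j)) (f≥k (right-∉ j)))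

        -- The second factor is the monomial of the blocks outside [k], and φ moves the standard
        -- splitting to the entries of T; the result is c_μ(S)·z_F.
        element : Elem N
        element = φ ⊙ (tabloidElem μ (F ∘ inc) S ⊗ ((1# , f₁) ∷ []))

        element∈ : InIdeal Gen N element
        element∈ = act φ (mul ((1# , f₁) ∷ []) (f₁-WF ∷ []) (gen (has _ _ (lift (S , ≡.refl)))))

        -- The product of labellings doubles labels to keep the two factors apart;
        -- up to this injective relabelling the transported product is the original labelling.
        double : ℕ → ℕ
        double v = if does (v ℕ.<? k) then 2 ℕ.* v else suc (2 ℕ.* v)

        double-injective : ∀ {x y} → double x ≡ double y → x ≡ y
        double-injective {x} {y} e with does (x ℕ.<? k) | does (y ℕ.<? k)
        ... | true  | true  = ℕₚ.*-cancelˡ-≡ x y 2 e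
        ... | false | false = ℕₚ.*-cancelˡ-≡ x y 2 (ℕₚ.suc-injective e)
        ... | true  | false = contradiction e (ℕₚ.even≢odd x y)
        ... | false | true  = contradiction (≡.sym e) (ℕₚ.even≢odd y x)

        f₀ : Label N₀
        f₀ i = F (inc (from-S i))

        relabel : ∀ (σ τ : Perm N₀) → SameKernel (actL φ (mulL (actL (σ · (τ · idₚ)) f₀) f₁)) (actL (ext σ · ext τ) f)
        relabel σ τ = sk-injective double double-injective (φ-elim _ left right)
          where
          left : ∀ i → actL φ (mulL (actL (σ · (τ · idₚ)) f₀) f₁) (φ ⟨$⟩ʳ (i ↑ˡ M)) ≡ double (actL (ext σ · ext τ) f (φ ⟨$⟩ʳ (i ↑ˡ M)))
          left i = ≡.trans (cong (mulL (actL (σ · (τ · idₚ)) f₀) f₁) (inverseˡ φ))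
            (≡.trans (cong [ _ , _ ]′ (Finₚ.splitAt-↑ˡ N₀ i M))
            (≡.trans (cong (λ z → 2 ℕ.* F z) (incl-from-S _))
            (≡.trans (≡.sym (cong (λ b → if b then 2 ℕ.* f′ else suc (2 ℕ.* f′)) (left-∈ (τ ⟨$⟩ˡ (σ ⟨$⟩ˡ i)))))
              (cong (double ∘ f) (≡.sym (≡.trans (cong (ext τ ⟨$⟩ˡ_) (ext-leftˡ σ i)) (ext-leftˡ τ (σ ⟨$⟩ˡ i))))))))
            where f′ = f (φ ⟨$⟩ʳ ((τ ⟨$⟩ˡ (σ ⟨$⟩ˡ i)) ↑ˡ M))
          right : ∀ j → actL φ (mulL (actL (σ · (τ · idₚ)) f₀) f₁) (φ ⟨$⟩ʳ (N₀ ↑ʳ j)) ≡ double (actL (ext σ · ext τ) f (φ ⟨$⟩ʳ (N₀ ↑ʳ j)))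
          right j = ≡.trans (cong (mulL (actL (σ · (τ · idₚ)) f₀) f₁) (inverseˡ φ))
            (≡.trans (cong [ _ , _ ]′ (Finₚ.splitAt-↑ʳ N₀ M j))
            (≡.trans (≡.sym (cong (λ b → if b then 2 ℕ.* f₁ j else suc (2 ℕ.* f₁ j)) (right-∉ j)))
              (cong (double ∘ f) (≡.sym (≡.trans (cong (ext τ ⟨$⟩ˡ_) (ext-rightˡ σ j)) (ext-rightˡ τ j))))))

        r c : Fin N → ℕ
        r a = row (Inverse.from T a)
        c a = col (Inverse.from T a)

        element-ev : ∀ g h → Pulls f g h → ev element g ≈ Young₀ T h
        element-ev g h o = begin
          ev element g
            ≈⟨ trans (ev-⊙ φ _ g) (ev-⊗-single (tabloidElem μ (F ∘ inc) S) f₁ (actLF φ g)) ⟩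
          ev (tabloidElem μ (F ∘ inc) S) (mulLF f₁ (actLF φ g))
            ≈⟨ ev-tabloid μ (F ∘ inc) S (mulLF f₁ (actLF φ g)) ⟩
          (∑G (row ∘ from-S) λ σ → ∑G (col ∘ from-S) λ τ → sgn τ * val g (actL φ (mulL (actL (σ · (τ · idₚ)) f₀) f₁)))
            ≈⟨ ∑G-cong _ (λ σ _ → ∑G-cong _ λ τ _ → *-cong (sym (sgn-embed τ φ))
                 (trans (kresp g (relabel σ τ)) (sym (o (ext σ · ext τ))))) ⟩
          (∑G (row ∘ from-S) λ σ → ∑G (col ∘ from-S) λ τ → sgn (ext τ) * app h (ext σ · ext τ))
            ≈⟨ ∑G-cong _ (λ σ _ → ∑G-ext c (col ∘ from-S) (λ _ → ≡.refl) {λ τ → sgn τ * app h (ext σ · τ)}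
                 λ e → *-cong (sgn-resp e) (app-cong h (·-congˡ (ext σ) e))) ⟩
          (∑G (row ∘ from-S) λ σ → ∑G (Column.isolate c (below T) c) λ τ → sgn τ * app h (ext σ · τ))
            ≈⟨ ∑G-ext r (row ∘ from-S) (λ _ → ≡.refl) {λ σ → ∑G (Column.isolate c (below T) c) λ τ → sgn τ * app h (σ · τ)}
                 (λ e → ∑G-cong _ λ τ _ → *-congˡ (app-cong h (·-congʳ τ e))) ⟩
          Young₀ T h ∎

      -- The splitting gives N₀ + M = N only propositionally. Matching on this equation turns φ into
      -- a permutation, as the closure of an ideal under `act` demands.
      transported : ∀ {N N₀ M} → N₀ ℕ.+ M ≡ N → (T : Box λ' ↔ Fin N) (φ : Fin (N₀ ℕ.+ M) ↔ Fin N) →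
        (∀ i → below T (φ ⟨$⟩ʳ (i ↑ˡ M)) ≡ true) → (∀ j → below T (φ ⟨$⟩ʳ (N₀ ↑ʳ j)) ≡ false) → Saturated T →
        Subspace._∋_ (IdealSubspace Gen (λ a → F (Inverse.from T a))) (Young₀ T)
      transported ≡.refl T φ l r sat = element , element∈ , element-ev
        where open Transported T φ l r sat

    young₀∈ : ∀ {N} (T : Box λ' ↔ Fin N) → Saturated T →
              Subspace._∋_ (IdealSubspace Gen (λ a → F (Inverse.from T a))) (Young₀ T)
    young₀∈ T sat = transported (Perm.↔⇒≡ φ) T φ
      (λ i → ≡.trans (cong (below T ∘ Inverse.to bij) (Finₚ.splitAt-↑ˡ N₀ i M)) (left i))
      (λ j → ≡.trans (cong (below T ∘ Inverse.to bij) (Finₚ.splitAt-↑ʳ N₀ M j)) (right j)) sat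
      where
      decided : ∀ b → b ≡ true ⊎ b ≡ false
      decided true  = inj₁ ≡.refl
      decided false = inj₂ ≡.refl
      open Splitting (splitting {P = λ a → below T a ≡ true} {λ a → below T a ≡ false} λ a → decided (below T a))
      φ : Fin (N₀ ℕ.+ M) ↔ Fin _
      φ = mk↔ₛ′ (Inverse.to bij ∘ splitAt N₀) (join N₀ M ∘ Inverse.from bij)
        (λ a → ≡.trans (cong (Inverse.to bij) (Finₚ.splitAt-join N₀ M _)) (Inverse.inverseˡ bij ≡.refl))
        (λ x → ≡.trans (cong (join N₀ M) (Inverse.inverseʳ bij ≡.refl)) (Finₚ.join-splitAt N₀ M x))

  -- The two inclusions

  module _ {λ' : List ℕ} (part : IsPartition λ') {N : ℕ} (T : Box λ' ↔ Fin N) (k : ℕ) where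

    open Positions part T

    module Stage (F : Box λ' → ℕ) where

      f : Fin N → ℕ
      f a = F (Inverse.from T a)

      in0 : Fin N → Bool
      in0 a = does (f a ℕ.<? k)

      open Column c in0 public
      open Straighten part T in0 public using (Shaped; straighten)

      -- The generating family is a variable so that this serves both inclusions, the second one
      -- also with G in place of F.
      in-ideal : (Gen : (N : ℕ) → Elem N → Set (u ⊔ ℓ)) {μ : List ℕ} (sub : μ ⊆ᵖ λ') →
        PreimageIsDiagram k λ' F μ →
        (∀ N v → TabloidGen μ (F ∘ incl {μ} {λ'} sub) N v → Gen N v) →
        (∀ a → length (filter (λ b → f b ℕ.≟ f a) (allFin N)) ≡ d) →
        (∀ π → StrictlyLeft π → Shaped π → Subspace._∋_ (IdealSubspace Gen f) (Y r c π)) →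
        InIdeal Gen N (tabloidElem λ' F T)
      in-ideal Gen {μ} sub diagram has sat shaped = Ideal-tabloid Gen λ' F T
        (Core.reduce r c in0 rc-injective left-closed left-closed₀ S (straighten S shaped)
          (λ ρ {Φ} → Ideal-translate Gen f ρ {Φ})
          (young₀∈ Gen F k sub diagram has T λ a _ → sat a))
        where
        S = IdealSubspace Gen f
        left-closed₀ : ∀ p j → in0 p ≡ true → j < c p → Σ (Fin N) λ w → in0 w ≡ true × c w ≡ j × r w ≡ r p
        left-closed₀ p j p∈ lt with left-closed p j lt
        ... | w , cw , rw = w
            , dec-true (f w ℕ.<? k) (Equivalence.from (diagram (Inverse.from T w))
                (≡.subst₂ _<_ (≡.sym cw) (cong (μ !_) (≡.sym rw))
                  (ℕₚ.<-trans lt (Equivalence.to (diagram (Inverse.from T p)) (does⇒ (f p ℕ.<? k) p∈)))))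
            , cw , rw

    module _ {n : ℕ} (F : Box λ' → ℕ) (tab : IsYoungTab d n λ' F) where

      open Stage F
      open Membership {k = k} {n} {d} part T F tab using (saturated; youngTab; diagram; in𝒢; F-def)

      moved : Perm N → Box λ' → ℕ
      moved π b = f (π ⟨$⟩ˡ Inverse.to T b)

      module _ {μ : List ℕ} (sub : μ ⊆ᵖ λ') (F-diagram : PreimageIsDiagram k λ' F μ) where

        generated-by-𝒢 : InIdeal (λ N v → TabloidGen μ (F ∘ incl {μ} {λ'} sub) N v
          ⊎ Σ (Box λ' → ℕ) (λ G → In𝒢 k n d λ' F G × TabloidGen λ' G N v)) N (tabloidElem λ' F T)
        generated-by-𝒢 = in-ideal _ sub F-diagram (λ _ _ → inj₁) saturated λ π left shaped →
          tabloid-translate _ λ' (moved π) T f π (λ a → cong (λ z → f (π ⟨$⟩ˡ z)) (Inverse.inverseˡ T ≡.refl))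
            (gen (inj₂ (moved π , in𝒢 π (moved π) (λ _ → ≡.refl) left shaped , lift (T , ≡.refl))))

        Gen₀ : (N : ℕ) → Elem N → Set (u ⊔ ℓ)
        Gen₀ N v = TabloidGen μ (F ∘ incl {μ} {λ'} sub) N v
          ⊎ Σ (Box λ' → ℕ) (λ G → In𝒢 k n d λ' F G
              × Σ (List ℕ) (λ δ → Σ (δ ⊆ᵖ λ') (λ subδ →
                  IsPartition δ × PreimageIsDiagram k λ' G δ × TabloidGen δ (G ∘ incl {δ} {λ'} subδ) N v)))

        -- Applying the first inclusion to G in place of F: the tableaux to the left of G are to the left of F.
        descend : ∀ π (G : Box λ' → ℕ) → (∀ b → G b ≡ moved π b) → Good π → pot π ≤ pot idₚ → Acc _<_ (pot π) →
          ∀ {δ} (subδ : δ ⊆ᵖ λ') → PreimageIsDiagram k λ' G δ →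
          (∀ N v → TabloidGen δ (G ∘ incl {δ} {λ'} subδ) N v → Gen₀ N v) → InIdeal Gen₀ N (tabloidElem λ' G T)
        descend π G G-def good le (acc rs) subδ G-diagram has = S.in-ideal Gen₀ subδ G-diagram has
            (Membership.saturated {k = k} {n} {d} part T G (youngTab π G G-def)) next
          where
          module S = Stage G
          f≡ : ∀ a → S.f a ≡ f (π ⟨$⟩ˡ a)
          f≡ a = ≡.trans (G-def _) (cong (λ z → f (π ⟨$⟩ˡ z)) (Inverse.inverseˡ T ≡.refl))
          in0≡ : ∀ a → S.in0 a ≡ in0 (π ⟨$⟩ˡ a)
          in0≡ a = cong (λ v → does (v ℕ.<? k)) (f≡ a)
          in0-π : ∀ s → S.in0 (π ⟨$⟩ʳ s) ≡ in0 s
          in0-π s = ≡.trans (in0≡ _) (cong in0 (inverseˡ π))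
          -- The potential of π′ relative to G is that of π′·π relative to F, so moving strictly
          -- left from G lowers the measure of the induction.
          pot≡ : ∀ π′ → pot (π′ · π) ≡ S.pot π′
          pot≡ π′ = moment-reindex c W0 S.W0 π′ π λ s → cong b2n (in0-π s)
          next : ∀ π′ → S.StrictlyLeft π′ → S.Shaped π′ → Subspace._∋_ (IdealSubspace Gen₀ S.f) (Y r c π′)
          next π′ left shaped = tabloid-translate Gen₀ λ' (moved π″) T S.f π′
              (λ a → ≡.trans (cong (λ z → f (π ⟨$⟩ˡ (π′ ⟨$⟩ˡ z))) (Inverse.inverseˡ T ≡.refl)) (≡.sym (f≡ _)))
              (descend π″ (moved π″) (λ _ → ≡.refl) good″ (ℕₚ.<⇒≤ pot″) (rs drop) (proj₁ (proj₂ (proj₂ δ″))) (proj₂ (proj₂ (proj₂ δ″)))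
                -- The restricted tabloid of the new tableau is a generator because this tableau
                -- belongs to the set 𝒢 of F itself.
                λ N v t → inj₂ (moved π″ , in𝒢 π″ (moved π″) (λ _ → ≡.refl) (good″ , pot″) shaped″
                  , proj₁ δ″ , proj₁ (proj₂ (proj₂ δ″)) , proj₁ (proj₂ δ″) , proj₂ (proj₂ (proj₂ δ″)) , t))
            where
            π″ : Perm N
            π″ = π′ · π
            good″ : Good π″
            good″ s s∈ = ℕₚ.≤-trans (proj₁ left (π ⟨$⟩ʳ s) (≡.trans (in0-π s) s∈)) (good s s∈)
            drop : pot π″ < pot π
            drop = ≡.subst₂ _<_ (≡.sym (pot≡ π′)) (≡.sym (pot≡ idₚ)) (proj₂ left)
            pot″ : pot π″ < pot idₚ
            pot″ = ℕₚ.<-≤-trans drop le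
            shaped″ : Shaped π″
            shaped″ a b o p q = ≡.trans (≡.sym (in0≡ _)) (shaped a b (≡.trans (in0≡ _) o) p q)
            δ″ = diagram π″ (moved π″) (λ _ → ≡.refl) shaped″

        generated-by-𝒢₀ : InIdeal Gen₀ N (tabloidElem λ' F T)
        -- At π = 1 the tableau is F, which is not strictly left of itself; this is why `descend`
        -- asks for weak inequalities.
        generated-by-𝒢₀ = descend idₚ F F-def (λ _ _ → ℕₚ.≤-refl) ℕₚ.≤-refl (<-wellFounded _) sub F-diagram (λ _ _ → inj₁)

open import Data.Nat using (_*_)

theorem3p4 : ∀ {c ℓ : Level} (K : Field c ℓ) → CharZero K →
    (k n d : ℕ) → 1 ≤ k → k ≤ n → 1 ≤ d →
    (λ' μ : List ℕ) → λ' ⊢ (n * d) → μ ⊢ (k * d) → (sub : μ ⊆ᵖ λ') →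
    (F : Box λ' → ℕ) → IsYoungTab d n λ' F →
    PreimageIsDiagram k λ' F μ →
    let open Algebra𝒮 K d in
    TabloidIn λ' F (λ N v → TabloidGen μ (F ∘ incl sub) N v
    ⊎ Σ (Box λ' → ℕ) (λ G → In𝒢 k n d λ' F G × TabloidGen λ' G N v))
    × TabloidIn λ' F (λ N v → TabloidGen μ (F ∘ incl sub) N v
    ⊎ Σ (Box λ' → ℕ) (λ G → In𝒢 k n d λ' F G
    × Σ (List ℕ) (λ δ → Σ (δ ⊆ᵖ λ') (λ subδ →
    IsPartition δ × PreimageIsDiagram k λ' G δ
    × TabloidGen δ (G ∘ incl subδ) N v))))
theorem3p4 K cz k n d _ _ _ λ' μ (part , _) _ sub F tab diagram =
    (λ N T → generated-by-𝒢 part T k F tab sub diagram)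
  , (λ N T → generated-by-𝒢₀ part T k F tab sub diagram)
  where open OverField K cz d
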